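{- Let $G$ be a finite group, and let $f:G \to \{\pm 1\}$ be a class function (i.e. $f(x^{ -1}yx) = f(y)$ for all $x,y \in G$) with $\mathbb{E}_{x \in G} f(x) = 0$. Then \[ \Pr_{x,y}\,[f(x)f(y) = f(xy)] \le \frac{1}{2}\left(1 + \frac{1}{d}\right), \] where $x,y$ are chosen uniformly and independently from $G$, and $d = \min_{\rho \ne 1} d_\rho$ is the minimum dimension of a nontrivial irreducible (complex) representation $\rho$ of $G$.
   Context: $d_\rho$ denotes the dimension of the representation $\rho$; the minimum is over nontrivial irreducible complex representations of $G$. $\mathbb{E}$ denotes the average over the uniform distribution on $G$. -}

module Defs where

open import Algebra.Bundles using (Group; RawRing)
import Algebra.Definitions.RawMonoid as RawMonoidDefs
open import Data.Fin.Base using (Fin)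
open import Data.Fin.Properties using (nonZeroIndex) renaming (_≟_ to _≟ᶠ_)
open import Data.Integer.Base using (+_; _◃_)
open import Data.List.Base as List using (List)
open import Data.Nat.Base as ℕ using (ℕ; NonZero)
import Data.Nat.Properties as ℕₚ
open import Data.Product using (∃-syntax; _×_; _,_; uncurry)
open import Data.Rational.Base as ℚ using (ℚ; 0ℚ; 1ℚ; ½)
import Data.Rational.Properties as ℚₚ
open import Data.Rational.Solver using (module +-*-Solver)
open import Data.Sign.Base using (Sign)
open import Data.Vec.Functional using (Vector)
open import Function.Bundles using (Inverse)
open import Level using (Level; _⊔_; 0ℓ) renaming (suc to lsuc)
open import Relation.Binary.Definitions using (Decidable)
open import Relation.Binary.PropositionalEquality
  using (_≡_; refl; sym; cong; subst; module ≡-Reasoning)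
  renaming (setoid to ≡-setoid)
open import Relation.Nullary.Decidable using (does)
open import Data.Bool.Base using (if_then_else_)
open import Relation.Nullary.Negation using (¬_)

------------------------------------------------------------------------
-- Real numbers: Cauchy sequences of rationals modulo null sequences

IsCauchy : (ℕ → ℚ) → Set
IsCauchy s = ∀ ε → 0ℚ ℚ.< ε →
  ∃[ N ] ∀ m n → N ℕ.≤ m → N ℕ.≤ n → ℚ.∣ s m ℚ.- s n ∣ ℚ.< ε

IsNull : (ℕ → ℚ) → Set
IsNull s = ∀ ε → 0ℚ ℚ.< ε → ∃[ N ] ∀ n → N ℕ.≤ n → ℚ.∣ s n ∣ ℚ.< ε

record ℝ : Set where
  constructor mkℝ
  field
    seq    : ℕ → ℚ
    cauchy : IsCauchy seq

open ℝ public

infix 4 _≈ℝ_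

record _≈ℝ_ (x y : ℝ) : Set where
  constructor mk≈ℝ
  field
    null : IsNull (λ n → seq x n ℚ.- seq y n)

-- Abstract because nothing depends on the values of the moduli, and
-- unfolding them makes type checking very slow.
private abstract
  half : ∀ {ε} → 0ℚ ℚ.< ε → 0ℚ ℚ.< ε ℚ.* ½
  half {ε} 0<ε = subst (ℚ._< ε ℚ.* ½) (ℚₚ.*-zeroˡ ½) (ℚₚ.*-monoˡ-<-pos ½ 0<ε)

  half+half : ∀ ε → ε ℚ.* ½ ℚ.+ ε ℚ.* ½ ≡ ε
  half+half ε = begin
    ε ℚ.* ½ ℚ.+ ε ℚ.* ½  ≡⟨ ℚₚ.*-distribˡ-+ ε ½ ½ ⟨
    ε ℚ.* (½ ℚ.+ ½)      ≡⟨ ℚₚ.*-identityʳ ε ⟩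
    ε                    ∎
    where open ≡-Reasoning

  const-cauchy : ∀ q → IsCauchy (λ _ → q)
  const-cauchy q ε 0<ε = 0 , λ _ _ _ _ →
    subst (λ d → ℚ.∣ d ∣ ℚ.< ε) (sym (ℚₚ.+-inverseʳ q)) 0<ε

  +-cauchy : ∀ {s t} → IsCauchy s → IsCauchy t → IsCauchy (λ n → s n ℚ.+ t n)
  +-cauchy {s} {t} cs ct ε 0<ε
    with cs (ε ℚ.* ½) (half 0<ε) | ct (ε ℚ.* ½) (half 0<ε)
  ... | N₁ , p | N₂ , q = N₁ ℕ.⊔ N₂ , λ m n N≤m N≤n → begin-strict
    ℚ.∣ (s m ℚ.+ t m) ℚ.- (s n ℚ.+ t n) ∣
      ≡⟨ cong ℚ.∣_∣ (regroup (s m) (t m) (s n) (t n)) ⟩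
    ℚ.∣ (s m ℚ.- s n) ℚ.+ (t m ℚ.- t n) ∣
      ≤⟨ ℚₚ.∣p+q∣≤∣p∣+∣q∣ (s m ℚ.- s n) (t m ℚ.- t n) ⟩
    ℚ.∣ s m ℚ.- s n ∣ ℚ.+ ℚ.∣ t m ℚ.- t n ∣
      <⟨ ℚₚ.+-mono-<
           (p m n (ℕₚ.m⊔n≤o⇒m≤o N₁ N₂ N≤m) (ℕₚ.m⊔n≤o⇒m≤o N₁ N₂ N≤n))
           (q m n (ℕₚ.m⊔n≤o⇒n≤o N₁ N₂ N≤m) (ℕₚ.m⊔n≤o⇒n≤o N₁ N₂ N≤n)) ⟩
    ε ℚ.* ½ ℚ.+ ε ℚ.* ½
      ≡⟨ half+half ε ⟩
    ε ∎
    where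
    open ℚₚ.≤-Reasoning
    regroup : ∀ a b c d →
      (a ℚ.+ b) ℚ.- (c ℚ.+ d) ≡ (a ℚ.- c) ℚ.+ (b ℚ.- d)
    regroup = solve 4 (λ a b c d →
      (a :+ b) :- (c :+ d) := (a :- c) :+ (b :- d)) refl
      where open +-*-Solver

  neg-cauchy : ∀ {s} → IsCauchy s → IsCauchy (λ n → ℚ.- s n)
  neg-cauchy {s} cs ε 0<ε with cs ε 0<ε
  ... | N , p = N , λ m n N≤m N≤n →
    subst (ℚ._< ε) (flip-sign (s m) (s n)) (p m n N≤m N≤n)
    where
    open ≡-Reasoning
    flip-sign : ∀ a b → ℚ.∣ a ℚ.- b ∣ ≡ ℚ.∣ (ℚ.- a) ℚ.- (ℚ.- b) ∣
    flip-sign a b = begin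
      ℚ.∣ a ℚ.- b ∣              ≡⟨ ℚₚ.∣-p∣≡∣p∣ (a ℚ.- b) ⟨
      ℚ.∣ ℚ.- (a ℚ.- b) ∣        ≡⟨ cong ℚ.∣_∣ (ℚₚ.neg-distrib-+ a (ℚ.- b)) ⟩
      ℚ.∣ (ℚ.- a) ℚ.- (ℚ.- b) ∣  ∎

  eventually-bounded : ∀ {s} → IsCauchy s →
    ∃[ B ] ∃[ N ] (0ℚ ℚ.< B × (∀ n → N ℕ.≤ n → ℚ.∣ s n ∣ ℚ.< B))
  eventually-bounded {s} cs with cs 1ℚ (ℚₚ.positive⁻¹ 1ℚ)
  ... | N , p = 1ℚ ℚ.+ ℚ.∣ s N ∣ , N , 0<B , λ n N≤n → begin-strict
    ℚ.∣ s n ∣                          ≡⟨ cong ℚ.∣_∣ (split (s n) (s N)) ⟩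
    ℚ.∣ (s n ℚ.- s N) ℚ.+ s N ∣        ≤⟨ ℚₚ.∣p+q∣≤∣p∣+∣q∣ (s n ℚ.- s N) (s N) ⟩
    ℚ.∣ s n ℚ.- s N ∣ ℚ.+ ℚ.∣ s N ∣    <⟨ ℚₚ.+-monoˡ-< ℚ.∣ s N ∣ (p n N N≤n ℕₚ.≤-refl) ⟩
    1ℚ ℚ.+ ℚ.∣ s N ∣                   ∎
    where
    open ℚₚ.≤-Reasoning
    0<B : 0ℚ ℚ.< 1ℚ ℚ.+ ℚ.∣ s N ∣
    0<B = ℚₚ.+-mono-<-≤ (ℚₚ.positive⁻¹ 1ℚ) (ℚₚ.0≤∣p∣ (s N))
    split : ∀ a b → a ≡ (a ℚ.- b) ℚ.+ b
    split = solve 2 (λ a b → a := (a :- b) :+ b) refl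
      where open +-*-Solver

  divide : ∀ {C ε} → 0ℚ ℚ.< C → 0ℚ ℚ.< ε → ∃[ δ ] (0ℚ ℚ.< δ × C ℚ.* δ ≡ ε)
  divide {C} {ε} 0<C 0<ε = δ , 0<δ , Cδ≡ε
    where
    instance
      C-positive : ℚ.Positive C
      C-positive = ℚ.positive 0<C
      C-nonZero : ℚ.NonZero C
      C-nonZero = ℚₚ.pos⇒nonZero C
      1/C-positive : ℚ.Positive (ℚ.1/ C)
      1/C-positive = ℚₚ.1/pos⇒pos C
    δ : ℚ
    δ = ℚ.1/ C ℚ.* ε
    0<δ : 0ℚ ℚ.< δ
    0<δ = subst (ℚ._< δ) (ℚₚ.*-zeroʳ (ℚ.1/ C)) (ℚₚ.*-monoʳ-<-pos (ℚ.1/ C) 0<ε)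
    open ≡-Reasoning
    Cδ≡ε : C ℚ.* δ ≡ ε
    Cδ≡ε = begin
      C ℚ.* (ℚ.1/ C ℚ.* ε)  ≡⟨ ℚₚ.*-assoc C (ℚ.1/ C) ε ⟨
      C ℚ.* ℚ.1/ C ℚ.* ε    ≡⟨ cong (ℚ._* ε) (ℚₚ.*-inverseʳ C) ⟩
      1ℚ ℚ.* ε              ≡⟨ ℚₚ.*-identityˡ ε ⟩
      ε                     ∎

  product-bound : ∀ a b {K η} → 0ℚ ℚ.< K → ℚ.∣ a ∣ ℚ.< K → ℚ.∣ b ∣ ℚ.< η →
                  ℚ.∣ a ℚ.* b ∣ ℚ.< K ℚ.* η
  product-bound a b {K} {η} 0<K ∣a∣<K ∣b∣<η = begin-strict
    ℚ.∣ a ℚ.* b ∣        ≡⟨ ℚₚ.∣p*q∣≡∣p∣*∣q∣ a b ⟩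
    ℚ.∣ a ∣ ℚ.* ℚ.∣ b ∣  ≤⟨ ℚₚ.*-monoʳ-≤-nonNeg ℚ.∣ b ∣
                              {{ℚ.nonNegative (ℚₚ.0≤∣p∣ b)}} (ℚₚ.<⇒≤ ∣a∣<K) ⟩
    K ℚ.* ℚ.∣ b ∣        <⟨ ℚₚ.*-monoʳ-<-pos K {{ℚ.positive 0<K}} ∣b∣<η ⟩
    K ℚ.* η              ∎
    where open ℚₚ.≤-Reasoning

  product-difference : ∀ a b c d {A B δ} → 0ℚ ℚ.< A → 0ℚ ℚ.< B →
    ℚ.∣ a ∣ ℚ.< A → ℚ.∣ d ∣ ℚ.< B →
    ℚ.∣ a ℚ.- c ∣ ℚ.< δ → ℚ.∣ b ℚ.- d ∣ ℚ.< δ →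
    ℚ.∣ a ℚ.* b ℚ.- c ℚ.* d ∣ ℚ.< (A ℚ.+ B) ℚ.* δ
  product-difference a b c d {A} {B} {δ} 0<A 0<B ∣a∣<A ∣d∣<B a~c b~d = begin-strict
    ℚ.∣ a ℚ.* b ℚ.- c ℚ.* d ∣
      ≡⟨ cong ℚ.∣_∣ (regroup a b c d) ⟩
    ℚ.∣ a ℚ.* (b ℚ.- d) ℚ.+ d ℚ.* (a ℚ.- c) ∣
      ≤⟨ ℚₚ.∣p+q∣≤∣p∣+∣q∣ (a ℚ.* (b ℚ.- d)) (d ℚ.* (a ℚ.- c)) ⟩
    ℚ.∣ a ℚ.* (b ℚ.- d) ∣ ℚ.+ ℚ.∣ d ℚ.* (a ℚ.- c) ∣
      <⟨ ℚₚ.+-mono-< (product-bound a (b ℚ.- d) 0<A ∣a∣<A b~d)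
                     (product-bound d (a ℚ.- c) 0<B ∣d∣<B a~c) ⟩
    A ℚ.* δ ℚ.+ B ℚ.* δ
      ≡⟨ ℚₚ.*-distribʳ-+ δ A B ⟨
    (A ℚ.+ B) ℚ.* δ ∎
    where
    open ℚₚ.≤-Reasoning
    regroup : ∀ a b c d →
      a ℚ.* b ℚ.- c ℚ.* d ≡ a ℚ.* (b ℚ.- d) ℚ.+ d ℚ.* (a ℚ.- c)
    regroup = solve 4 (λ a b c d →
      a :* b :- c :* d := a :* (b :- d) :+ d :* (a :- c)) refl
      where open +-*-Solver

  split-⊔ : ∀ a b c d {k} → (a ℕ.⊔ b) ℕ.⊔ (c ℕ.⊔ d) ℕ.≤ k →
            (a ℕ.≤ k × b ℕ.≤ k) × (c ℕ.≤ k × d ℕ.≤ k)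
  split-⊔ a b c d le =
    let l = ℕₚ.m⊔n≤o⇒m≤o (a ℕ.⊔ b) (c ℕ.⊔ d) le
        r = ℕₚ.m⊔n≤o⇒n≤o (a ℕ.⊔ b) (c ℕ.⊔ d) le
    in (ℕₚ.m⊔n≤o⇒m≤o a b l , ℕₚ.m⊔n≤o⇒n≤o a b l)
     , (ℕₚ.m⊔n≤o⇒m≤o c d r , ℕₚ.m⊔n≤o⇒n≤o c d r)

  *-cauchy : ∀ {s t} → IsCauchy s → IsCauchy t → IsCauchy (λ n → s n ℚ.* t n)
  *-cauchy {s} {t} cs ct ε 0<ε =
    let
      A , N₁ , 0<A , s<A = eventually-bounded {s} cs
      B , N₂ , 0<B , t<B = eventually-bounded {t} ct
      δ , 0<δ , [A+B]δ≡ε = divide (ℚₚ.+-mono-< 0<A 0<B) 0<ε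
      N₃ , p             = cs δ 0<δ
      N₄ , q             = ct δ 0<δ
    in
    (N₁ ℕ.⊔ N₂) ℕ.⊔ (N₃ ℕ.⊔ N₄) , λ m n N≤m N≤n →
      let
        (N₁≤m , _) , N₃≤m , N₄≤m = split-⊔ N₁ N₂ N₃ N₄ N≤m
        (_ , N₂≤n) , N₃≤n , N₄≤n = split-⊔ N₁ N₂ N₃ N₄ N≤n
      in
      subst (ℚ.∣ s m ℚ.* t m ℚ.- s n ℚ.* t n ∣ ℚ.<_) [A+B]δ≡ε
        (product-difference (s m) (t m) (s n) (t n) 0<A 0<B
          (s<A m N₁≤m) (t<B n N₂≤n) (p m n N₃≤m N₃≤n) (q m n N₄≤m N₄≤n))

infix  8 -ℝ_
infixl 7 _*ℝ_
infixl 6 _+ℝ_ _-ℝ_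

fromℚ : ℚ → ℝ
fromℚ q = mkℝ (λ _ → q) (const-cauchy q)

0ℝ 1ℝ : ℝ
0ℝ = fromℚ 0ℚ
1ℝ = fromℚ 1ℚ

_+ℝ_ _*ℝ_ : ℝ → ℝ → ℝ
mkℝ s cs +ℝ mkℝ t ct = mkℝ (λ n → s n ℚ.+ t n) (+-cauchy {s} {t} cs ct)
mkℝ s cs *ℝ mkℝ t ct = mkℝ (λ n → s n ℚ.* t n) (*-cauchy {s} {t} cs ct)

-ℝ_ : ℝ → ℝ
-ℝ_ (mkℝ s cs) = mkℝ (λ n → ℚ.- s n) (neg-cauchy {s} cs)

_-ℝ_ : ℝ → ℝ → ℝ
x -ℝ y = x +ℝ (-ℝ y)

------------------------------------------------------------------------
-- Complex numbers

record ℂ : Set where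
  constructor _+i_
  field
    re im : ℝ

open ℂ public

infix 4 _≈ℂ_

record _≈ℂ_ (z w : ℂ) : Set where
  constructor mk≈ℂ
  field
    re-≈ : re z ≈ℝ re w
    im-≈ : im z ≈ℝ im w

ℂ-rawRing : RawRing 0ℓ 0ℓ
ℂ-rawRing = record
  { Carrier = ℂ
  ; _≈_     = _≈ℂ_
  ; _+_     = λ z w → (re z +ℝ re w) +i (im z +ℝ im w)
  ; _*_     = λ z w → (re z *ℝ re w -ℝ im z *ℝ im w)
                   +i (re z *ℝ im w +ℝ im z *ℝ re w)
  ; -_      = λ z → (-ℝ re z) +i (-ℝ im z)
  ; 0#      = 0ℝ +i 0ℝ
  ; 1#      = 1ℝ +i 0ℝ
  }

private
  module C = RawRing ℂ-rawRing

------------------------------------------------------------------------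
-- Vectors and square matrices over ℂ

Σℂ : ∀ {n} → Vector ℂ n → ℂ
Σℂ = RawMonoidDefs.sum C.+-rawMonoid

Matrix : ℕ → Set
Matrix n = Fin n → Fin n → ℂ

infix 4 _≈ᵐ_ _≈ᵛ_

_≈ᵛ_ : ∀ {n} → Vector ℂ n → Vector ℂ n → Set
v ≈ᵛ w = ∀ i → v i ≈ℂ w i

_≈ᵐ_ : ∀ {n} → Matrix n → Matrix n → Set
M ≈ᵐ N = ∀ i j → M i j ≈ℂ N i j

0ᵛ : ∀ {n} → Vector ℂ n
0ᵛ _ = C.0#

infixl 6 _+ᵛ_
_+ᵛ_ : ∀ {n} → Vector ℂ n → Vector ℂ n → Vector ℂ n
(v +ᵛ w) i = v i C.+ w i

infixr 7 _*ᵛ_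
_*ᵛ_ : ∀ {n} → ℂ → Vector ℂ n → Vector ℂ n
(c *ᵛ v) i = c C.* v i

1ᵐ : ∀ {n} → Matrix n
1ᵐ i j = if does (i ≟ᶠ j) then C.1# else C.0#

infixl 7 _*ᵐ_ _·_
_*ᵐ_ : ∀ {n} → Matrix n → Matrix n → Matrix n
(M *ᵐ N) i k = Σℂ λ j → M i j C.* N j k

_·_ : ∀ {n} → Matrix n → Vector ℂ n → Vector ℂ n
(M · v) i = Σℂ λ j → M i j C.* v j

------------------------------------------------------------------------
-- Finite groups, with uniform averages and probabilities

record FiniteGroup (c ℓ : Level) : Set (lsuc (c ⊔ ℓ)) where
  field
    group       : Group c ℓ
    order       : ℕ
    enumeration : Inverse (≡-setoid (Fin order)) (Group.setoid group)

  open Group group public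
  open Inverse enumeration public using () renaming (to to element; from to index)

  instance
    order-nonZero : NonZero order
    order-nonZero = nonZeroIndex (index ε)

    order²-nonZero : NonZero (order ℕ.* order)
    order²-nonZero = ℕₚ.m*n≢0 order order

  elements : List Carrier
  elements = List.tabulate element

  𝔼 : (Carrier → ℚ) → ℚ
  𝔼 g = List.foldr ℚ._+_ 0ℚ (List.map g elements) ℚ.* (+ 1 ℚ./ order)

  -- Probability of a binary event for independent uniform x and y.
  Pr : ∀ {p} {P : Carrier → Carrier → Set p} → Decidable P → ℚ
  Pr P? = + List.length (List.filter (uncurry P?) (List.cartesianProduct elements elements))
          ℚ./ (order ℕ.* order)

-- The elements of {±1} are represented by the two-element type Sign.
toℚ : Sign → ℚ
toℚ s = (s ◃ 1) ℚ./ 1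

record IsClassFunction {c ℓ} (G : FiniteGroup c ℓ)
                       (f : FiniteGroup.Carrier G → Sign) : Set (c ⊔ ℓ) where
  open FiniteGroup G
  field
    f-cong       : ∀ {x y} → x ≈ y → f x ≡ f y
    f-conjugacy  : ∀ x y → f (x ⁻¹ ∙ y ∙ x) ≡ f y

------------------------------------------------------------------------
-- Complex representations

record Representation {c ℓ} (G : FiniteGroup c ℓ) (n : ℕ) : Set (c ⊔ ℓ) where
  open FiniteGroup G
  field
    ρ      : Carrier → Matrix n
    ρ-cong : ∀ {x y} → x ≈ y → ρ x ≈ᵐ ρ y
    ρ-ε    : ρ ε ≈ᵐ 1ᵐ
    ρ-∙    : ∀ x y → ρ (x ∙ y) ≈ᵐ ρ x *ᵐ ρ y

module _ {c ℓ} {G : FiniteGroup c ℓ} {n : ℕ} (R : Representation G n) where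
  open FiniteGroup G using (Carrier)
  open Representation R

  record IsInvariantSubspace (P : Vector ℂ n → Set) : Set c where
    field
      resp     : ∀ {v w} → v ≈ᵛ w → P v → P w
      zero∈    : P 0ᵛ
      +-closed : ∀ {v w} → P v → P w → P (v +ᵛ w)
      *-closed : ∀ a {v} → P v → P (a *ᵛ v)
      ρ-closed : ∀ g {v} → P v → P (ρ g · v)

  -- "Each invariant subspace is zero or everything" with that disjunction
  -- read as ¬ (¬ A × ¬ B): as P need not be decidable, no representation
  -- could constructively be proved irreducible with A ⊎ B.
  record IsIrreducible : Set (c ⊔ lsuc 0ℓ) where
    field
      n-nonZero : NonZero n
      no-proper : ∀ P → IsInvariantSubspace P →
        ¬ (¬ (∀ v → P v → v ≈ᵛ 0ᵛ) × ¬ (∀ v → P v))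

  -- For irreducible R this says that R is the one-dimensional
  -- representation 1.
  IsTrivial : Set c
  IsTrivial = ∀ g → ρ g ≈ᵐ 1ᵐ

record NontrivialIrrep {c ℓ} (G : FiniteGroup c ℓ) (n : ℕ) : Set (c ⊔ ℓ ⊔ lsuc 0ℓ) where
  field
    rep         : Representation G n
    irreducible : IsIrreducible rep
    nontrivial  : ¬ IsTrivial rep

IsMinNontrivialDim : ∀ {c ℓ} → FiniteGroup c ℓ → ℕ → Set (c ⊔ ℓ ⊔ lsuc 0ℓ)
IsMinNontrivialDim G d =
  NontrivialIrrep G d × (∀ {e} → NontrivialIrrep G e → d ℕ.≤ e)

minDim-nonZero : ∀ {c ℓ} {G : FiniteGroup c ℓ} {d} →
                 IsMinNontrivialDim G d → NonZero d
minDim-nonZero (R , _) = IsIrreducible.n-nonZero (NontrivialIrrep.irreducible R)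

{-# OPTIONS --safe #-}
module Submission where

-- The class function f is a central element of the group algebra ℂ[G], with N(f) = |G| in the
-- standard inner product, and ∑ f(x) f(y) f(xy) = ⟪ f ⊛ f , f ⟫.  On a minimal left ideal ℂ[G]p
-- of dimension e, given by a primitive projection p, f acts as a scalar λ; comparing f with the
-- character of the ideal, which has norm |G|, gives 2 Re(λ) e ≤ 2 |G|.  If ∑ p = 0 the ideal is a
-- nontrivial irreducible representation, so that e ≥ d.  Decomposing 1 - (1/|G|) ∑ g into
-- primitive projections bounds ⟪ f ⊛ f , f ⟫ by |G|²/d.
--
-- A projection p that is not primitive splits because some Hermitian g = pg has g² not in ℂp:
-- then the largest eigenvalue of g² has a proper eigenprojection below p.  That eigenvalue has to be
-- a Cauchy sequence; it is computed by trisection, as N(g^2ʲ) locates the norm of g.  Every other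
-- case distinction happens under a double negation, which the rational inequality to be proved
-- allows to eliminate.

open import Defs
open import Algebra.Bundles using (CommutativeRing; Group; RawRing; Ring)
import Algebra.Definitions.RawMonoid as RawMonoidDefs
import Algebra.Properties.Group
import Algebra.Properties.Ring
import Algebra.Properties.Semiring.Sum
import Algebra.Solver.Ring
open import Algebra.Solver.Ring.AlmostCommutativeRing using (fromCommutativeRing; _-Raw-AlmostCommutative⟶_)
open import Algebra.Structures using (IsGroup)
open import Data.Bool.Base using (if_then_else_)
open import Data.Empty using (⊥-elim)
open import Data.Fin.Base using (Fin; zero; suc)
open import Data.Fin.Permutation using (Permutation; permutation; _⟨$⟩ʳ_)
open import Data.Fin.Properties using (nonZeroIndex) renaming (_≟_ to _≟ᶠ_)
open import Data.Integer.Base as ℤ using (+_)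
import Data.Integer.Properties as ℤₚ
open import Data.List.Base as List using (List; []; _∷_; _++_)
import Data.List.Properties as Listₚ
open import Data.Maybe.Base using (Maybe; just; nothing)
open import Data.Nat.Base as ℕ using (ℕ; zero; suc)
import Data.Nat.Properties as ℕₚ
open import Data.Product using (∃-syntax; Σ-syntax; _×_; _,_; proj₁; proj₂; uncurry)
open import Data.Rational.Base as ℚ using (ℚ; 0ℚ; 1ℚ; ½)
import Data.Rational.Properties as ℚₚ
open import Data.Rational.Solver using (module +-*-Solver)
import Data.Rational.Unnormalised.Base as ℚᵘ
import Data.Rational.Unnormalised.Properties as ℚᵘₚ
open import Data.Sign.Base as Sign using (Sign)
import Data.Sign.Properties as Signₚ
open import Data.Sum.Base as Sum using (_⊎_; inj₁; inj₂)
open import Function.Base using (_∘_)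
open import Function.Bundles using (Inverse)
open import Level using (0ℓ)
import Relation.Binary.Reasoning.Setoid as SetoidReasoning
open import Relation.Binary.PropositionalEquality as ≡ using (_≡_; cong; cong₂; subst)
open import Relation.Nullary using (¬_; yes; no; does)
open import Relation.Unary using (Decidable; Pred)

-- Double negation fails in one place: a real number is a function on ℕ, and infinitely many choices
-- made under a double negation cannot be collected into one function. So the norm of g must be
-- computed outright, whereas Gram-Schmidt, inverses, ranks and the search for a splitting g make
-- finitely many choices each.
--
-- The decomposition of 1 - J, where J = (1/|G|) ∑ g, is never formed as a list. Let κ = 2|G|/d, and
-- let `φ` be the element with τ(φp) = (κ - 2 Re λ) |λ|² τ(p) whenever f acts on p as λ. On a
-- primitive p with ∑ p = 0 this is nonnegative by the bound on Re λ. As τ(φ ·) is additive,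
-- nonnegativity passes from r and p - r to p, by induction on the rank, and reaches 1 - J. There
-- the value is κ |G| - 2 Re ⟪ f ⊛ f , f ⟫, because ∑ f = 0 gives τ(φJ) = 0.
--
-- The rank is the dimension of the left ideal and equals |G| τ(p), so it is additive along a
-- splitting. Orthogonal projections onto left ideals commute with left translation, hence are right
-- multiplications; this is where every self-adjoint idempotent comes from, the eigenprojection
-- included.

-- Rational inequalities

module Rationals where
  open ≡ using (refl)
  open +-*-Solver

  private variable p q r ε : ℚ

  <-offset : 0ℚ ℚ.< r → q ≡ p ℚ.+ r → p ℚ.< q
  <-offset {r} {q} {p} 0<r eq =
    ≡.subst₂ ℚ._<_ (ℚₚ.+-identityʳ p) (≡.sym eq) (ℚₚ.+-monoʳ-< p 0<r)

  ≤-offset : 0ℚ ℚ.≤ r → q ≡ p ℚ.+ r → p ℚ.≤ q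
  ≤-offset {r} {q} {p} 0≤r eq =
    ≡.subst₂ ℚ._≤_ (ℚₚ.+-identityʳ p) (≡.sym eq) (ℚₚ.+-monoʳ-≤ p 0≤r)

  p<q⇒0<q-p : p ℚ.< q → 0ℚ ℚ.< q ℚ.- p
  p<q⇒0<q-p {p} {q} p<q =
    subst (ℚ._< q ℚ.- p) (ℚₚ.+-inverseʳ p) (ℚₚ.+-monoˡ-< (ℚ.- p) p<q)

  p≤q⇒0≤q-p : p ℚ.≤ q → 0ℚ ℚ.≤ q ℚ.- p
  p≤q⇒0≤q-p {p} {q} p≤q =
    subst (ℚ._≤ q ℚ.- p) (ℚₚ.+-inverseʳ p) (ℚₚ.+-monoˡ-≤ (ℚ.- p) p≤q)

  0<p+q : 0ℚ ℚ.< p → 0ℚ ℚ.< q → 0ℚ ℚ.< p ℚ.+ q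
  0<p+q = ℚₚ.+-mono-<

  0≤p+q : 0ℚ ℚ.≤ p → 0ℚ ℚ.≤ q → 0ℚ ℚ.≤ p ℚ.+ q
  0≤p+q = ℚₚ.+-mono-≤

  0<p*q : 0ℚ ℚ.< p → 0ℚ ℚ.< q → 0ℚ ℚ.< p ℚ.* q
  0<p*q {p} {q} 0<p 0<q =
    ℚₚ.positive⁻¹ (p ℚ.* q) {{ℚₚ.pos*pos⇒pos p {{ℚ.positive 0<p}} q {{ℚ.positive 0<q}}}}

  0≤p*q : 0ℚ ℚ.≤ p → 0ℚ ℚ.≤ q → 0ℚ ℚ.≤ p ℚ.* q
  0≤p*q {p} {q} 0≤p 0≤q = ℚₚ.nonNegative⁻¹ (p ℚ.* q)
    {{ℚₚ.nonNeg*nonNeg⇒nonNeg p {{ℚ.nonNegative 0≤p}} q {{ℚ.nonNegative 0≤q}}}}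

  0<½ : 0ℚ ℚ.< ½
  0<½ = ℚₚ.positive⁻¹ ½

  0<1 : 0ℚ ℚ.< 1ℚ
  0<1 = ℚₚ.positive⁻¹ 1ℚ

  0<p*½ : 0ℚ ℚ.< p → 0ℚ ℚ.< p ℚ.* ½
  0<p*½ 0<p = 0<p*q 0<p 0<½

  ∣∣-< : ℚ.- ε ℚ.< p → p ℚ.< ε → ℚ.∣ p ∣ ℚ.< ε
  ∣∣-< {ε} {p} -ε<p p<ε with ℚₚ.∣p∣≡p∨∣p∣≡-p p
  ... | inj₁ eq = subst (ℚ._< ε) (≡.sym eq) p<ε
  ... | inj₂ eq = subst (ℚ._< ε) (≡.sym eq)
    (<-offset (p<q⇒0<q-p -ε<p) (solve 2 (λ e p → e := (:- p) :+ (p :- (:- e))) refl ε p))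

  p≤∣p∣ : ∀ p → p ℚ.≤ ℚ.∣ p ∣
  p≤∣p∣ p with ℚₚ.≤-total 0ℚ p
  ... | inj₁ 0≤p = ℚₚ.≤-reflexive (≡.sym (ℚₚ.0≤p⇒∣p∣≡p 0≤p))
  ... | inj₂ p≤0 = ℚₚ.≤-trans p≤0 (ℚₚ.0≤∣p∣ p)

  -p≤∣p∣ : ∀ p → ℚ.- p ℚ.≤ ℚ.∣ p ∣
  -p≤∣p∣ p = subst (ℚ.- p ℚ.≤_) (ℚₚ.∣-p∣≡∣p∣ p) (p≤∣p∣ (ℚ.- p))

  ∣p-q∣<ε⇒q-ε<p : ∀ p q → ℚ.∣ p ℚ.- q ∣ ℚ.< ε → q ℚ.- ε ℚ.< p
  ∣p-q∣<ε⇒q-ε<p {ε} p q h =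
    <-offset (p<q⇒0<q-p (ℚₚ.≤-<-trans (-p≤∣p∣ (p ℚ.- q)) h))
      (solve 3 (λ p q e → p := (q :- e) :+ (e :- (:- (p :- q)))) refl p q ε)

  ∣p-q∣<ε⇒p<q+ε : ∀ p q → ℚ.∣ p ℚ.- q ∣ ℚ.< ε → p ℚ.< q ℚ.+ ε
  ∣p-q∣<ε⇒p<q+ε {ε} p q h =
    <-offset (p<q⇒0<q-p (ℚₚ.≤-<-trans (p≤∣p∣ (p ℚ.- q)) h))
      (solve 3 (λ p q e → q :+ e := p :+ (e :- (p :- q))) refl p q ε)

  abstract
    divide : 0ℚ ℚ.< p → 0ℚ ℚ.< ε → ∃[ δ ] (0ℚ ℚ.< δ × p ℚ.* δ ≡ ε)
    divide {C} {ε} 0<C 0<ε = δ , 0<p*q 0<1/C 0<ε , Cδ≡ε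
      where
      instance
        C-positive : ℚ.Positive C
        C-positive = ℚ.positive 0<C
        C-nonZero : ℚ.NonZero C
        C-nonZero = ℚₚ.pos⇒nonZero C
        1/C-positive : ℚ.Positive (ℚ.1/ C)
        1/C-positive = ℚₚ.1/pos⇒pos C
      0<1/C : 0ℚ ℚ.< ℚ.1/ C
      0<1/C = ℚₚ.positive⁻¹ (ℚ.1/ C)
      δ : ℚ
      δ = ℚ.1/ C ℚ.* ε
      open ≡.≡-Reasoning
      Cδ≡ε : C ℚ.* δ ≡ ε
      Cδ≡ε = begin
        C ℚ.* (ℚ.1/ C ℚ.* ε)  ≡⟨ ℚₚ.*-assoc C (ℚ.1/ C) ε ⟨
        C ℚ.* ℚ.1/ C ℚ.* ε    ≡⟨ cong (ℚ._* ε) (ℚₚ.*-inverseʳ C) ⟩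
        1ℚ ℚ.* ε              ≡⟨ ℚₚ.*-identityˡ ε ⟩
        ε                     ∎

  ∣p*q∣< : ∀ p q {K η} → 0ℚ ℚ.< K → ℚ.∣ p ∣ ℚ.< K → ℚ.∣ q ∣ ℚ.< η →
           ℚ.∣ p ℚ.* q ∣ ℚ.< K ℚ.* η
  ∣p*q∣< a b {K} {η} 0<K ∣a∣<K ∣b∣<η = begin-strict
    ℚ.∣ a ℚ.* b ∣        ≡⟨ ℚₚ.∣p*q∣≡∣p∣*∣q∣ a b ⟩
    ℚ.∣ a ∣ ℚ.* ℚ.∣ b ∣  ≤⟨ ℚₚ.*-monoʳ-≤-nonNeg ℚ.∣ b ∣
                              {{ℚ.nonNegative (ℚₚ.0≤∣p∣ b)}} (ℚₚ.<⇒≤ ∣a∣<K) ⟩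
    K ℚ.* ℚ.∣ b ∣        <⟨ ℚₚ.*-monoʳ-<-pos K {{ℚ.positive 0<K}} ∣b∣<η ⟩
    K ℚ.* η              ∎
    where open ℚₚ.≤-Reasoning

-- Null sequences

module NullSequences where
  open Rationals
  open ≡ using (refl)
  open +-*-Solver

  private variable s t u : ℕ → ℚ

  null-resp : (∀ n → s n ≡ t n) → IsNull s → IsNull t
  null-resp s≡t ns ε 0<ε with ns ε 0<ε
  ... | N , p = N , λ n N≤n → subst (λ a → ℚ.∣ a ∣ ℚ.< ε) (s≡t n) (p n N≤n)

  null-0 : (∀ n → s n ≡ 0ℚ) → IsNull s
  null-0 s≡0 ε 0<ε = 0 , λ n _ → subst (λ a → ℚ.∣ a ∣ ℚ.< ε) (≡.sym (s≡0 n)) 0<ε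

  null-neg : IsNull s → IsNull (λ n → ℚ.- s n)
  null-neg {s} ns ε 0<ε with ns ε 0<ε
  ... | N , p = N , λ n N≤n → subst (ℚ._< ε) (≡.sym (ℚₚ.∣-p∣≡∣p∣ (s n))) (p n N≤n)

  null-+ : IsNull s → IsNull t → IsNull (λ n → s n ℚ.+ t n)
  null-+ {s} {t} ns nt ε 0<ε with ns (ε ℚ.* ½) (0<p*½ 0<ε) | nt (ε ℚ.* ½) (0<p*½ 0<ε)
  ... | N , p | M , q = N ℕ.⊔ M , λ n le → begin-strict
    ℚ.∣ s n ℚ.+ t n ∣          ≤⟨ ℚₚ.∣p+q∣≤∣p∣+∣q∣ (s n) (t n) ⟩
    ℚ.∣ s n ∣ ℚ.+ ℚ.∣ t n ∣    <⟨ ℚₚ.+-mono-< (p n (ℕₚ.m⊔n≤o⇒m≤o N M le)) (q n (ℕₚ.m⊔n≤o⇒n≤o N M le)) ⟩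
    ε ℚ.* ½ ℚ.+ ε ℚ.* ½        ≡⟨ solve 1 (λ e → e :* con ½ :+ e :* con ½ := e) refl ε ⟩
    ε ∎
    where open ℚₚ.≤-Reasoning

  EventuallyBounded : (ℕ → ℚ) → Set
  EventuallyBounded s = ∃[ B ] ∃[ N ] (0ℚ ℚ.< B × (∀ n → N ℕ.≤ n → ℚ.∣ s n ∣ ℚ.< B))

  cauchy⇒bounded : IsCauchy s → EventuallyBounded s
  cauchy⇒bounded {s} cs with cs 1ℚ 0<1
  ... | N , p = 1ℚ ℚ.+ ℚ.∣ s N ∣ , N
              , ℚₚ.+-mono-<-≤ 0<1 (ℚₚ.0≤∣p∣ (s N)) , λ n N≤n → begin-strict
    ℚ.∣ s n ∣                          ≡⟨ cong ℚ.∣_∣ (solve 2 (λ a b → a := (a :- b) :+ b) refl (s n) (s N)) ⟩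
    ℚ.∣ (s n ℚ.- s N) ℚ.+ s N ∣        ≤⟨ ℚₚ.∣p+q∣≤∣p∣+∣q∣ (s n ℚ.- s N) (s N) ⟩
    ℚ.∣ s n ℚ.- s N ∣ ℚ.+ ℚ.∣ s N ∣    <⟨ ℚₚ.+-monoˡ-< ℚ.∣ s N ∣ (p n N N≤n ℕₚ.≤-refl) ⟩
    1ℚ ℚ.+ ℚ.∣ s N ∣                   ∎
    where open ℚₚ.≤-Reasoning

  null-* : EventuallyBounded s → IsNull t → IsNull (λ n → s n ℚ.* t n)
  null-* {s} {t} (B , M , 0<B , s<B) nt ε 0<ε =
    let δ , 0<δ , Bδ≡ε = divide 0<B 0<ε
        N , p          = nt δ 0<δ
    in M ℕ.⊔ N , λ n le → subst (ℚ.∣ s n ℚ.* t n ∣ ℚ.<_) Bδ≡ε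
         (∣p*q∣< (s n) (t n) 0<B (s<B n (ℕₚ.m⊔n≤o⇒m≤o M N le)) (p n (ℕₚ.m⊔n≤o⇒n≤o M N le)))

-- The ring of Cauchy reals

module RealRing where
  open ≡ using (refl)
  open NullSequences
  open +-*-Solver

  private variable x y u v : ℝ

  pointwise : (∀ n → seq x n ≡ seq y n) → x ≈ℝ y
  pointwise {x} {y} eq = mk≈ℝ (null-0 λ n →
    ≡.trans (cong (ℚ._- seq y n) (eq n)) (ℚₚ.+-inverseʳ (seq y n)))

  ≈ℝ-refl : x ≈ℝ x
  ≈ℝ-refl = pointwise λ _ → refl

  ≈ℝ-sym : x ≈ℝ y → y ≈ℝ x
  ≈ℝ-sym {x} {y} (mk≈ℝ e) = mk≈ℝ (null-resp
    (λ n → solve 2 (λ a b → :- (a :- b) := b :- a) refl (seq x n) (seq y n)) (null-neg e))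

  ≈ℝ-trans : x ≈ℝ y → y ≈ℝ u → x ≈ℝ u
  ≈ℝ-trans {x} {y} {u} (mk≈ℝ e) (mk≈ℝ f) = mk≈ℝ (null-resp
    (λ n → solve 3 (λ a b c → (a :- b) :+ (b :- c) := a :- c) refl (seq x n) (seq y n) (seq u n))
    (null-+ e f))

  +ℝ-cong : x ≈ℝ y → u ≈ℝ v → x +ℝ u ≈ℝ y +ℝ v
  +ℝ-cong {x} {y} {u} {v} (mk≈ℝ e) (mk≈ℝ f) = mk≈ℝ (null-resp
    (λ n → solve 4 (λ a b c d → (a :- b) :+ (c :- d) := (a :+ c) :- (b :+ d)) refl
             (seq x n) (seq y n) (seq u n) (seq v n))
    (null-+ e f))

  -ℝ-cong : x ≈ℝ y → -ℝ x ≈ℝ -ℝ y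
  -ℝ-cong {x} {y} (mk≈ℝ e) = mk≈ℝ (null-resp
    (λ n → solve 2 (λ a b → :- (a :- b) := (:- a) :- (:- b)) refl (seq x n) (seq y n))
    (null-neg e))

  *ℝ-cong : x ≈ℝ y → u ≈ℝ v → x *ℝ u ≈ℝ y *ℝ v
  *ℝ-cong {x} {y} {u} {v} (mk≈ℝ e) (mk≈ℝ f) = mk≈ℝ (null-resp
    (λ n → solve 4 (λ a b c d → c :* (a :- b) :+ b :* (c :- d) := a :* c :- b :* d) refl
             (seq x n) (seq y n) (seq u n) (seq v n))
    (null-+ {λ n → seq u n ℚ.* (seq x n ℚ.- seq y n)} {λ n → seq y n ℚ.* (seq u n ℚ.- seq v n)}
      (null-* {seq u} (cauchy⇒bounded {seq u} (cauchy u)) e)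
      (null-* {seq y} (cauchy⇒bounded {seq y} (cauchy y)) f)))

  ℝ-commutativeRing : CommutativeRing 0ℓ 0ℓ
  ℝ-commutativeRing = record
    { Carrier = ℝ ; _≈_ = _≈ℝ_ ; _+_ = _+ℝ_ ; _*_ = _*ℝ_ ; -_ = -ℝ_ ; 0# = 0ℝ ; 1# = 1ℝ
    ; isCommutativeRing = record
      { isRing = record
        { +-isAbelianGroup = record
          { isGroup = record
            { isMonoid = record
              { isSemigroup = record
                { isMagma = record
                  { isEquivalence = record { refl = ≈ℝ-refl ; sym = ≈ℝ-sym ; trans = ≈ℝ-trans }
                  ; ∙-cong = +ℝ-cong }
                ; assoc = λ x y z → pointwise λ n → ℚₚ.+-assoc (seq x n) (seq y n) (seq z n) }
              ; identity = (λ x → pointwise λ n → ℚₚ.+-identityˡ (seq x n))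
                         , (λ x → pointwise λ n → ℚₚ.+-identityʳ (seq x n)) }
            ; inverse = (λ x → pointwise λ n → ℚₚ.+-inverseˡ (seq x n))
                      , (λ x → pointwise λ n → ℚₚ.+-inverseʳ (seq x n))
            ; ⁻¹-cong = -ℝ-cong }
          ; comm = λ x y → pointwise λ n → ℚₚ.+-comm (seq x n) (seq y n) }
        ; *-cong = *ℝ-cong
        ; *-assoc = λ x y z → pointwise λ n → ℚₚ.*-assoc (seq x n) (seq y n) (seq z n)
        ; *-identity = (λ x → pointwise λ n → ℚₚ.*-identityˡ (seq x n))
                     , (λ x → pointwise λ n → ℚₚ.*-identityʳ (seq x n))
        ; distrib = (λ x y z → pointwise λ n → ℚₚ.*-distribˡ-+ (seq x n) (seq y n) (seq z n))
                  , (λ x y z → pointwise λ n → ℚₚ.*-distribʳ-+ (seq x n) (seq y n) (seq z n)) }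
      ; *-comm = λ x y → pointwise λ n → ℚₚ.*-comm (seq x n) (seq y n) } }

-- Excluded middle for `A` when the goal is a negation. A goal `¬ ¬ X` has this form, with `B` the
-- type `¬ X` of its continuation.
¬¬-lem : ∀ {a} (A : Set a) {B : Set} → (A → ¬ B) → (¬ A → ¬ B) → ¬ B
¬¬-lem A f g b = g (λ a → f a b) b

-- Order, reciprocals and location of reals

module RealOrder where
  open Rationals
  open ≡ using (refl)
  open NullSequences
  open RealRing
  open +-*-Solver

  private variable x y z : ℝ

  -- Carries its witness, which `pos-reciprocal` and `pos-bounded-below` turn into data;
  -- nonnegativity is by contrast the bare negation of a `Pos`.
  record Pos (x : ℝ) : Set where
    constructor mkPos
    field
      bound   : ℚ
      0<bound : 0ℚ ℚ.< bound
      from    : ℕ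
      bound≤  : ∀ n → from ℕ.≤ n → bound ℚ.≤ seq x n

  record NonNeg (x : ℝ) : Set where
    constructor mkNonNeg
    field ¬pos-neg : ¬ Pos (-ℝ x)
  open NonNeg

  pos-resp : x ≈ℝ y → Pos x → Pos y
  pos-resp {x} {y} (mk≈ℝ e) (mkPos ε 0<ε N ε≤) with e (ε ℚ.* ½) (0<p*½ 0<ε)
  ... | M , p = mkPos (ε ℚ.* ½) (0<p*½ 0<ε) (N ℕ.⊔ M) λ n le →
    ≤-offset (0≤p+q (p≤q⇒0≤q-p (ε≤ n (ℕₚ.m⊔n≤o⇒m≤o N M le)))
                    (p≤q⇒0≤q-p (ℚₚ.<⇒≤ (ℚₚ.≤-<-trans (p≤∣p∣ _) (p n (ℕₚ.m⊔n≤o⇒n≤o N M le))))))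
      (solve 3 (λ e a b → b := e :* con ½ :+ ((a :- e) :+ (e :* con ½ :- (a :- b)))) refl
         ε (seq x n) (seq y n))

  pos-+ : Pos x → Pos y → Pos (x +ℝ y)
  pos-+ {x} {y} (mkPos ε 0<ε N ε≤) (mkPos δ 0<δ M δ≤) =
    mkPos (ε ℚ.+ δ) (0<p+q 0<ε 0<δ) (N ℕ.⊔ M) λ n le →
      ℚₚ.+-mono-≤ (ε≤ n (ℕₚ.m⊔n≤o⇒m≤o N M le)) (δ≤ n (ℕₚ.m⊔n≤o⇒n≤o N M le))

  pos-* : Pos x → Pos y → Pos (x *ℝ y)
  pos-* {x} {y} (mkPos ε 0<ε N ε≤) (mkPos δ 0<δ M δ≤) =
    mkPos (ε ℚ.* δ) (0<p*q 0<ε 0<δ) (N ℕ.⊔ M) λ n le →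
      let ε≤x = ε≤ n (ℕₚ.m⊔n≤o⇒m≤o N M le)
          δ≤y = δ≤ n (ℕₚ.m⊔n≤o⇒n≤o N M le)
      in ≤-offset
        (0≤p+q (0≤p*q (p≤q⇒0≤q-p ε≤x) (ℚₚ.≤-trans (ℚₚ.<⇒≤ 0<δ) δ≤y))
               (0≤p*q (ℚₚ.<⇒≤ 0<ε) (p≤q⇒0≤q-p δ≤y)))
        (solve 4 (λ a b e d → a :* b := e :* d :+ ((a :- e) :* b :+ e :* (b :- d))) refl
           (seq x n) (seq y n) ε δ)

  ¬pos-0 : ¬ Pos 0ℝ
  ¬pos-0 (mkPos ε 0<ε N ε≤) = ℚₚ.<-irrefl refl (ℚₚ.<-≤-trans 0<ε (ε≤ N ℕₚ.≤-refl))

  module R = CommutativeRing ℝ-commutativeRing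

  pos-asym : Pos x → ¬ Pos (-ℝ x)
  pos-asym {x} p q = ¬pos-0 (pos-resp (R.-‿inverseʳ x) (pos-+ p q))

  -- One sample decides. At an index `N` of precision ε/4, a value of at least ε/2 would keep `x`
  -- above ε/4 from then on, a value of at most -ε/2 would keep it below -ε/4, and anything in
  -- between leaves it within 3ε/4 of 0.
  ¬pos⇒≈0 : ¬ Pos x → ¬ Pos (-ℝ x) → x ≈ℝ 0ℝ
  ¬pos⇒≈0 {x} ¬p ¬n = mk≈ℝ (null-resp (λ n → ≡.sym (ℚₚ.+-identityʳ (seq x n))) null-x)
    where
    null-x : IsNull (seq x)
    null-x ε 0<ε with cauchy x (ε ℚ.* ½ ℚ.* ½) (0<p*½ (0<p*½ 0<ε))
    ... | N , p with ε ℚ.* ½ ℚₚ.≤? seq x N | ε ℚ.* ½ ℚₚ.≤? ℚ.- seq x N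
    ... | yes q | _ = ⊥-elim (¬p (mkPos (ε ℚ.* ½ ℚ.* ½) (0<p*½ (0<p*½ 0<ε)) N λ n N≤n →
      ℚₚ.<⇒≤ (<-offset (ℚₚ.+-mono-<-≤ (p<q⇒0<q-p (∣p-q∣<ε⇒q-ε<p (seq x n) (seq x N) (p n N N≤n ℕₚ.≤-refl))) (p≤q⇒0≤q-p q))
        (solve 3 (λ e a b → b := e :* con ½ :* con ½ :+
             ((b :- (a :- e :* con ½ :* con ½)) :+ (a :- e :* con ½))) refl ε (seq x N) (seq x n)))))
    ... | no _ | yes q = ⊥-elim (¬n (mkPos (ε ℚ.* ½ ℚ.* ½) (0<p*½ (0<p*½ 0<ε)) N λ n N≤n →
      ℚₚ.<⇒≤ (<-offset (ℚₚ.+-mono-<-≤ (p<q⇒0<q-p (∣p-q∣<ε⇒p<q+ε (seq x n) (seq x N) (p n N N≤n ℕₚ.≤-refl))) (p≤q⇒0≤q-p q))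
        (solve 3 (λ e a b → (:- b) := e :* con ½ :* con ½ :+
             (((a :+ e :* con ½ :* con ½) :- b) :+ ((:- a) :- e :* con ½))) refl ε (seq x N) (seq x n)))))
    ... | no q | no r = N , λ n N≤n → begin-strict
      ℚ.∣ seq x n ∣
        ≡⟨ cong ℚ.∣_∣ (solve 2 (λ a b → b := (b :- a) :+ a) refl (seq x N) (seq x n)) ⟩
      ℚ.∣ (seq x n ℚ.- seq x N) ℚ.+ seq x N ∣
        ≤⟨ ℚₚ.∣p+q∣≤∣p∣+∣q∣ (seq x n ℚ.- seq x N) (seq x N) ⟩
      ℚ.∣ seq x n ℚ.- seq x N ∣ ℚ.+ ℚ.∣ seq x N ∣
        <⟨ ℚₚ.+-mono-< (p n N N≤n ℕₚ.≤-refl) (∣∣-<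
             (<-offset (p<q⇒0<q-p (ℚₚ.≰⇒> r))
                (solve 2 (λ e a → a := :- (e :* con ½) :+ (e :* con ½ :- (:- a))) refl ε (seq x N)))
             (ℚₚ.≰⇒> q)) ⟩
      ε ℚ.* ½ ℚ.* ½ ℚ.+ ε ℚ.* ½
        <⟨ <-offset (0<p*½ (0<p*½ 0<ε))
             (solve 1 (λ e → e := (e :* con ½ :* con ½ :+ e :* con ½) :+ e :* con ½ :* con ½) refl ε) ⟩
      ε ∎
      where open ℚₚ.≤-Reasoning

  -- NonNeg, ≈ℝ and ⊥ are ¬¬-stable, so that reals may be compared by cases.
  nonNeg-cases : NonNeg x → ¬ ¬ (Pos x ⊎ x ≈ℝ 0ℝ)
  nonNeg-cases {x} (mkNonNeg h) k = k (inj₂ (¬pos⇒≈0 (λ p → k (inj₁ p)) h))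

  pos⇒nonNeg : Pos x → NonNeg x
  pos⇒nonNeg p = mkNonNeg (pos-asym p)

  ≈0⇒nonNeg : x ≈ℝ 0ℝ → NonNeg x
  ≈0⇒nonNeg {x} x≈0 = mkNonNeg λ p → ¬pos-0 (pos-resp (R.trans (R.-‿cong x≈0) (pointwise λ _ → refl)) p)

  nonNeg-eventually : ∀ N → (∀ n → N ℕ.≤ n → 0ℚ ℚ.≤ seq x n) → NonNeg x
  nonNeg-eventually {x} N 0≤x = mkNonNeg λ (mkPos ε 0<ε M ε≤) →
    let n = N ℕ.⊔ M
        -x≤0 : ℚ.- seq x n ℚ.≤ 0ℚ
        -x≤0 = ℚₚ.neg-antimono-≤ {0ℚ} {seq x n} (0≤x n (ℕₚ.m≤m⊔n N M))
    in ℚₚ.<-irrefl refl (ℚₚ.<-≤-trans 0<ε (ℚₚ.≤-trans (ε≤ n (ℕₚ.m≤n⊔m N M)) -x≤0))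

  nonNeg-stable : ¬ ¬ NonNeg x → NonNeg x
  nonNeg-stable k = mkNonNeg λ p → k λ (mkNonNeg h) → h p

  nonNeg-resp : x ≈ℝ y → NonNeg x → NonNeg y
  nonNeg-resp e (mkNonNeg h) = mkNonNeg λ p → h (pos-resp (R.-‿cong (R.sym e)) p)

  nonNeg-antisym : NonNeg x → NonNeg (-ℝ x) → x ≈ℝ 0ℝ
  nonNeg-antisym {x} (mkNonNeg h) (mkNonNeg k) =
    ¬pos⇒≈0 (λ p → k (pos-resp (pointwise λ n → solve 1 (λ a → a := :- (:- a)) refl (seq x n)) p)) h

  nonNeg-+ : NonNeg x → NonNeg y → NonNeg (x +ℝ y)
  nonNeg-+ {x} {y} hx hy = nonNeg-stable λ k → nonNeg-cases hx λ where
    (inj₂ x≈0) → k (nonNeg-resp (R.sym (R.trans (R.+-congʳ x≈0) (R.+-identityˡ y))) hy)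
    (inj₁ px) → nonNeg-cases hy λ where
      (inj₂ y≈0) → k (nonNeg-resp (R.sym (R.trans (R.+-congˡ y≈0) (R.+-identityʳ x))) hx)
      (inj₁ py) → k (pos⇒nonNeg (pos-+ px py))

  nonNeg-* : NonNeg x → NonNeg y → NonNeg (x *ℝ y)
  nonNeg-* {x} {y} hx hy = nonNeg-stable λ k → nonNeg-cases hx λ where
    (inj₂ x≈0) → k (≈0⇒nonNeg (R.trans (R.*-congʳ x≈0) (R.zeroˡ y)))
    (inj₁ px) → nonNeg-cases hy λ where
      (inj₂ y≈0) → k (≈0⇒nonNeg (R.trans (R.*-congˡ y≈0) (R.zeroʳ x)))
      (inj₁ py) → k (pos⇒nonNeg (pos-* px py))

  -- The sign of `x` is not decided. If the square were not nonnegative, then -x could not be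
  -- positive, since its square would be; so `x` is nonnegative and its square is as well.
  nonNeg-x² : ∀ x → NonNeg (x *ℝ x)
  nonNeg-x² x = nonNeg-stable λ k → k (nonNeg-* (hx k) (hx k))
    where
    hx : ¬ NonNeg (x *ℝ x) → NonNeg x
    hx k = mkNonNeg λ p → k (nonNeg-resp
      (pointwise λ n → solve 1 (λ a → (:- a) :* (:- a) := a :* a) refl (seq x n))
      (pos⇒nonNeg (pos-* p p)))

  ≈ℝ-stable : ¬ ¬ (x ≈ℝ y) → x ≈ℝ y
  ≈ℝ-stable {x} {y} k = R.trans (pointwise λ n → solve 2 (λ a b → a := (a :- b) :+ b) refl (seq x n) (seq y n))
    (R.trans (R.+-congʳ (¬pos⇒≈0 (λ p → k λ e → pos⇒≉ p (x-y≈0 e))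
                                 (λ p → k λ e → pos⇒≉ p (R.trans (R.-‿cong (x-y≈0 e)) (pointwise λ _ → refl)))))
             (R.+-identityˡ y))
    where
    pos⇒≉ : Pos z → ¬ z ≈ℝ 0ℝ
    pos⇒≉ p e = ¬pos-0 (pos-resp e p)
    x-y≈0 : x ≈ℝ y → x -ℝ y ≈ℝ 0ℝ
    x-y≈0 e = R.trans (R.+-congʳ e) (R.-‿inverseʳ y)

  nonNeg-fromℚ : ∀ {q} → 0ℚ ℚ.≤ q → NonNeg (fromℚ q)
  nonNeg-fromℚ {q} 0≤q = nonNeg-eventually 0 λ _ _ → 0≤q

  -- The exit from double negations: the order of ℚ is decidable, so a negative `q` can be refuted
  -- outright.
  nonNeg-fromℚ⁻¹ : ∀ {q} → NonNeg (fromℚ q) → 0ℚ ℚ.≤ q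
  nonNeg-fromℚ⁻¹ {q} (mkNonNeg h) with 0ℚ ℚₚ.≤? q
  ... | yes 0≤q = 0≤q
  ... | no 0≰q = ⊥-elim (h (mkPos (ℚ.- q) (ℚₚ.neg-antimono-< (ℚₚ.≰⇒> 0≰q)) 0 λ _ _ → ℚₚ.≤-refl))

  module _ (m t : ℕ → ℚ) (ε : ℚ) (0<ε : 0ℚ ℚ.< ε) (ε≤m : ∀ n → ε ℚ.≤ m n)
           (0<t : ∀ n → 0ℚ ℚ.< t n) (m*t : ∀ n → m n ℚ.* t n ≡ 1ℚ) (m-cauchy : IsCauchy m) where

    reciprocals-bounded : ∃[ K ] (0ℚ ℚ.< K × ∀ n → ℚ.∣ t n ∣ ℚ.< K)
    reciprocals-bounded with divide 0<ε 0<1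
    -- `K` is 1/ε; adding 1 makes the bound strict.
    ... | K , 0<K , εK≡1 = K ℚ.+ 1ℚ , 0<p+q 0<K 0<1 , λ n →
      subst (ℚ._< K ℚ.+ 1ℚ) (≡.sym (ℚₚ.0≤p⇒∣p∣≡p (ℚₚ.<⇒≤ (0<t n))))
        (<-offset (ℚₚ.+-mono-≤-< (p≤q⇒0≤q-p (t≤K n)) 0<1)
           (solve 3 (λ t k o → k :+ o := t :+ ((k :- t) :+ o)) refl (t n) K 1ℚ))
      where
      t≤K : ∀ n → t n ℚ.≤ K
      t≤K n = ≤-offset (0≤p*q (0≤p*q (p≤q⇒0≤q-p (ε≤m n)) (ℚₚ.<⇒≤ (0<t n))) (ℚₚ.<⇒≤ 0<K)) (begin
        K                                        ≡⟨ ℚₚ.*-identityˡ K ⟨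
        1ℚ ℚ.* K                                 ≡⟨ cong (ℚ._* K) (m*t n) ⟨
        m n ℚ.* t n ℚ.* K
          ≡⟨ solve 4 (λ m t k e → m :* t :* k := t :* (e :* k) :+ (m :- e) :* t :* k) refl (m n) (t n) K ε ⟩
        t n ℚ.* (ε ℚ.* K) ℚ.+ (m n ℚ.- ε) ℚ.* t n ℚ.* K
          ≡⟨ cong (ℚ._+ (m n ℚ.- ε) ℚ.* t n ℚ.* K) (≡.trans (cong (t n ℚ.*_) εK≡1) (ℚₚ.*-identityʳ (t n))) ⟩
        t n ℚ.+ (m n ℚ.- ε) ℚ.* t n ℚ.* K ∎)
        where open ≡.≡-Reasoning

    reciprocals-difference : ∀ i j → t i ℚ.- t j ≡ t i ℚ.* (t j ℚ.* (m j ℚ.- m i))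
    reciprocals-difference i j = begin
      t i ℚ.- t j
        ≡⟨ cong₂ ℚ._-_ (ℚₚ.*-identityʳ (t i)) (ℚₚ.*-identityʳ (t j)) ⟨
      t i ℚ.* 1ℚ ℚ.- t j ℚ.* 1ℚ
        ≡⟨ cong₂ (λ a b → t i ℚ.* a ℚ.- t j ℚ.* b) (m*t j) (m*t i) ⟨
      t i ℚ.* (m j ℚ.* t j) ℚ.- t j ℚ.* (m i ℚ.* t i)
        ≡⟨ solve 4 (λ a b c d → a :* (c :* b) :- b :* (d :* a) := a :* (b :* (c :- d))) refl (t i) (t j) (m j) (m i) ⟩
      t i ℚ.* (t j ℚ.* (m j ℚ.- m i)) ∎
      where open ≡.≡-Reasoning

    reciprocals-close : ∀ {K δ η} → 0ℚ ℚ.< K → (∀ n → ℚ.∣ t n ∣ ℚ.< K) → K ℚ.* K ℚ.* δ ≡ η →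
      ∀ i j → ℚ.∣ m j ℚ.- m i ∣ ℚ.< δ → ℚ.∣ t i ℚ.- t j ∣ ℚ.< η
    reciprocals-close {K} {δ} {η} 0<K ∣t∣<K eq i j mj~mi = begin-strict
      ℚ.∣ t i ℚ.- t j ∣
        ≡⟨ cong ℚ.∣_∣ (reciprocals-difference i j) ⟩
      ℚ.∣ t i ℚ.* (t j ℚ.* (m j ℚ.- m i)) ∣
        <⟨ ∣p*q∣< (t i) (t j ℚ.* (m j ℚ.- m i)) {K} {K ℚ.* δ} 0<K (∣t∣<K i)
             (∣p*q∣< (t j) (m j ℚ.- m i) {K} {δ} 0<K (∣t∣<K j) mj~mi) ⟩
      K ℚ.* (K ℚ.* δ)
        ≡⟨ ℚₚ.*-assoc K K δ ⟨
      K ℚ.* K ℚ.* δ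
        ≡⟨ eq ⟩
      η ∎
      where open ℚₚ.≤-Reasoning

    reciprocals-cauchy : IsCauchy t
    reciprocals-cauchy η 0<η =
      let K , 0<K , ∣t∣<K = reciprocals-bounded
          δ , 0<δ , eq = divide {K ℚ.* K} {η} (0<p*q {K} {K} 0<K 0<K) 0<η
          M , p = m-cauchy δ 0<δ
      in M , λ i j i≥ j≥ → reciprocals-close 0<K ∣t∣<K eq i j (p j i j≥ i≥)

  pos-reciprocal : Pos x → ∃[ y ] (NonNeg y × x *ℝ y ≈ℝ 1ℝ)
  pos-reciprocal {x} (mkPos ε 0<ε N ε≤) =
      mkℝ t (reciprocals-cauchy m t ε 0<ε ε≤m 0<t m*t m-cauchy)
    , nonNeg-eventually 0 (λ n _ → ℚₚ.<⇒≤ (0<t n))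
    , mk≈ℝ (λ η 0<η → N , λ n N≤n → subst (λ a → ℚ.∣ a ∣ ℚ.< η)
          (≡.sym (≡.trans (cong (ℚ._- 1ℚ) (≡.trans (cong (ℚ._* t n) (≡.sym (m≡x n N≤n))) (m*t n)))
                          (ℚₚ.+-inverseʳ 1ℚ))) 0<η)
    where
    -- Terms of `x` before `N` may vanish or be negative, so all terms are raised to at least `ε`.
    -- From `N` on nothing changes, and now reciprocals exist at every index.
    clamp : ∃[ m ] ((∀ n → ε ℚ.≤ m n) × (∀ n → N ℕ.≤ n → m n ≡ seq x n))
    clamp = (λ n → ε ℚ.⊔ seq x n) , (λ n → ℚₚ.p≤p⊔q ε (seq x n)) , λ n N≤n → ℚₚ.p≤q⇒p⊔q≡q (ε≤ n N≤n)
    m = proj₁ clamp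
    ε≤m = proj₁ (proj₂ clamp)
    m≡x = proj₂ (proj₂ clamp)
    m-cauchy : IsCauchy m
    m-cauchy δ 0<δ with cauchy x δ 0<δ
    ... | M , p = N ℕ.⊔ M , λ i j i≥ j≥ →
      ≡.subst₂ (λ a b → ℚ.∣ a ℚ.- b ∣ ℚ.< δ)
        (≡.sym (m≡x i (ℕₚ.m⊔n≤o⇒m≤o N M i≥))) (≡.sym (m≡x j (ℕₚ.m⊔n≤o⇒m≤o N M j≥)))
        (p i j (ℕₚ.m⊔n≤o⇒n≤o N M i≥) (ℕₚ.m⊔n≤o⇒n≤o N M j≥))
    t : ℕ → ℚ
    t n = proj₁ (divide (ℚₚ.<-≤-trans 0<ε (ε≤m n)) 0<1)
    0<t : ∀ n → 0ℚ ℚ.< t n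
    0<t n = proj₁ (proj₂ (divide (ℚₚ.<-≤-trans 0<ε (ε≤m n)) 0<1))
    m*t : ∀ n → m n ℚ.* t n ≡ 1ℚ
    m*t n = proj₂ (proj₂ (divide (ℚₚ.<-≤-trans 0<ε (ε≤m n)) 0<1))

  nonNeg-closed : (∀ ε → 0ℚ ℚ.< ε → NonNeg (x +ℝ fromℚ ε)) → NonNeg x
  nonNeg-closed {x} h = mkNonNeg λ (mkPos ε 0<ε N ε≤) →
    NonNeg.¬pos-neg (h (ε ℚ.* ½) (0<p*½ 0<ε)) (mkPos (ε ℚ.* ½) (0<p*½ 0<ε) N λ n N≤n →
      ≤-offset (p≤q⇒0≤q-p {ε} {ℚ.- seq x n} (ε≤ n N≤n))
        (solve 2 (λ e a → :- (a :+ e :* con ½) := e :* con ½ :+ (:- a :- e)) refl ε (seq x n)))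

  pos-bounded-below : Pos x → ∃[ ε ] (0ℚ ℚ.< ε × NonNeg (x -ℝ fromℚ ε))
  pos-bounded-below (mkPos ε 0<ε N ε≤) =
    ε , 0<ε , nonNeg-eventually N λ n N≤n → p≤q⇒0≤q-p (ε≤ n N≤n)

  bounded-above : ∀ x → ∃[ B ] (0ℚ ℚ.< B × NonNeg (fromℚ B -ℝ x))
  bounded-above x =
    let B , N , 0<B , x<B = cauchy⇒bounded {seq x} (cauchy x)
    in B , 0<B , nonNeg-eventually N λ n N≤n →
         p≤q⇒0≤q-p {seq x n} {B} (ℚₚ.≤-trans (p≤∣p∣ (seq x n)) (ℚₚ.<⇒≤ (x<B n N≤n)))

  -- With precision (q - p)/4, one term of `x` is compared with the midpoint of `p` and `q`. Each
  -- outcome leaves enough room on its own side.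
  locate : ∀ x {p q} → p ℚ.< q → NonNeg (fromℚ q -ℝ x) ⊎ ¬ NonNeg (fromℚ p -ℝ x)
  locate x {p} {q} p<q with cauchy x ((q ℚ.- p) ℚ.* ½ ℚ.* ½) (0<p*½ (0<p*½ (p<q⇒0<q-p p<q)))
  ... | N , c with seq x N ℚₚ.≤? (p ℚ.+ q) ℚ.* ½
  ... | yes le = inj₁ (nonNeg-eventually N λ n N≤n → p≤q⇒0≤q-p {seq x n} {q} (ℚₚ.<⇒≤ (<-offset
          (ℚₚ.+-mono-<-≤ (p<q⇒0<q-p (∣p-q∣<ε⇒p<q+ε (seq x n) (seq x N) (c n N N≤n ℕₚ.≤-refl)))
            (ℚₚ.+-mono-≤ (p≤q⇒0≤q-p le) (ℚₚ.<⇒≤ (0<p*½ (0<p*½ (p<q⇒0<q-p p<q))))))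
          (solve 4 (λ p q a b → q := b :+ (((a :+ (q :- p) :* con ½ :* con ½) :- b)
               :+ (((p :+ q) :* con ½ :- a) :+ (q :- p) :* con ½ :* con ½))) refl p q (seq x N) (seq x n)))))
  ... | no gt = inj₂ λ (mkNonNeg h) → h (mkPos ((q ℚ.- p) ℚ.* ½ ℚ.* ½) (0<p*½ (0<p*½ (p<q⇒0<q-p p<q))) N λ n N≤n →
    ℚₚ.<⇒≤ (<-offset
      (0<p+q (p<q⇒0<q-p (∣p-q∣<ε⇒q-ε<p (seq x n) (seq x N) (c n N N≤n ℕₚ.≤-refl)))
             (p<q⇒0<q-p (ℚₚ.≰⇒> gt)))
      (solve 4 (λ p q a b → :- (p :- b) := (q :- p) :* con ½ :* con ½
           :+ ((b :- (a :- (q :- p) :* con ½ :* con ½)) :+ (a :- (p :+ q) :* con ½))) refl p q (seq x N) (seq x n))))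

  module _ (a w : ℕ → ℚ) (0≤w : ∀ j → 0ℚ ℚ.≤ w j)
           (a↑ : ∀ j → a j ℚ.≤ a (suc j))
           (a+w↓ : ∀ j → a (suc j) ℚ.+ w (suc j) ℚ.≤ a j ℚ.+ w j)
           (w→0 : ∀ ε → 0ℚ ℚ.< ε → ∃[ j ] w j ℚ.< ε) where

    private
      a-mono : ∀ {i j} → i ℕ.≤′ j → a i ℚ.≤ a j
      a-mono ℕ.≤′-refl = ℚₚ.≤-refl
      a-mono (ℕ.≤′-step le) = ℚₚ.≤-trans (a-mono le) (a↑ _)

      a+w-anti : ∀ {i j} → i ℕ.≤′ j → a j ℚ.+ w j ℚ.≤ a i ℚ.+ w i
      a+w-anti ℕ.≤′-refl = ℚₚ.≤-refl
      a+w-anti (ℕ.≤′-step le) = ℚₚ.≤-trans (a+w↓ _) (a+w-anti le)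

      a≤a+w : ∀ {i j} → i ℕ.≤ j → a j ℚ.≤ a i ℚ.+ w i
      a≤a+w {i} {j} le = ℚₚ.≤-trans
        (≤-offset (0≤w j) refl) (a+w-anti (ℕₚ.≤⇒≤′ le))

      a-cauchy : IsCauchy a
      a-cauchy ε 0<ε with w→0 ε 0<ε
      ... | N , w<ε = N , λ m n N≤m N≤n → ∣∣-<
        (<-offset (ℚₚ.+-mono-<-≤ (p<q⇒0<q-p w<ε)
             (0≤p+q (p≤q⇒0≤q-p (a≤a+w N≤n)) (p≤q⇒0≤q-p (a-mono (ℕₚ.≤⇒≤′ N≤m)))))
          (solve 5 (λ e w c m n → m :- n := :- e :+ ((e :- w) :+ ((c :+ w :- n) :+ (m :- c)))) refl
             ε (w N) (a N) (a m) (a n)))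
        (<-offset (ℚₚ.+-mono-<-≤ (p<q⇒0<q-p w<ε)
             (0≤p+q (p≤q⇒0≤q-p (a≤a+w N≤m)) (p≤q⇒0≤q-p (a-mono (ℕₚ.≤⇒≤′ N≤n)))))
          (solve 5 (λ e w c m n → e := (m :- n) :+ ((e :- w) :+ ((c :+ w :- m) :+ (n :- c)))) refl
             ε (w N) (a N) (a m) (a n)))

    -- The left ends themselves are the Cauchy sequence: from index j on they all lie between `a j`
    -- and `a j + w j`.
    nested-intervals : ∃[ l ] (∀ j → NonNeg (l -ℝ fromℚ (a j)) × NonNeg (fromℚ (a j ℚ.+ w j) -ℝ l))
    nested-intervals = mkℝ a a-cauchy , λ j →
        nonNeg-eventually j (λ n j≤n → p≤q⇒0≤q-p {a j} {a n} (a-mono (ℕₚ.≤⇒≤′ j≤n)))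
      , nonNeg-eventually j (λ n j≤n → p≤q⇒0≤q-p {a n} {a j ℚ.+ w j} (a≤a+w j≤n))

-- Scalars with conjugation and order, as an interface

module RationalCoefficients (K : CommutativeRing 0ℓ 0ℓ)
  (embedding : ℚ.+-*-rawRing -Raw-AlmostCommutative⟶ fromCommutativeRing K) where
  open CommutativeRing K
  open _-Raw-AlmostCommutative⟶_ embedding using () renaming (⟦_⟧ to ι)

  private
    _≟_ : ∀ p q → Maybe (ι p ≈ ι q)
    p ≟ q with p ℚₚ.≟ q
    ... | yes eq = just (reflexive (cong ι eq))
    ... | no _   = nothing

  open Algebra.Solver.Ring ℚ.+-*-rawRing (fromCommutativeRing K) embedding _≟_ public
    using (solve; _:=_; _:+_; _:*_; _:-_; :-_; con; Polynomial)

-- 0≤ z says that z is real and nonnegative.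
record StarField : Set₁ where
  field commutativeRing : CommutativeRing 0ℓ 0ℓ
  open CommutativeRing commutativeRing public
  infix 4 0≤_
  field
    conj      : Carrier → Carrier
    conj-cong : ∀ {x y} → x ≈ y → conj x ≈ conj y
    conj-+    : ∀ x y → conj (x + y) ≈ conj x + conj y
    conj-*    : ∀ x y → conj (x * y) ≈ conj x * conj y
    conj-conj : ∀ x → conj (conj x) ≈ x

    0≤_        : Carrier → Set
    0≤-resp    : ∀ {x y} → x ≈ y → 0≤ x → 0≤ y
    0≤-+       : ∀ {x y} → 0≤ x → 0≤ y → 0≤ (x + y)
    0≤-*       : ∀ {x y} → 0≤ x → 0≤ y → 0≤ (x * y)
    0≤-norm    : ∀ x → 0≤ (x * conj x)
    norm-definite : ∀ {x} → x * conj x ≈ 0# → x ≈ 0#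
    0≤-antisym : ∀ {x} → 0≤ x → 0≤ (- x) → x ≈ 0#
    0≤⇒real    : ∀ {x} → 0≤ x → conj x ≈ x

    ≈-stable   : ∀ {x y} → ¬ ¬ (x ≈ y) → x ≈ y
    0≤-stable  : ∀ {x} → ¬ ¬ (0≤ x) → 0≤ x
    -- From `¬ x ≈ 0#` a positive lower bound follows only under a double negation, and the inverse
    -- inherits it.
    reciprocal : ∀ {x} → 0≤ x → ¬ x ≈ 0# → ¬ ¬ (∃[ y ] (0≤ y × x * y ≈ 1#))

    ι       : ℚ → Carrier
    ι-+     : ∀ p q → ι (p ℚ.+ q) ≈ ι p + ι q
    ι-*     : ∀ p q → ι (p ℚ.* q) ≈ ι p * ι q
    ι-neg   : ∀ q → ι (ℚ.- q) ≈ - ι q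
    ι-0     : ι 0ℚ ≈ 0#
    ι-1     : ι 1ℚ ≈ 1#
    0≤-ι    : ∀ {q} → 0ℚ ℚ.≤ q → 0≤ ι q
    0≤-ι⁻¹  : ∀ {q} → 0≤ ι q → 0ℚ ℚ.≤ q

    𝑖       : Carrier
    𝑖*𝑖     : 𝑖 * 𝑖 ≈ - 1#
    conj-𝑖  : conj 𝑖 ≈ - 𝑖

    0≤-closed     : ∀ {x} → (∀ ε → 0ℚ ℚ.< ε → 0≤ (x + ι ε)) → 0≤ x
    bounded-below : ∀ {x} → 0≤ x → ¬ x ≈ 0# → ¬ ¬ (∃[ ε ] (0ℚ ℚ.< ε × 0≤ (x - ι ε)))
    bounded-above : ∀ {x} → 0≤ x → ∃[ B ] (0ℚ ℚ.< B × 0≤ (ι B - x))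
    -- A comparison that is decided outright, at the price of a gap between `p` and `q`; the
    -- trisection for the operator norm rests on it.
    locate        : ∀ {x p q} → 0≤ x → p ℚ.< q → 0≤ (ι q - x) ⊎ ¬ 0≤ (ι p - x)
    nested-intervals : ∀ (a w : ℕ → ℚ) → (∀ j → 0ℚ ℚ.≤ w j) → (∀ j → a j ℚ.≤ a (suc j)) →
      (∀ j → a (suc j) ℚ.+ w (suc j) ℚ.≤ a j ℚ.+ w j) →
      (∀ ε → 0ℚ ℚ.< ε → ∃[ j ] w j ℚ.< ε) →
      ∃[ l ] ∀ j → 0≤ (l - ι (a j)) × 0≤ (ι (a j ℚ.+ w j) - l)

  ι-embedding : ℚ.+-*-rawRing -Raw-AlmostCommutative⟶ fromCommutativeRing commutativeRing
  ι-embedding = record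
    { ⟦_⟧ = ι ; +-homo = ι-+ ; *-homo = ι-* ; -‿homo = ι-neg ; 0-homo = ι-0 ; 1-homo = ι-1 }

  open RationalCoefficients commutativeRing ι-embedding public

-- The complex numbers as scalars

module ComplexStarField where
  open ≡ using (refl)
  open RealRing
  open RealOrder hiding (module R)
  private
    module R = CommutativeRing ℝ-commutativeRing
    module C = RawRing ℂ-rawRing
    fromℚ-+ : ∀ p q → fromℚ (p ℚ.+ q) ≈ℝ fromℚ p +ℝ fromℚ q
    fromℚ-+ p q = pointwise λ _ → refl
    fromℚ-* : ∀ p q → fromℚ (p ℚ.* q) ≈ℝ fromℚ p *ℝ fromℚ q
    fromℚ-* p q = pointwise λ _ → refl
    fromℚ-neg : ∀ q → fromℚ (ℚ.- q) ≈ℝ -ℝ fromℚ q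
    fromℚ-neg q = pointwise λ _ → refl
    fromℚ-embedding : ℚ.+-*-rawRing -Raw-AlmostCommutative⟶ fromCommutativeRing ℝ-commutativeRing
    fromℚ-embedding = record
      { ⟦_⟧ = fromℚ ; +-homo = fromℚ-+ ; *-homo = fromℚ-* ; -‿homo = fromℚ-neg
      ; 0-homo = R.refl ; 1-homo = R.refl }
  open RationalCoefficients ℝ-commutativeRing fromℚ-embedding

  private
    0:ᵖ 1:ᵖ : ∀ {n} → Polynomial n
    0:ᵖ = con 0ℚ
    1:ᵖ = con 1ℚ

  ℂ-commutativeRing : CommutativeRing 0ℓ 0ℓ
  ℂ-commutativeRing = record
    { Carrier = ℂ ; _≈_ = _≈ℂ_ ; _+_ = C._+_ ; _*_ = C._*_ ; -_ = C.-_ ; 0# = C.0# ; 1# = C.1#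
    ; isCommutativeRing = record
      { isRing = record
        { +-isAbelianGroup = record
          { isGroup = record
            { isMonoid = record
              { isSemigroup = record
                { isMagma = record
                  { isEquivalence = record
                    { refl  = mk≈ℂ R.refl R.refl
                    ; sym   = λ (mk≈ℂ e f) → mk≈ℂ (R.sym e) (R.sym f)
                    ; trans = λ (mk≈ℂ e f) (mk≈ℂ g h) → mk≈ℂ (R.trans e g) (R.trans f h) }
                  ; ∙-cong = λ (mk≈ℂ e f) (mk≈ℂ g h) → mk≈ℂ (R.+-cong e g) (R.+-cong f h) }
                ; assoc = λ x y z → mk≈ℂ (R.+-assoc _ _ _) (R.+-assoc _ _ _) }
              ; identity = (λ x → mk≈ℂ (R.+-identityˡ _) (R.+-identityˡ _))
                         , (λ x → mk≈ℂ (R.+-identityʳ _) (R.+-identityʳ _)) }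
            ; inverse = (λ x → mk≈ℂ (R.-‿inverseˡ _) (R.-‿inverseˡ _))
                      , (λ x → mk≈ℂ (R.-‿inverseʳ _) (R.-‿inverseʳ _))
            ; ⁻¹-cong = λ (mk≈ℂ e f) → mk≈ℂ (R.-‿cong e) (R.-‿cong f) }
          ; comm = λ x y → mk≈ℂ (R.+-comm _ _) (R.+-comm _ _) }
        ; *-cong = λ (mk≈ℂ e f) (mk≈ℂ g h) →
            mk≈ℂ (R.+-cong (R.*-cong e g) (R.-‿cong (R.*-cong f h)))
                 (R.+-cong (R.*-cong e h) (R.*-cong f g))
        ; *-assoc = λ x y z → mk≈ℂ
            (solve 6 (λ a b c d e f →
               (a :* c :- b :* d) :* e :- (a :* d :+ b :* c) :* f
               := a :* (c :* e :- d :* f) :- b :* (c :* f :+ d :* e)) R.refl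
               (re x) (im x) (re y) (im y) (re z) (im z))
            (solve 6 (λ a b c d e f →
               (a :* c :- b :* d) :* f :+ (a :* d :+ b :* c) :* e
               := a :* (c :* f :+ d :* e) :+ b :* (c :* e :- d :* f)) R.refl
               (re x) (im x) (re y) (im y) (re z) (im z))
        ; *-identity =
            (λ x → mk≈ℂ (solve 2 (λ a b → 1:ᵖ :* a :- 0:ᵖ :* b := a) R.refl (re x) (im x))
                        (solve 2 (λ a b → 1:ᵖ :* b :+ 0:ᵖ :* a := b) R.refl (re x) (im x)))
          , (λ x → mk≈ℂ (solve 2 (λ a b → a :* 1:ᵖ :- b :* 0:ᵖ := a) R.refl (re x) (im x))
                        (solve 2 (λ a b → a :* 0:ᵖ :+ b :* 1:ᵖ := b) R.refl (re x) (im x)))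
        ; distrib =
            (λ x y z → mk≈ℂ
              (solve 6 (λ a b c d e f → a :* (c :+ e) :- b :* (d :+ f)
                 := (a :* c :- b :* d) :+ (a :* e :- b :* f)) R.refl
                 (re x) (im x) (re y) (im y) (re z) (im z))
              (solve 6 (λ a b c d e f → a :* (d :+ f) :+ b :* (c :+ e)
                 := (a :* d :+ b :* c) :+ (a :* f :+ b :* e)) R.refl
                 (re x) (im x) (re y) (im y) (re z) (im z)))
          , (λ x y z → mk≈ℂ
              (solve 6 (λ a b c d e f → (c :+ e) :* a :- (d :+ f) :* b
                 := (c :* a :- d :* b) :+ (e :* a :- f :* b)) R.refl
                 (re x) (im x) (re y) (im y) (re z) (im z))
              (solve 6 (λ a b c d e f → (c :+ e) :* b :+ (d :+ f) :* a
                 := (c :* b :+ d :* a) :+ (e :* b :+ f :* a)) R.refl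
                 (re x) (im x) (re y) (im y) (re z) (im z))) }
      ; *-comm = λ x y → mk≈ℂ
          (solve 4 (λ a b c d → a :* c :- b :* d := c :* a :- d :* b) R.refl
             (re x) (im x) (re y) (im y))
          (solve 4 (λ a b c d → a :* d :+ b :* c := c :* b :+ d :* a) R.refl
             (re x) (im x) (re y) (im y)) } }

  private
    infixr 4 _,ⁱ_
    record Nonneg (z : ℂ) : Set where
      constructor _,ⁱ_
      field
        re-nonNeg : NonNeg (re z)
        im≈0      : im z ≈ℝ 0ℝ

    -0≈0 : -ℝ 0ℝ ≈ℝ 0ℝ
    -0≈0 = pointwise λ _ → refl

    fromℚ′ : ℚ → ℂ
    fromℚ′ q = fromℚ q +i 0ℝ

    nonneg-minus : ∀ z q → NonNeg (re z -ℝ fromℚ q) → im z ≈ℝ 0ℝ → Nonneg (z C.+ (C.- fromℚ′ q))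
    nonneg-minus z q h i = h ,ⁱ R.trans (R.+-congʳ {_} {im z} {0ℝ} i) (R.-‿inverseʳ 0ℝ)

    minus-nonneg : ∀ q z → NonNeg (fromℚ q -ℝ re z) → im z ≈ℝ 0ℝ → Nonneg (fromℚ′ q C.+ (C.- z))
    minus-nonneg q z h i = h ,ⁱ R.trans (R.+-congˡ {0ℝ} (R.-‿cong i)) (R.-‿inverseʳ 0ℝ)

    reciprocal′ : ∀ {x} → Nonneg x → ¬ x ≈ℂ C.0# → ¬ ¬ (∃[ y ] (Nonneg y × x C.* y ≈ℂ C.1#))
    reciprocal′ {x} (h ,ⁱ i) x≉0 k = nonNeg-cases h λ where
      (inj₂ e) → x≉0 (mk≈ℂ e i)
      (inj₁ p) → let y , 0≤y , xy≈1 = pos-reciprocal p in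
        k (y +i 0ℝ , (0≤y ,ⁱ R.refl) , mk≈ℂ
          (R.trans (solve 3 (λ a b c → a :* b :- c :* 0:ᵖ := a :* b) R.refl (re x) y (im x)) xy≈1)
          (R.trans (R.+-congˡ {re x *ℝ 0ℝ} (R.*-congʳ {y} i))
            (solve 2 (λ a b → a :* 0:ᵖ :+ 0:ᵖ :* b := 0:ᵖ) R.refl (re x) y)))

    nonneg-closed : ∀ {x} → (∀ ε → 0ℚ ℚ.< ε → Nonneg (x C.+ fromℚ′ ε)) → Nonneg x
    nonneg-closed {x} h = nonNeg-closed (λ ε 0<ε → Nonneg.re-nonNeg (h ε 0<ε))
      ,ⁱ R.trans (R.sym (R.+-identityʳ (im x))) (Nonneg.im≈0 (h 1ℚ Rationals.0<1))

    bounded-below′ : ∀ {x} → Nonneg x → ¬ x ≈ℂ C.0# →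
      ¬ ¬ (∃[ ε ] (0ℚ ℚ.< ε × Nonneg (x C.+ (C.- fromℚ′ ε))))
    bounded-below′ {x} (h ,ⁱ i) x≉0 k = nonNeg-cases h λ where
      (inj₂ e) → x≉0 (mk≈ℂ e i)
      (inj₁ p) → let ε , 0<ε , ε≤x = pos-bounded-below p in
        k (ε , 0<ε , nonneg-minus x ε ε≤x i)

    bounded-above′ : ∀ {x} → Nonneg x → ∃[ B ] (0ℚ ℚ.< B × Nonneg (fromℚ′ B C.+ (C.- x)))
    bounded-above′ {x} (h ,ⁱ i) = let B , 0<B , x≤B = RealOrder.bounded-above (re x) in
      B , 0<B , minus-nonneg B x x≤B i

    locate′ : ∀ {x p q} → Nonneg x → p ℚ.< q →
      Nonneg (fromℚ′ q C.+ (C.- x)) ⊎ ¬ Nonneg (fromℚ′ p C.+ (C.- x))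
    locate′ {x} {p} {q} (h ,ⁱ i) p<q = Sum.map
      (λ x≤q → minus-nonneg q x x≤q i)
      (λ x≰p (k ,ⁱ _) → x≰p k)
      (RealOrder.locate (re x) p<q)

    nested-intervals′ : ∀ (a w : ℕ → ℚ) → (∀ j → 0ℚ ℚ.≤ w j) → (∀ j → a j ℚ.≤ a (suc j)) →
      (∀ j → a (suc j) ℚ.+ w (suc j) ℚ.≤ a j ℚ.+ w j) →
      (∀ ε → 0ℚ ℚ.< ε → ∃[ j ] w j ℚ.< ε) →
      ∃[ l ] ∀ j → Nonneg (l C.+ (C.- fromℚ′ (a j))) × Nonneg (fromℚ′ (a j ℚ.+ w j) C.+ (C.- l))
    nested-intervals′ a w 0≤w a↑ a+w↓ w→0 =
      let l , bounds = RealOrder.nested-intervals a w 0≤w a↑ a+w↓ w→0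
      in l +i 0ℝ , λ j → nonneg-minus (l +i 0ℝ) (a j) (proj₁ (bounds j)) R.refl
                       , minus-nonneg (a j ℚ.+ w j) (l +i 0ℝ) (proj₂ (bounds j)) R.refl

    conj : ℂ → ℂ
    conj z = re z +i (-ℝ im z)

    conj-cong : ∀ {z w} → z ≈ℂ w → conj z ≈ℂ conj w
    conj-cong (mk≈ℂ e f) = mk≈ℂ e (R.-‿cong f)

    conj-+ : ∀ z w → conj (z C.+ w) ≈ℂ conj z C.+ conj w
    conj-+ z w = mk≈ℂ R.refl
      (solve 2 (λ a b → :- (a :+ b) := (:- a) :+ (:- b)) R.refl (im z) (im w))

    conj-* : ∀ z w → conj (z C.* w) ≈ℂ conj z C.* conj w
    conj-* z w = mk≈ℂ
      (solve 4 (λ a b c d → a :* c :- b :* d := a :* c :- (:- b) :* (:- d)) R.refl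
        (re z) (im z) (re w) (im w))
      (solve 4 (λ a b c d → :- (a :* d :+ b :* c) := a :* (:- d) :+ (:- b) :* c) R.refl
        (re z) (im z) (re w) (im w))

    conj-conj : ∀ z → conj (conj z) ≈ℂ z
    conj-conj z = mk≈ℂ R.refl (solve 1 (λ a → :- (:- a) := a) R.refl (im z))

    nonneg-resp : ∀ {z w} → z ≈ℂ w → Nonneg z → Nonneg w
    nonneg-resp (mk≈ℂ e f) (h ,ⁱ i) = nonNeg-resp e h ,ⁱ R.trans (R.sym f) i

    nonneg-+ : ∀ {z w} → Nonneg z → Nonneg w → Nonneg (z C.+ w)
    nonneg-+ {z} {w} (h ,ⁱ i) (k ,ⁱ j) = nonNeg-+ h k
      ,ⁱ R.trans (R.+-cong {im z} {0ℝ} {im w} {0ℝ} i j) (R.+-identityˡ 0ℝ)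

    nonneg-* : ∀ {z w} → Nonneg z → Nonneg w → Nonneg (z C.* w)
    nonneg-* {z} {w} (h ,ⁱ i) (k ,ⁱ j) =
        nonNeg-resp (R.sym (R.trans (R.+-congˡ {re z *ℝ re w} (R.-‿cong (R.*-congʳ {im w} i)))
          (solve 2 (λ a b → a :- 0:ᵖ :* b := a) R.refl (re z *ℝ re w) (im w)))) (nonNeg-* h k)
      ,ⁱ R.trans (R.+-cong (R.*-congˡ {re z} j) (R.*-congʳ {re w} i))
          (solve 2 (λ a b → a :* 0:ᵖ :+ 0:ᵖ :* b := 0:ᵖ) R.refl (re z) (re w))

    nonneg-norm : ∀ z → Nonneg (z C.* conj z)
    nonneg-norm z =
        nonNeg-resp (solve 2 (λ a b → a :* a :+ b :* b := a :* a :- b :* (:- b)) R.refl (re z) (im z))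
          (nonNeg-+ (nonNeg-x² (re z)) (nonNeg-x² (im z)))
      ,ⁱ solve 2 (λ a b → a :* (:- b) :+ b :* a := 0:ᵖ) R.refl (re z) (im z)

    norm-definite′ : ∀ {z} → z C.* conj z ≈ℂ C.0# → z ≈ℂ C.0#
    norm-definite′ {z} (mk≈ℂ e _) = mk≈ℂ
      (a²+b²≈0 {re z} {im z}
        (R.trans (solve 2 (λ a b → a :* a :+ b :* b := a :* a :- b :* (:- b)) R.refl (re z) (im z)) e))
      (a²+b²≈0 {im z} {re z}
        (R.trans (solve 2 (λ a b → b :* b :+ a :* a := a :* a :- b :* (:- b)) R.refl (re z) (im z)) e))
      where
      -- Given a² = -b², an `a` of either strict sign would make -b² positive.
      a²+b²≈0 : ∀ {a b} → a *ℝ a +ℝ b *ℝ b ≈ℝ 0ℝ → a ≈ℝ 0ℝ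
      a²+b²≈0 {a} {b} e = ¬pos⇒≈0
        (λ p → NonNeg.¬pos-neg (nonNeg-x² b) (pos-resp (-b²≈a² {a} e) (pos-* p p)))
        (λ p → NonNeg.¬pos-neg (nonNeg-x² b) (pos-resp (-b²≈a² { -ℝ a}
          (R.trans (R.+-congʳ {b *ℝ b} (solve 1 (λ a → (:- a) :* (:- a) := a :* a) R.refl a)) e)) (pos-* p p)))
        where
        -b²≈a² : ∀ {a} → a *ℝ a +ℝ b *ℝ b ≈ℝ 0ℝ → a *ℝ a ≈ℝ -ℝ (b *ℝ b)
        -b²≈a² {a} e = R.trans
          (solve 2 (λ a b → a :* a := (a :* a :+ b :* b) :- b :* b) R.refl a b)
          (R.trans (R.+-congʳ {(-ℝ (b *ℝ b))} e) (R.+-identityˡ _))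

    nonneg-antisym : ∀ {z} → Nonneg z → Nonneg (C.- z) → z ≈ℂ C.0#
    nonneg-antisym (h ,ⁱ i) (k ,ⁱ j) = mk≈ℂ (nonNeg-antisym h k) i

    nonneg⇒real : ∀ {z} → Nonneg z → conj z ≈ℂ z
    nonneg⇒real (h ,ⁱ i) = mk≈ℂ R.refl (R.trans (R.-‿cong i) (R.trans -0≈0 (R.sym i)))

    ≈ℂ-stable : ∀ {z w} → ¬ ¬ (z ≈ℂ w) → z ≈ℂ w
    ≈ℂ-stable k = mk≈ℂ (≈ℝ-stable λ h → k λ (mk≈ℂ e f) → h e)
                       (≈ℝ-stable λ h → k λ (mk≈ℂ e f) → h f)

    nonneg-stable : ∀ {z} → ¬ ¬ Nonneg z → Nonneg z
    nonneg-stable k = nonNeg-stable (λ h → k λ (a ,ⁱ b) → h a)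
                    ,ⁱ ≈ℝ-stable (λ h → k λ (a ,ⁱ b) → h b)

    fromℚ′-+ : ∀ p q → fromℚ′ (p ℚ.+ q) ≈ℂ fromℚ′ p C.+ fromℚ′ q
    fromℚ′-+ p q = mk≈ℂ (fromℚ-+ p q) (R.sym (R.+-identityˡ 0ℝ))

    fromℚ′-* : ∀ p q → fromℚ′ (p ℚ.* q) ≈ℂ fromℚ′ p C.* fromℚ′ q
    fromℚ′-* p q = mk≈ℂ
      (R.trans (fromℚ-* p q) (solve 1 (λ a → a := a :- 0:ᵖ :* 0:ᵖ) R.refl (fromℚ p *ℝ fromℚ q)))
      (solve 2 (λ a b → 0:ᵖ := a :* 0:ᵖ :+ 0:ᵖ :* b) R.refl (fromℚ p) (fromℚ q))

    fromℚ′-neg : ∀ q → fromℚ′ (ℚ.- q) ≈ℂ C.- fromℚ′ q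
    fromℚ′-neg q = mk≈ℂ (fromℚ-neg q) (R.sym -0≈0)

    i : ℂ
    i = 0ℝ +i 1ℝ

    i*i : i C.* i ≈ℂ C.- C.1#
    i*i = mk≈ℂ (solve 0 (0:ᵖ :* 0:ᵖ :- 1:ᵖ :* 1:ᵖ := :- 1:ᵖ) R.refl)
               (solve 0 (0:ᵖ :* 1:ᵖ :+ 1:ᵖ :* 0:ᵖ := :- 0:ᵖ) R.refl)

    conj-i : conj i ≈ℂ C.- i
    conj-i = mk≈ℂ (R.sym -0≈0) R.refl

    nonneg-fromℚ : ∀ {q} → 0ℚ ℚ.≤ q → Nonneg (fromℚ′ q)
    nonneg-fromℚ 0≤q = nonNeg-fromℚ 0≤q ,ⁱ R.refl

    nonneg-fromℚ⁻¹ : ∀ {q} → Nonneg (fromℚ′ q) → 0ℚ ℚ.≤ q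
    nonneg-fromℚ⁻¹ (h ,ⁱ _) = nonNeg-fromℚ⁻¹ h

  ℂ-starField : StarField
  ℂ-starField = record
    { commutativeRing = ℂ-commutativeRing
    ; conj = conj ; conj-cong = conj-cong ; conj-+ = conj-+ ; conj-* = conj-* ; conj-conj = conj-conj
    ; 0≤_ = Nonneg ; 0≤-resp = nonneg-resp ; 0≤-+ = nonneg-+ ; 0≤-* = nonneg-*
    ; 0≤-norm = nonneg-norm ; norm-definite = norm-definite′ ; 0≤-antisym = nonneg-antisym ; 0≤⇒real = nonneg⇒real
    ; ≈-stable = ≈ℂ-stable ; 0≤-stable = nonneg-stable
    ; reciprocal = reciprocal′
    ; ι = fromℚ′ ; ι-+ = fromℚ′-+ ; ι-* = fromℚ′-* ; ι-neg = fromℚ′-neg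
    ; ι-0 = mk≈ℂ R.refl R.refl ; ι-1 = mk≈ℂ R.refl R.refl
    ; 0≤-ι = nonneg-fromℚ ; 0≤-ι⁻¹ = nonneg-fromℚ⁻¹
    ; 𝑖 = i ; 𝑖*𝑖 = i*i ; conj-𝑖 = conj-i
    ; 0≤-closed = nonneg-closed
    ; bounded-below = bounded-below′
    ; bounded-above = bounded-above′
    ; locate = λ {x} {p} {q} → locate′ {x} {p} {q}
    ; nested-intervals = nested-intervals′
    }

-- Natural numbers, finite sums and inequalities of scalars

-- Recursive rather than `+ n / 1`, so that it follows inductions over sums and ranks; `toℚᵘ-fromℕ`
-- links it to the fractions of the statement.
fromℕ : ℕ → ℚ
fromℕ zero    = 0ℚ
fromℕ (suc n) = 1ℚ ℚ.+ fromℕ n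

0≤fromℕ : ∀ n → 0ℚ ℚ.≤ fromℕ n
0≤fromℕ zero    = ℚₚ.≤-refl
0≤fromℕ (suc n) = Rationals.0≤p+q (ℚₚ.<⇒≤ Rationals.0<1) (0≤fromℕ n)

fromℕ-+ : ∀ k l → fromℕ (k ℕ.+ l) ≡ fromℕ k ℚ.+ fromℕ l
fromℕ-+ zero    l = ≡.sym (ℚₚ.+-identityˡ (fromℕ l))
fromℕ-+ (suc k) l = ≡.trans (cong (1ℚ ℚ.+_) (fromℕ-+ k l)) (≡.sym (ℚₚ.+-assoc 1ℚ (fromℕ k) (fromℕ l)))

fromℕ-mono : ∀ {k l} → k ℕ.≤ l → fromℕ k ℚ.≤ fromℕ l
fromℕ-mono {k} {l} k≤l = Rationals.≤-offset (0≤fromℕ (l ℕ.∸ k))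
  (≡.trans (cong fromℕ (≡.sym (ℕₚ.m+[n∸m]≡n k≤l))) (fromℕ-+ k (l ℕ.∸ k)))

0<fromℕ : ∀ k → 0ℚ ℚ.< fromℕ (suc k)
0<fromℕ k = ℚₚ.+-mono-<-≤ Rationals.0<1 (0≤fromℕ k)

fromℕ-* : ∀ k l → fromℕ (k ℕ.* l) ≡ fromℕ k ℚ.* fromℕ l
fromℕ-* zero    l = ≡.sym (ℚₚ.*-zeroˡ (fromℕ l))
fromℕ-* (suc k) l = ≡.trans (fromℕ-+ l (k ℕ.* l)) (≡.trans (cong (fromℕ l ℚ.+_) (fromℕ-* k l))
  (solve 2 (λ k l → l :+ k :* l := (con 1ℚ :+ k) :* l) ≡.refl (fromℕ k) (fromℕ l)))
  where open +-*-Solver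

module Scalars (S : StarField) where
  open StarField S hiding (zero)
  private module ∑ = Algebra.Properties.Semiring.Sum semiring
  open Algebra.Properties.Ring ring using (-0#≈0#; -1*x≈-x) public
  open SetoidReasoning setoid

  -- Abstract because the unifier cannot infer the summand of an unfolded sum.
  abstract
    sum : ∀ {m} → (Fin m → Carrier) → Carrier
    sum = ∑.sum

    -- Opens the abstract sum for the comparison with the matrix and matrix-vector products in the
    -- definition of a representation.
    sum≡ : ∀ {m} (t : Fin m → Carrier) → sum t ≡ RawMonoidDefs.sum +-rawMonoid t
    sum≡ t = ≡.refl

    sum-[] : ∀ (t : Fin 0 → Carrier) → sum t ≈ 0#
    sum-[] t = refl

    sum-∷ : ∀ {m} (t : Fin (suc m) → Carrier) → sum t ≈ t zero + sum (t ∘ suc)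
    sum-∷ t = refl

    sum-cong : ∀ {m} {s t : Fin m → Carrier} → (∀ i → s i ≈ t i) → sum s ≈ sum t
    sum-cong {s = s} {t} h = ∑.sum-cong-≋ {x = s} {t} h

    sum-replicate-zero : ∀ m → sum {m} (λ _ → 0#) ≈ 0#
    sum-replicate-zero = ∑.sum-replicate-zero

    ∑-distrib-+ : ∀ {m} (s t : Fin m → Carrier) → sum (λ i → s i + t i) ≈ sum s + sum t
    ∑-distrib-+ = ∑.∑-distrib-+

    ∑-comm : ∀ {l m} (t : Fin l → Fin m → Carrier) →
             sum (λ i → sum (t i)) ≈ sum (λ j → sum (λ i → t i j))
    ∑-comm = ∑.∑-comm

    sum-permute : ∀ {m} (t : Fin m → Carrier) (π : Permutation m m) → sum t ≈ sum (λ i → t (π ⟨$⟩ʳ i))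
    sum-permute = ∑.sum-permute

    *-distribˡ-sum : ∀ {m} x (t : Fin m → Carrier) → x * sum t ≈ sum (λ i → x * t i)
    *-distribˡ-sum = ∑.*-distribˡ-sum

    *-distribʳ-sum : ∀ {m} x (t : Fin m → Carrier) → sum t * x ≈ sum (λ i → t i * x)
    *-distribʳ-sum = ∑.*-distribʳ-sum

  infix 4 _≤_
  _≤_ : Carrier → Carrier → Set
  x ≤ y = 0≤ (y - x)

  private variable x y z : Carrier

  0≤0 : 0≤ 0#
  0≤0 = 0≤-resp ι-0 (0≤-ι ℚₚ.≤-refl)

  0≤1 : 0≤ 1#
  0≤1 = 0≤-resp ι-1 (0≤-ι (ℚₚ.<⇒≤ Rationals.0<1))

  -- The distinction comes from ℚ: if 1 were 0, then -1 would be 0 too, hence nonnegative, and `ι`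
  -- reflects the order.
  1≉0 : ¬ 1# ≈ 0#
  1≉0 e = ℚₚ.<-irrefl ≡.refl (ℚₚ.<-≤-trans (ℚₚ.negative⁻¹ (ℚ.- 1ℚ)) (0≤-ι⁻¹ (0≤-resp 0≈ι-1 0≤0)))
    where
    0≈ι-1 : 0# ≈ ι (ℚ.- 1ℚ)
    0≈ι-1 = trans (sym -0#≈0#) (trans (-‿cong (trans (sym e) (sym ι-1))) (sym (ι-neg 1ℚ)))

  ≤-reflexive : x ≈ y → x ≤ y
  ≤-reflexive {x} {y} e = 0≤-resp (sym (trans (+-congʳ (sym e)) (-‿inverseʳ x))) 0≤0

  ≤-trans : x ≤ y → y ≤ z → x ≤ z
  ≤-trans {x} {y} {z} h k =
    0≤-resp (solve 3 (λ x y z → (y :- x) :+ (z :- y) := z :- x) refl x y z) (0≤-+ h k)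

  ≤-resp : ∀ {x y u v} → x ≈ u → y ≈ v → x ≤ y → u ≤ v
  ≤-resp e f = 0≤-resp (+-cong f (-‿cong e))

  ι-mono : ∀ {p q} → p ℚ.≤ q → ι p ≤ ι q
  ι-mono {p} {q} p≤q = 0≤-resp (trans (ι-+ q (ℚ.- p)) (+-congˡ (ι-neg p)))
    (0≤-ι (Rationals.p≤q⇒0≤q-p p≤q))

  *-monoʳ-≤ : ∀ {x y z} → 0≤ z → x ≤ y → x * z ≤ y * z
  *-monoʳ-≤ {x} {y} {z} h k =
    0≤-resp (solve 3 (λ x y z → (y :- x) :* z := y :* z :- x :* z) refl x y z) (0≤-* k h)

  *-monoˡ-≤ : ∀ {x y z} → 0≤ z → x ≤ y → z * x ≤ z * y
  *-monoˡ-≤ h k = ≤-resp (*-comm _ _) (*-comm _ _) (*-monoʳ-≤ h k)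

  0≤-≤ : ∀ {x y} → 0≤ x → x ≤ y → 0≤ y
  0≤-≤ {x} {y} h k = 0≤-resp (solve 2 (λ x y → x :+ (y :- x) := y) refl x y) (0≤-+ h k)

  ≤0⇒≈0 : 0≤ x → x ≤ 0# → x ≈ 0#
  ≤0⇒≈0 {x} h k = 0≤-antisym h (0≤-resp (+-identityˡ (- x)) k)

  conj-0 : conj 0# ≈ 0#
  conj-0 = 0≤⇒real 0≤0

  conj-1 : conj 1# ≈ 1#
  conj-1 = 0≤⇒real 0≤1

  x+y≈0⇒y≈-x : x + y ≈ 0# → y ≈ - x
  x+y≈0⇒y≈-x {x} {y} e = begin
    y             ≈⟨ solve 2 (λ x y → y := :- x :+ (x :+ y)) refl x y ⟩
    - x + (x + y) ≈⟨ +-congˡ e ⟩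
    - x + 0#      ≈⟨ +-identityʳ (- x) ⟩
    - x           ∎

  conj-neg : ∀ x → conj (- x) ≈ - conj x
  conj-neg x = x+y≈0⇒y≈-x (trans (sym (conj-+ x (- x))) (trans (conj-cong (-‿inverseʳ x)) conj-0))

  conj-ι : ∀ q → conj (ι q) ≈ ι q
  conj-ι q with ℚₚ.≤-total 0ℚ q
  ... | inj₁ 0≤q = 0≤⇒real (0≤-ι 0≤q)
  ... | inj₂ q≤0 = begin
    conj (ι q)            ≈⟨ conj-cong ι-q ⟩
    conj (- ι (ℚ.- q))    ≈⟨ conj-neg _ ⟩
    - conj (ι (ℚ.- q))    ≈⟨ -‿cong (0≤⇒real (0≤-ι (ℚₚ.neg-antimono-≤ q≤0))) ⟩
    - ι (ℚ.- q)           ≈⟨ ι-q ⟨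
    ι q                   ∎
    where
    ι-q : ι q ≈ - ι (ℚ.- q)
    ι-q = trans (solve 1 (λ x → x := :- (:- x)) refl (ι q)) (-‿cong (sym (ι-neg q)))

  conj-sum : ∀ {m} (t : Fin m → Carrier) → conj (sum t) ≈ sum (conj ∘ t)
  conj-sum {zero}  t = trans (conj-cong (sum-[] t)) (trans conj-0 (sym (sum-[] (conj ∘ t))))
  conj-sum {suc m} t = trans (conj-cong (sum-∷ t)) (trans (conj-+ _ _)
    (trans (+-congˡ (conj-sum (t ∘ suc))) (sym (sum-∷ (conj ∘ t)))))

  neg-sum : ∀ {m} (t : Fin m → Carrier) → - sum t ≈ sum (λ i → - t i)
  neg-sum {m} t = trans (sym (-1*x≈-x (sum t)))
    (trans (*-distribˡ-sum (- 1#) t) (sum-cong λ i → -1*x≈-x (t i)))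

  0≤-sum : ∀ {m} {t : Fin m → Carrier} → (∀ i → 0≤ t i) → 0≤ sum t
  0≤-sum {zero}  {t} h = 0≤-resp (sym (sum-[] t)) 0≤0
  0≤-sum {suc m} {t} h = 0≤-resp (sym (sum-∷ t)) (0≤-+ (h zero) (0≤-sum (h ∘ suc)))

  sum≈0 : ∀ {m} {t : Fin m → Carrier} → (∀ i → t i ≈ 0#) → sum t ≈ 0#
  sum≈0 {m} h = trans (sum-cong h) (sum-replicate-zero m)

  0≤-sum≈0 : ∀ {m} {t : Fin m → Carrier} → (∀ i → 0≤ t i) → sum t ≈ 0# → ∀ i → t i ≈ 0#
  0≤-sum≈0 {suc m} {t} h e zero = 0≤-antisym (h zero)
    (0≤-resp (x+y≈0⇒y≈-x (trans (sym (sum-∷ t)) e)) (0≤-sum (h ∘ suc)))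
  0≤-sum≈0 {suc m} {t} h e (suc i) = 0≤-sum≈0 (h ∘ suc)
    (0≤-antisym (0≤-sum (h ∘ suc)) (0≤-resp (x+y≈0⇒y≈-x (trans (+-comm _ _) (trans (sym (sum-∷ t)) e))) (h zero))) i

  sum-const : ∀ m x → sum {m} (λ _ → x) ≈ ι (fromℕ m) * x
  sum-const zero    x = trans (sum-[] (λ _ → x)) (trans (sym (zeroˡ x)) (*-congʳ (sym ι-0)))
  sum-const (suc m) x = begin
    sum {suc m} (λ _ → x)      ≈⟨ sum-∷ {m} (λ _ → x) ⟩
    x + sum {m} (λ _ → x)      ≈⟨ +-congˡ (sum-const m x) ⟩
    x + ι (fromℕ m) * x        ≈⟨ solve 2 (λ x m → x :+ m :* x := (con 1ℚ :+ m) :* x) refl x (ι (fromℕ m)) ⟩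
    (ι 1ℚ + ι (fromℕ m)) * x   ≈⟨ *-congʳ (ι-+ 1ℚ (fromℕ m)) ⟨
    ι (fromℕ (suc m)) * x      ∎

  -- The same conditional as in `1ᵐ`, so that `ρ-identity` proves `ρ-ε` as it stands.
  δ : ∀ {m} → Fin m → Fin m → Carrier
  δ i j = if does (i ≟ᶠ j) then 1# else 0#

  δ-refl : ∀ {m} (i : Fin m) → δ i i ≡ 1#
  δ-refl zero    = ≡.refl
  δ-refl (suc i) with i ≟ᶠ i | δ-refl i
  ... | yes _ | _ = ≡.refl
  ... | no _  | h = h

  δ-sym : ∀ {m} (i j : Fin m) → δ i j ≡ δ j i
  δ-sym zero zero = ≡.refl
  δ-sym zero (suc j) = ≡.refl
  δ-sym (suc i) zero = ≡.refl
  δ-sym (suc i) (suc j) with i ≟ᶠ j | j ≟ᶠ i | δ-sym i j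
  ... | yes _ | yes _ | _ = ≡.refl
  ... | no _  | no _  | _ = ≡.refl
  ... | yes _ | no _  | h = h
  ... | no _  | yes _ | h = h

  δ-suc : ∀ {m} (i j : Fin m) → δ (suc i) (suc j) ≡ δ i j
  δ-suc i j with i ≟ᶠ j
  ... | yes _ = ≡.refl
  ... | no _  = ≡.refl

  sum-δ : ∀ {m} (i : Fin m) (t : Fin m → Carrier) → sum (λ j → δ i j * t j) ≈ t i
  sum-δ zero t = trans (sum-∷ (λ j → δ zero j * t j)) (trans (+-cong (*-identityˡ _) (sum≈0 λ j → zeroˡ _)) (+-identityʳ _))
  sum-δ (suc i) t = begin
    sum (λ j → δ (suc i) j * t j)
      ≈⟨ sum-∷ (λ j → δ (suc i) j * t j) ⟩
    0# * t zero + sum (λ j → δ (suc i) (suc j) * t (suc j))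
      ≈⟨ +-cong (zeroˡ _) (sum-cong λ j → *-congʳ (reflexive (δ-suc i j))) ⟩
    0# + sum (λ j → δ i j * t (suc j))
      ≈⟨ +-identityˡ _ ⟩
    sum (λ j → δ i j * t (suc j))
      ≈⟨ sum-δ i (t ∘ suc) ⟩
    t (suc i) ∎

  cancel : ∀ {x y} a → a * y ≈ 1# → x * y ≈ 0# → x ≈ 0#
  cancel {x} {y} a ay≈1 xy≈0 = begin
    x             ≈⟨ *-identityʳ x ⟨
    x * 1#        ≈⟨ *-congˡ ay≈1 ⟨
    x * (a * y)   ≈⟨ solve 3 (λ x a y → x :* (a :* y) := a :* (x :* y)) refl x a y ⟩
    a * (x * y)   ≈⟨ *-congˡ xy≈0 ⟩
    a * 0#        ≈⟨ zeroʳ a ⟩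
    0#            ∎

-- The group algebra and its inner product

module GroupAlgebra (S : StarField) {n : ℕ} (_∙_ : Fin n → Fin n → Fin n) (ε : Fin n)
                    (_⁻¹ : Fin n → Fin n) (isGroup : IsGroup _≡_ _∙_ ε _⁻¹) where
  open StarField S hiding (zero)
  open Scalars S
  private
    group : Group 0ℓ 0ℓ
    group = record { isGroup = isGroup }
  open IsGroup isGroup using ()
    renaming (assoc to ∙-assoc; identityˡ to ∙-identityˡ; identityʳ to ∙-identityʳ;
              inverseˡ to ∙-inverseˡ; inverseʳ to ∙-inverseʳ)
  open Algebra.Properties.Group group

  A : Set
  A = Fin n → Carrier

  infix 4 _≐_
  -- A record, so that both sides can be inferred from the type.
  record _≐_ (a b : A) : Set where
    constructor pointwise
    field at : ∀ x → a x ≈ b x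
  open _≐_ public

  infixl 7 _⊛_
  infixl 6 _⊕_
  infixr 8 _•_

  -- `a ⊛ b` is the combination of the left translates of `b` with coefficients `a`: it unfolds to
  -- `lincomb a` of the family `shift y b`, which later proofs use without mention.
  _⊕_ _⊛_ : A → A → A
  (a ⊕ b) x = a x + b x
  (a ⊛ b) x = sum λ y → a y * b ((y ⁻¹) ∙ x)

  ⊖_ : A → A
  (⊖ a) x = - a x

  _•_ : Carrier → A → A
  (c • a) x = c * a x

  𝟘 𝟙 : A
  𝟘 x = 0#
  𝟙 x = δ ε x

  star : A → A
  star a x = conj (a (x ⁻¹))

  -- Up to the factor |G|, the trace of multiplication by `a` on the group algebra; hence `τ-comm`
  -- and `trace≈rank`.
  τ : A → Carrier
  τ a = a ε

  shift : Fin n → A → A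
  shift g a x = a ((g ⁻¹) ∙ x)

  ap : ∀ (a : A) {x y} → x ≡ y → a x ≈ a y
  ap a e = reflexive (cong a e)

  reindexˡ : ∀ g (t : A) → sum t ≈ sum (λ x → t (g ∙ x))
  reindexˡ g t = sum-permute t (permutation (g ∙_) ((g ⁻¹) ∙_) (\\-leftDividesˡ g) (\\-leftDividesʳ g))

  reindexʳ : ∀ g (t : A) → sum t ≈ sum (λ x → t (x ∙ g))
  reindexʳ g t = sum-permute t (permutation (_∙ g) (_∙ (g ⁻¹)) (//-rightDividesˡ g) (//-rightDividesʳ g))

  reindex⁻¹ : ∀ (t : A) → sum t ≈ sum (λ x → t (x ⁻¹))
  reindex⁻¹ t = sum-permute t (permutation _⁻¹ _⁻¹ ⁻¹-involutive ⁻¹-involutive)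

  ⊛-cong : ∀ {a a′ b b′} → a ≐ a′ → b ≐ b′ → a ⊛ b ≐ a′ ⊛ b′
  ⊛-cong e f = pointwise λ x → sum-cong λ y → *-cong (at e y) (at f _)

  [gh]⁻¹x : ∀ g h x → ((g ∙ h) ⁻¹) ∙ x ≡ (h ⁻¹) ∙ ((g ⁻¹) ∙ x)
  [gh]⁻¹x g h x = ≡.trans (cong (_∙ x) (⁻¹-anti-homo-∙ g h)) (∙-assoc _ _ _)

  shift-⊛ : ∀ g a b → shift g (a ⊛ b) ≐ shift g a ⊛ b
  shift-⊛ g a b = pointwise λ x → trans (reindexˡ (g ⁻¹) (λ y → a y * b ((y ⁻¹) ∙ ((g ⁻¹) ∙ x))))
    (sum-cong λ y → *-congˡ (ap b (≡.trans ([gh]⁻¹x (g ⁻¹) y ((g ⁻¹) ∙ x))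
      (cong ((y ⁻¹) ∙_) (\\-leftDividesʳ (g ⁻¹) x)))))

  ⊛-assoc : ∀ a b c → (a ⊛ b) ⊛ c ≐ a ⊛ (b ⊛ c)
  ⊛-assoc a b c = pointwise λ x → begin
    sum (λ y → (a ⊛ b) y * c ((y ⁻¹) ∙ x))
      ≈⟨ sum-cong (λ y → *-distribʳ-sum (c ((y ⁻¹) ∙ x)) (λ z → a z * b ((z ⁻¹) ∙ y))) ⟩
    sum (λ y → sum (λ z → a z * b ((z ⁻¹) ∙ y) * c ((y ⁻¹) ∙ x)))
      ≈⟨ ∑-comm (λ y z → a z * b ((z ⁻¹) ∙ y) * c ((y ⁻¹) ∙ x)) ⟩
    sum (λ z → sum (λ y → a z * b ((z ⁻¹) ∙ y) * c ((y ⁻¹) ∙ x)))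
      ≈⟨ sum-cong (λ z → trans (sum-cong λ y → *-assoc (a z) _ _)
           (sym (*-distribˡ-sum (a z) (λ y → b ((z ⁻¹) ∙ y) * c ((y ⁻¹) ∙ x))))) ⟩
    sum (λ z → a z * (shift z b ⊛ c) x)
      ≈⟨ sum-cong (λ z → *-congˡ (at (shift-⊛ z b c) x)) ⟨
    sum (λ z → a z * (b ⊛ c) ((z ⁻¹) ∙ x)) ∎
    where open SetoidReasoning setoid

  𝟙-δ : ∀ x y → 𝟙 ((x ⁻¹) ∙ y) ≡ δ x y
  𝟙-δ x y with ε ≟ᶠ ((x ⁻¹) ∙ y) | x ≟ᶠ y
  ... | yes _ | yes _ = ≡.refl
  ... | no _  | no _  = ≡.refl
  ... | yes e | no h  = ⊥-elim (h (≡.trans (≡.sym (∙-identityʳ x)) (≡.trans (cong (x ∙_) e) (\\-leftDividesˡ x y))))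
  ... | no h  | yes ≡.refl = ⊥-elim (h (≡.sym (∙-inverseˡ x)))

  ⊛-identityˡ : ∀ a → 𝟙 ⊛ a ≐ a
  ⊛-identityˡ a = pointwise λ x → trans (sum-δ ε (λ y → a ((y ⁻¹) ∙ x)))
    (ap a (≡.trans (cong (_∙ x) ε⁻¹≈ε) (∙-identityˡ x)))

  ⊛-identityʳ : ∀ a → a ⊛ 𝟙 ≐ a
  ⊛-identityʳ a = pointwise λ x → trans
    (sum-cong λ y → trans (*-comm _ _) (*-congʳ (reflexive (≡.trans (𝟙-δ y x) (δ-sym y x)))))
    (sum-δ x a)

  ⊛-distribˡ : ∀ a b c → a ⊛ (b ⊕ c) ≐ a ⊛ b ⊕ a ⊛ c
  ⊛-distribˡ a b c = pointwise λ x → trans (sum-cong λ y → distribˡ _ _ _)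
    (∑-distrib-+ (λ y → a y * b ((y ⁻¹) ∙ x)) (λ y → a y * c ((y ⁻¹) ∙ x)))

  ⊛-distribʳ : ∀ a b c → (b ⊕ c) ⊛ a ≐ b ⊛ a ⊕ c ⊛ a
  ⊛-distribʳ a b c = pointwise λ x → trans (sum-cong λ y → distribʳ _ _ _)
    (∑-distrib-+ (λ y → b y * a ((y ⁻¹) ∙ x)) (λ y → c y * a ((y ⁻¹) ∙ x)))

  ≐-refl : ∀ {a} → a ≐ a
  ≐-refl = pointwise λ _ → refl
  ≐-sym : ∀ {a b} → a ≐ b → b ≐ a
  ≐-sym e = pointwise λ x → sym (at e x)
  ≐-trans : ∀ {a b c} → a ≐ b → b ≐ c → a ≐ c
  ≐-trans e f = pointwise λ x → trans (at e x) (at f x)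

  algebra : Ring 0ℓ 0ℓ
  algebra = record
    { Carrier = A ; _≈_ = _≐_ ; _+_ = _⊕_ ; _*_ = _⊛_ ; -_ = ⊖_ ; 0# = 𝟘 ; 1# = 𝟙
    ; isRing = record
      { +-isAbelianGroup = record
        { isGroup = record
          { isMonoid = record
            { isSemigroup = record
              { isMagma = record
                { isEquivalence = record { refl = ≐-refl ; sym = ≐-sym ; trans = ≐-trans }
                ; ∙-cong = λ e f → pointwise λ x → +-cong (at e x) (at f x) }
              ; assoc = λ a b c → pointwise λ x → +-assoc _ _ _ }
            ; identity = (λ a → pointwise λ x → +-identityˡ _) , (λ a → pointwise λ x → +-identityʳ _) }
          ; inverse = (λ a → pointwise λ x → -‿inverseˡ _) , (λ a → pointwise λ x → -‿inverseʳ _)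
          ; ⁻¹-cong = λ e → pointwise λ x → -‿cong (at e x) }
        ; comm = λ a b → pointwise λ x → +-comm _ _ }
      ; *-cong = ⊛-cong
      ; *-assoc = ⊛-assoc
      ; *-identity = ⊛-identityˡ , ⊛-identityʳ
      ; distrib = ⊛-distribˡ , ⊛-distribʳ } }

  module A = Ring algebra
  module AP = Algebra.Properties.Ring algebra
  module ≐-Reasoning = SetoidReasoning A.setoid
  module ≈-Reasoning = SetoidReasoning setoid

  private variable a b c a′ b′ : A

  •-cong : ∀ {s t} → s ≈ t → a ≐ b → s • a ≐ t • b
  •-cong e f = pointwise λ x → *-cong e (at f x)

  •-congˡ : ∀ s → a ≐ b → s • a ≐ s • b
  •-congˡ s f = •-cong refl f

  •-⊛ : ∀ s a b → (s • a) ⊛ b ≐ s • (a ⊛ b)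
  •-⊛ s a b = pointwise λ x → trans (sum-cong λ y → *-assoc s _ _)
    (sym (*-distribˡ-sum s (λ y → a y * b ((y ⁻¹) ∙ x))))

  ⊛-• : ∀ s a b → a ⊛ (s • b) ≐ s • (a ⊛ b)
  ⊛-• s a b = pointwise λ x → trans (sum-cong λ y → solve 3 (λ s a b → a :* (s :* b) := s :* (a :* b)) refl s (a y) _)
    (sym (*-distribˡ-sum s (λ y → a y * b ((y ⁻¹) ∙ x))))

  •-• : ∀ s t a → s • (t • a) ≐ (s * t) • a
  •-• s t a = pointwise λ x → sym (*-assoc s t (a x))

  •-identity : ∀ a → 1# • a ≐ a
  •-identity a = pointwise λ x → *-identityˡ (a x)

  star-cong : a ≐ b → star a ≐ star b
  star-cong e = pointwise λ x → conj-cong (at e _)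

  star-star : ∀ a → star (star a) ≐ a
  star-star a = pointwise λ x → trans (conj-conj _) (ap a (⁻¹-involutive x))

  star-⊕ : ∀ a b → star (a ⊕ b) ≐ star a ⊕ star b
  star-⊕ a b = pointwise λ x → conj-+ _ _

  star-⊖ : ∀ a → star (⊖ a) ≐ ⊖ star a
  star-⊖ a = pointwise λ x → conj-neg _

  star-• : ∀ s a → star (s • a) ≐ conj s • star a
  star-• s a = pointwise λ x → conj-* _ _

  star-𝟙 : star 𝟙 ≐ 𝟙
  star-𝟙 = pointwise λ x → trans (conj-cong (reflexive (≡.trans (cong 𝟙 (≡.sym (∙-identityʳ (x ⁻¹)))) (≡.trans (𝟙-δ x ε) (δ-sym x ε)))))
    (conj-δ x)
    where
    conj-δ : ∀ x → conj (δ ε x) ≈ δ ε x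
    conj-δ x with ε ≟ᶠ x
    ... | yes _ = conj-1
    ... | no _  = conj-0

  star-⊛ : ∀ a b → star (a ⊛ b) ≐ star b ⊛ star a
  star-⊛ a b = pointwise λ x → begin
    conj (sum λ y → a y * b ((y ⁻¹) ∙ (x ⁻¹)))
      ≈⟨ conj-sum (λ y → a y * b ((y ⁻¹) ∙ (x ⁻¹))) ⟩
    sum (λ y → conj (a y * b ((y ⁻¹) ∙ (x ⁻¹))))
      ≈⟨ reindexˡ (x ⁻¹) (λ y → conj (a y * b ((y ⁻¹) ∙ (x ⁻¹)))) ⟩
    sum (λ y → conj (a ((x ⁻¹) ∙ y) * b ((((x ⁻¹) ∙ y) ⁻¹) ∙ (x ⁻¹))))
      ≈⟨ sum-cong (λ y → trans (conj-* _ _) (trans (*-comm _ _) (*-cong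
           (conj-cong (ap b (lemma x y))) (conj-cong (ap a (≡.sym (lemma′ x y))))))) ⟩
    sum (λ y → conj (b (y ⁻¹)) * conj (a (((y ⁻¹) ∙ x) ⁻¹))) ∎
    where
    open ≈-Reasoning
    lemma : ∀ x y → (((x ⁻¹) ∙ y) ⁻¹) ∙ (x ⁻¹) ≡ y ⁻¹
    lemma x y = ≡.trans ([gh]⁻¹x (x ⁻¹) y (x ⁻¹))
      (≡.trans (cong ((y ⁻¹) ∙_) (∙-inverseˡ (x ⁻¹))) (∙-identityʳ (y ⁻¹)))
    lemma′ : ∀ x y → ((y ⁻¹) ∙ x) ⁻¹ ≡ (x ⁻¹) ∙ y
    lemma′ x y = ≡.trans (⁻¹-anti-homo-∙ (y ⁻¹) x) (cong ((x ⁻¹) ∙_) (⁻¹-involutive y))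

  ⟪_,_⟫ : A → A → Carrier
  ⟪ a , b ⟫ = sum λ x → a x * conj (b x)

  N : A → Carrier
  N a = ⟪ a , a ⟫

  ⟪⟫-cong : a ≐ a′ → b ≐ b′ → ⟪ a , b ⟫ ≈ ⟪ a′ , b′ ⟫
  ⟪⟫-cong e f = sum-cong λ x → *-cong (at e x) (conj-cong (at f x))

  N-cong : a ≐ b → N a ≈ N b
  N-cong e = ⟪⟫-cong e e

  ⟪⟫-⊕ˡ : ∀ a b c → ⟪ a ⊕ b , c ⟫ ≈ ⟪ a , c ⟫ + ⟪ b , c ⟫
  ⟪⟫-⊕ˡ a b c = trans (sum-cong λ x → distribʳ _ _ _)
    (∑-distrib-+ (λ x → a x * conj (c x)) (λ x → b x * conj (c x)))

  ⟪⟫-•ˡ : ∀ s a b → ⟪ s • a , b ⟫ ≈ s * ⟪ a , b ⟫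
  ⟪⟫-•ˡ s a b = trans (sum-cong λ x → *-assoc s _ _) (sym (*-distribˡ-sum s (λ x → a x * conj (b x))))

  ⟪⟫-⊖ˡ : ∀ a b → ⟪ ⊖ a , b ⟫ ≈ - ⟪ a , b ⟫
  ⟪⟫-⊖ˡ a b = trans (sum-cong λ x → solve 2 (λ a b → (:- a) :* b := :- (a :* b)) refl (a x) _)
    (sym (neg-sum (λ x → a x * conj (b x))))

  ⟪⟫-conj : ∀ a b → conj ⟪ a , b ⟫ ≈ ⟪ b , a ⟫
  ⟪⟫-conj a b = trans (conj-sum λ x → a x * conj (b x))
    (sum-cong λ x → trans (conj-* _ _) (trans (*-congˡ (conj-conj _)) (*-comm _ _)))

  private
    flip : ∀ {s} → conj ⟪ b , a ⟫ ≈ s → ⟪ a , b ⟫ ≈ s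
    flip {b} {a} e = trans (sym (⟪⟫-conj b a)) e

  ⟪⟫-⊕ʳ : ∀ a b c → ⟪ a , b ⊕ c ⟫ ≈ ⟪ a , b ⟫ + ⟪ a , c ⟫
  ⟪⟫-⊕ʳ a b c = flip (trans (conj-cong (⟪⟫-⊕ˡ b c a)) (trans (conj-+ _ _) (+-cong (⟪⟫-conj b a) (⟪⟫-conj c a))))

  ⟪⟫-•ʳ : ∀ s a b → ⟪ a , s • b ⟫ ≈ conj s * ⟪ a , b ⟫
  ⟪⟫-•ʳ s a b = flip (trans (conj-cong (⟪⟫-•ˡ s b a)) (trans (conj-* _ _) (*-congˡ (⟪⟫-conj b a))))

  ⟪⟫-⊖ʳ : ∀ a b → ⟪ a , ⊖ b ⟫ ≈ - ⟪ a , b ⟫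
  ⟪⟫-⊖ʳ a b = flip (trans (conj-cong (⟪⟫-⊖ˡ b a)) (trans (conj-neg _) (-‿cong (⟪⟫-conj b a))))

  ⟪⟫-τ : ∀ a b → ⟪ a , b ⟫ ≈ τ (a ⊛ star b)
  ⟪⟫-τ a b = sum-cong λ y → *-congˡ (conj-cong (ap b
    (≡.sym (≡.trans (cong _⁻¹ (∙-identityʳ (y ⁻¹))) (⁻¹-involutive y)))))

  τ-comm : ∀ a b → τ (a ⊛ b) ≈ τ (b ⊛ a)
  τ-comm a b = trans (reindex⁻¹ (λ y → a y * b ((y ⁻¹) ∙ ε)))
    (sum-cong λ y → trans (*-comm _ _) (*-cong
      (ap b (≡.trans (∙-identityʳ _) (⁻¹-involutive y))) (ap a (≡.sym (∙-identityʳ (y ⁻¹))))))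

  0≤N : ∀ a → 0≤ N a
  0≤N a = 0≤-sum λ x → 0≤-norm (a x)

  N≈0 : N a ≈ 0# → a ≐ 𝟘
  N≈0 {a} e = pointwise λ x → norm-definite (0≤-sum≈0 (λ y → 0≤-norm (a y)) e x)

  N-𝟘 : N 𝟘 ≈ 0#
  N-𝟘 = sum≈0 {n} λ x → zeroˡ _

  N-𝟙 : N 𝟙 ≈ 1#
  N-𝟙 = trans (sum-δ ε (λ x → conj (𝟙 x))) (trans (conj-cong (reflexive (δ-refl ε))) conj-1)

  -- Both sides are the trace `τ` of a b c*.
  ⟪⟫-adjointʳ : ∀ a b c → ⟪ a ⊛ b , c ⟫ ≈ ⟪ a , c ⊛ star b ⟫
  ⟪⟫-adjointʳ a b c = begin
    ⟪ a ⊛ b , c ⟫                   ≈⟨ ⟪⟫-τ _ c ⟩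
    τ (a ⊛ b ⊛ star c)              ≈⟨ at (⊛-assoc a b (star c)) ε ⟩
    τ (a ⊛ (b ⊛ star c))            ≈⟨ at (⊛-cong (≐-refl {a}) (⊛-cong (star-star b) (≐-refl {star c}))) ε ⟨
    τ (a ⊛ (star (star b) ⊛ star c)) ≈⟨ at (⊛-cong (≐-refl {a}) (star-⊛ c (star b))) ε ⟨
    τ (a ⊛ star (c ⊛ star b))       ≈⟨ ⟪⟫-τ a _ ⟨
    ⟪ a , c ⊛ star b ⟫              ∎
    where open ≈-Reasoning

  ⟪⟫-shift : ∀ g a b → ⟪ shift g a , shift g b ⟫ ≈ ⟪ a , b ⟫
  ⟪⟫-shift g a b = sym (reindexˡ (g ⁻¹) (λ x → a x * conj (b x)))

  shift-∙ : ∀ g h a → shift (g ∙ h) a ≐ shift g (shift h a)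
  shift-∙ g h a = pointwise λ x → ap a ([gh]⁻¹x g h x)

  shift-ε : ∀ a → shift ε a ≐ a
  shift-ε a = pointwise λ x → ap a (≡.trans (cong (_∙ x) ε⁻¹≈ε) (∙-identityˡ x))

  shift-cong : ∀ g → a ≐ b → shift g a ≐ shift g b
  shift-cong g e = pointwise λ x → at e _

  lincomb : ∀ {m} → (Fin m → Carrier) → (Fin m → A) → A
  lincomb c w x = sum λ i → c i * w i x

  lincomb-cong : ∀ {m} {c d : Fin m → Carrier} (w : Fin m → A) → (∀ i → c i ≈ d i) → lincomb c w ≐ lincomb d w
  lincomb-cong w e = pointwise λ x → sum-cong λ i → *-congʳ (e i)

  ⟪⟫-lincomb : ∀ {m} (c : Fin m → Carrier) (w : Fin m → A) b →
    ⟪ lincomb c w , b ⟫ ≈ sum λ i → c i * ⟪ w i , b ⟫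
  ⟪⟫-lincomb c w b = begin
    sum (λ x → sum (λ i → c i * w i x) * conj (b x))
      ≈⟨ sum-cong (λ x → trans (*-distribʳ-sum (conj (b x)) (λ i → c i * w i x)) (sum-cong λ i → *-assoc (c i) (w i x) _)) ⟩
    sum (λ x → sum (λ i → c i * (w i x * conj (b x))))
      ≈⟨ ∑-comm (λ x i → c i * (w i x * conj (b x))) ⟩
    sum (λ i → sum (λ x → c i * (w i x * conj (b x))))
      ≈⟨ sum-cong (λ i → *-distribˡ-sum (c i) (λ x → w i x * conj (b x))) ⟨
    sum (λ i → c i * ⟪ w i , b ⟫) ∎
    where open ≈-Reasoning

  lincomb-[] : ∀ (c : Fin 0 → Carrier) w → lincomb c w ≐ 𝟘
  lincomb-[] c w = pointwise λ x → sum-[] λ i → c i * w i x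

  lincomb-∷ : ∀ {m} (c : Fin (suc m) → Carrier) w →
    lincomb c w ≐ c zero • w zero ⊕ lincomb (c ∘ suc) (w ∘ suc)
  lincomb-∷ c w = pointwise λ x → sum-∷ λ i → c i * w i x

  -- From N(a + b) ≤ 2 (N(a) + N(b)); any constant depending on m alone would do.
  growth : ℕ → ℚ
  growth zero    = 0ℚ
  growth (suc m) = (1ℚ ℚ.+ 1ℚ) ℚ.+ (1ℚ ℚ.+ 1ℚ) ℚ.* growth m

  0≤growth : ∀ m → 0ℚ ℚ.≤ growth m
  0≤growth zero = ℚₚ.≤-refl
  0≤growth (suc m) = Rationals.0≤p+q {1ℚ ℚ.+ 1ℚ} (ℚₚ.nonNegative⁻¹ (1ℚ ℚ.+ 1ℚ))
    (Rationals.0≤p*q {1ℚ ℚ.+ 1ℚ} (ℚₚ.nonNegative⁻¹ (1ℚ ℚ.+ 1ℚ)) (0≤growth m))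

  N-⊕ : ∀ a b → N (a ⊕ b) ≈ (N a + N b) + (⟪ a , b ⟫ + ⟪ b , a ⟫)
  N-⊕ a b = trans (⟪⟫-⊕ˡ a b (a ⊕ b)) (trans (+-cong (⟪⟫-⊕ʳ a a b) (⟪⟫-⊕ʳ b a b))
    (solve 4 (λ p q r s → (p :+ q) :+ (r :+ s) := (p :+ s) :+ (q :+ r)) refl (N a) ⟪ a , b ⟫ ⟪ b , a ⟫ (N b)))

  N-⊖ : ∀ a b → N (a ⊕ ⊖ b) ≈ (N a + N b) - (⟪ a , b ⟫ + ⟪ b , a ⟫)
  N-⊖ a b = trans (N-⊕ a (⊖ b)) (trans (+-cong
      (+-congˡ (trans (⟪⟫-⊖ˡ b (⊖ b)) (trans (-‿cong (⟪⟫-⊖ʳ b b)) (solve 1 (λ x → :- (:- x) := x) refl (N b)))))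
      (+-cong (⟪⟫-⊖ʳ a b) (⟪⟫-⊖ˡ b a)))
    (solve 4 (λ p q r s → (p :+ q) :+ (:- r :+ :- s) := (p :+ q) :- (r :+ s)) refl (N a) (N b) ⟪ a , b ⟫ ⟪ b , a ⟫))

  N-• : ∀ s a → N (s • a) ≈ s * conj s * N a
  N-• s a = trans (⟪⟫-•ˡ s a (s • a)) (trans (*-congˡ (⟪⟫-•ʳ s a a)) (sym (*-assoc _ _ _)))

  -- The parallelogram law: the two sides differ by `N (a ⊕ ⊖ b)`.
  N-⊕-bound : ∀ a b → N (a ⊕ b) ≤ (1# + 1#) * (N a + N b)
  N-⊕-bound a b = 0≤-resp (trans (N-⊖ a b) (trans
    (solve 2 (λ s t → s :- t := (con 1ℚ :+ con 1ℚ) :* s :- (s :+ t)) refl (N a + N b) (⟪ a , b ⟫ + ⟪ b , a ⟫))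
    (+-cong (*-congʳ (+-cong ι-1 ι-1)) (-‿cong (sym (N-⊕ a b)))))) (0≤N (a ⊕ ⊖ b))

  N-lincomb : ∀ {m} (c : Fin m → Carrier) (w : Fin m → A) {M} → 0≤ M → (∀ i → N (w i) ≈ M) →
    N (lincomb c w) ≤ ι (growth m) * ((sum λ i → c i * conj (c i)) * M)
  N-lincomb {zero} c w 0≤M e = ≤-reflexive (trans (trans (N-cong (lincomb-[] c w)) N-𝟘) (sym (trans (*-congʳ ι-0) (zeroˡ _))))
  N-lincomb {suc m} c w {M} 0≤M e =
    0≤-resp (trans (solve 6 (λ two g u s M n →
        (two :* (u :* M :+ g :* (s :* M)) :- n) :+ (two :* g :* u :* M :+ two :* s :* M)
        := (two :+ two :* g) :* ((u :+ s) :* M) :- n) refl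
        (1# + 1#) (ι (growth m)) u s M (N (c zero • w zero ⊕ rest)))
      (+-cong (*-cong (sym ι-growth) (*-congʳ (sym (sum-∷ λ i → c i * conj (c i))))) (-‿cong (N-cong (≐-sym (lincomb-∷ c w))))))
      (0≤-+ (≤-trans (N-⊕-bound (c zero • w zero) (lincomb (c ∘ suc) (w ∘ suc)))
              (0≤-resp (trans (solve 4 (λ two x y z → two :* (z :- y) := two :* (x :+ z) :- two :* (x :+ y)) refl
                 (1# + 1#) (N (c zero • w zero)) (N rest) (ι (growth m) * (s * M)))
                 (+-congʳ (*-congˡ (+-congʳ (trans (N-• (c zero) (w zero)) (*-congˡ (e zero)))))))
                 (0≤-* 0≤2 (N-lincomb (c ∘ suc) (w ∘ suc) 0≤M (e ∘ suc)))))
            -- The terms 2guM and 2sM are the surplus that the recursion of `growth` gives away.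
            (0≤-+ (0≤-* (0≤-* (0≤-* 0≤2 (0≤-ι (0≤growth m))) (0≤-norm (c zero))) 0≤M)
                  (0≤-* (0≤-* 0≤2 (0≤-sum λ i → 0≤-norm (c (suc i)))) 0≤M)))
    where
    u = c zero * conj (c zero)
    s = sum λ i → c (suc i) * conj (c (suc i))
    rest = lincomb (c ∘ suc) (w ∘ suc)
    0≤2 : 0≤ (1# + 1#)
    0≤2 = 0≤-+ 0≤1 0≤1
    ι-2 : ι (1ℚ ℚ.+ 1ℚ) ≈ 1# + 1#
    ι-2 = trans (ι-+ 1ℚ 1ℚ) (+-cong ι-1 ι-1)
    ι-growth : ι (growth (suc m)) ≈ (1# + 1#) + (1# + 1#) * ι (growth m)
    ι-growth = trans (ι-+ (1ℚ ℚ.+ 1ℚ) _) (+-cong ι-2 (trans (ι-* (1ℚ ℚ.+ 1ℚ) (growth m)) (*-congʳ ι-2)))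

  -- `a ⊛ b` combines `n` translates of `b`, translation preserves `N`, and the coefficients have
  -- square sum `N a`.
  N-⊛ : ∀ a b → N (a ⊛ b) ≤ ι (growth n) * (N a * N b)
  N-⊛ a b = N-lincomb a (λ y → shift y b) (0≤N b) (λ y → ⟪⟫-shift y b b)

-- Orthogonal families and projections onto left ideals

module Projections (S : StarField) {n : ℕ} (_∙_ : Fin n → Fin n → Fin n) (ε : Fin n)
                    (_⁻¹ : Fin n → Fin n) (isGroup : IsGroup _≡_ _∙_ ε _⁻¹) where
  open StarField S hiding (zero)
  open Scalars S
  open GroupAlgebra S _∙_ ε _⁻¹ isGroup
  open IsGroup isGroup using () renaming (inverseˡ to ∙-inverseˡ; inverseʳ to ∙-inverseʳ; identityʳ to ∙-identityʳ)

  private variable a b c : A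

  record IsSubmodule (P : A → Set) : Set where
    field
      ∈-resp : ∀ {a b} → a ≐ b → P a → P b
      𝟘∈     : P 𝟘
      ⊕∈     : ∀ {a b} → P a → P b → P (a ⊕ b)
      •∈     : ∀ s {a} → P a → P (s • a)

    ⊖∈ : ∀ {a b} → P a → P b → P (a ⊕ ⊖ b)
    ⊖∈ {a} {b} p q = ⊕∈ p (∈-resp (pointwise λ x → -1*x≈-x (b x)) (•∈ (- 1#) q))

    lincomb∈ : ∀ {m} (c : Fin m → Carrier) w → (∀ i → P (w i)) → P (lincomb c w)
    lincomb∈ {zero}  c w h = ∈-resp (≐-sym (lincomb-[] c w)) 𝟘∈
    lincomb∈ {suc m} c w h = ∈-resp (≐-sym (lincomb-∷ c w))
      (⊕∈ (•∈ (c zero) (h zero)) (lincomb∈ (c ∘ suc) (w ∘ suc) (h ∘ suc)))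

  -- Orthogonal rather than orthonormal vectors, so that no square roots are needed.
  record OrthoFamily (k : ℕ) : Set where
    field
      basis : Fin k → A
      scale : Fin k → Carrier
      ortho : ∀ i j → scale i * ⟪ basis j , basis i ⟫ ≈ δ i j

    coeffs : A → Fin k → Carrier
    coeffs a i = scale i * ⟪ a , basis i ⟫

    proj : A → A
    proj a = lincomb (coeffs a) basis

    coeffs-cong : a ≐ b → ∀ i → coeffs a i ≈ coeffs b i
    coeffs-cong e i = *-congˡ (⟪⟫-cong e ≐-refl)

    proj-cong : a ≐ b → proj a ≐ proj b
    proj-cong e = lincomb-cong basis (coeffs-cong e)

    coeffs-lincomb : ∀ {m} (c : Fin m → Carrier) w i →
      coeffs (lincomb c w) i ≈ sum λ j → c j * coeffs (w j) i
    coeffs-lincomb c w i = trans (*-congˡ (⟪⟫-lincomb c w (basis i)))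
      (trans (*-distribˡ-sum (scale i) λ j → c j * ⟪ w j , basis i ⟫)
        (sum-cong λ j → solve 3 (λ s c t → s :* (c :* t) := c :* (s :* t)) refl (scale i) (c j) ⟪ w j , basis i ⟫))

    proj-lincomb : ∀ {m} (c : Fin m → Carrier) w → proj (lincomb c w) ≐ lincomb c (proj ∘ w)
    proj-lincomb c w = pointwise λ x → begin
      sum (λ i → coeffs (lincomb c w) i * basis i x)
        ≈⟨ sum-cong (λ i → *-congʳ (coeffs-lincomb c w i)) ⟩
      sum (λ i → (sum λ j → c j * coeffs (w j) i) * basis i x)
        ≈⟨ sum-cong (λ i → trans (*-distribʳ-sum (basis i x) (λ j → c j * coeffs (w j) i)) (sum-cong λ j → *-assoc (c j) _ _)) ⟩
      sum (λ i → sum λ j → c j * (coeffs (w j) i * basis i x))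
        ≈⟨ ∑-comm (λ i j → c j * (coeffs (w j) i * basis i x)) ⟩
      sum (λ j → sum λ i → c j * (coeffs (w j) i * basis i x))
        ≈⟨ sum-cong (λ j → *-distribˡ-sum (c j) (λ i → coeffs (w j) i * basis i x)) ⟨
      sum (λ j → c j * proj (w j) x) ∎
      where open ≈-Reasoning

    coeffs-span : ∀ (c : Fin k → Carrier) i → coeffs (lincomb c basis) i ≈ c i
    coeffs-span c i = trans (coeffs-lincomb c basis i)
      (trans (sum-cong λ j → trans (*-congˡ (ortho i j)) (*-comm _ _)) (sum-δ i c))

    coeffs-⊖ : ∀ a b i → coeffs (a ⊕ ⊖ b) i ≈ coeffs a i - coeffs b i
    coeffs-⊖ a b i = trans (*-congˡ (trans (⟪⟫-⊕ˡ a (⊖ b) (basis i)) (+-congˡ (⟪⟫-⊖ˡ b (basis i)))))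
      (solve 3 (λ s a b → s :* (a :+ :- b) := s :* a :- s :* b) refl (scale i) ⟪ a , basis i ⟫ ⟪ b , basis i ⟫)

    residual : A → A
    residual a = a ⊕ ⊖ proj a

    residual⊥basis : ∀ a i → ⟪ residual a , basis i ⟫ ≈ 0#
    residual⊥basis a i = cancel (⟪ basis i , basis i ⟫)
      (trans (*-comm _ _) (trans (ortho i i) (reflexive (δ-refl i))))
      (trans (*-comm _ _) (trans (coeffs-⊖ a (proj a) i)
        (trans (+-congˡ (-‿cong (coeffs-span (coeffs a) i))) (-‿inverseʳ _))))

    ⊥residual : ∀ a b → proj b ≐ b → ⟪ b , residual a ⟫ ≈ 0#
    ⊥residual a b e = trans (⟪⟫-cong (≐-sym e) ≐-refl) (trans (⟪⟫-lincomb (coeffs b) basis (residual a))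
      (sum≈0 λ i → trans (*-congˡ (trans (sym (⟪⟫-conj (residual a) (basis i)))
        (trans (conj-cong (residual⊥basis a i)) conj-0))) (zeroʳ _)))

    residual⊥ : ∀ a b → proj b ≐ b → ⟪ residual a , b ⟫ ≈ 0#
    residual⊥ a b e = trans (sym (⟪⟫-conj b (residual a))) (trans (conj-cong (⊥residual a b e)) conj-0)

    proj-proj : ∀ a → proj (proj a) ≐ proj a
    proj-proj a = lincomb-cong basis (coeffs-span (coeffs a))

  open OrthoFamily

  emptyFamily : OrthoFamily 0
  emptyFamily = record { basis = λ () ; scale = λ () ; ortho = λ () }

  module _ {k} (F : OrthoFamily k) (w : A) (s : Carrier) (sN≈1 : s * N (residual F w) ≈ 1#) where
    private
      r = residual F w

    extend : OrthoFamily (suc k)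
    extend = record
      { basis = λ { zero → r ; (suc i) → basis F i }
      ; scale = λ { zero → s ; (suc i) → scale F i }
      ; ortho = λ where
          zero    zero    → sN≈1
          zero    (suc j) → trans (*-congˡ (trans (sym (⟪⟫-conj r (basis F j)))
            (trans (conj-cong (residual⊥basis F w j)) conj-0))) (zeroʳ s)
          (suc i) zero    → trans (*-congˡ (residual⊥basis F w i)) (zeroʳ _)
          (suc i) (suc j) → trans (ortho F i j) (reflexive (≡.sym (δ-suc i j)))
      }

    proj-extend : ∀ a → proj extend a ≐ (s * ⟪ a , r ⟫) • r ⊕ proj F a
    proj-extend a = lincomb-∷ _ _

    proj-extend-fixed : ∀ a → proj F a ≐ a → proj extend a ≐ a
    proj-extend-fixed a e = ≐-trans (proj-extend a) (pointwise λ x → trans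
      (+-cong (*-congʳ (trans (*-congˡ (⊥residual F w a e)) (zeroʳ s))) (at e x))
      (trans (+-congʳ (zeroˡ _)) (+-identityˡ _)))

    proj-extend-new : proj extend w ≐ w
    proj-extend-new = ≐-trans (proj-extend w) (pointwise λ x → trans
      (+-congʳ (trans (*-congʳ s⟪w,r⟫≈1) (*-identityˡ _)))
      (solve 2 (λ w p → (w :+ :- p) :+ p := w) refl (w x) (proj F w x)))
      where
      s⟪w,r⟫≈1 : s * ⟪ w , r ⟫ ≈ 1#
      s⟪w,r⟫≈1 = begin
        s * ⟪ w , r ⟫
          ≈⟨ *-congˡ (⟪⟫-cong (pointwise λ x → solve 2 (λ w p → w := (w :+ :- p) :+ p) refl (w x) (proj F w x)) ≐-refl) ⟩
        s * ⟪ r ⊕ proj F w , r ⟫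
          ≈⟨ *-congˡ (⟪⟫-⊕ˡ r (proj F w) r) ⟩
        s * (N r + ⟪ proj F w , r ⟫)
          ≈⟨ *-congˡ (trans (+-congˡ (⊥residual F w (proj F w) (proj-proj F w))) (+-identityʳ _)) ⟩
        s * N r
          ≈⟨ sN≈1 ⟩
        1# ∎
        where open ≈-Reasoning

  module _ {P : A → Set} (P-submodule : IsSubmodule P) where
    open IsSubmodule P-submodule

    -- Each new vector either has residual 0 and is already in the span, or its residual joins the
    -- family, with the inverse of its norm as `scale`. Neither the alternative nor the inverse is
    -- computable, hence the double negation.
    gram-schmidt : ∀ {m} (w : Fin m → A) → (∀ i → P (w i)) →
      ¬ ¬ (∃[ k ] Σ[ F ∈ OrthoFamily k ] (∀ j → P (basis F j)) × (∀ i → proj F (w i) ≐ w i))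
    gram-schmidt {zero} w w∈ ret = ret (0 , emptyFamily , (λ ()) , (λ ()))
    gram-schmidt {suc m} w w∈ ret = gram-schmidt (w ∘ suc) (w∈ ∘ suc) λ (k , F , b∈ , fixed) →
      let r∈ : P (residual F (w zero))
          r∈ = ⊖∈ (w∈ zero) (lincomb∈ (coeffs F (w zero)) (basis F) b∈)
      in ¬¬-lem (N (residual F (w zero)) ≈ 0#)
        (λ Nr≈0 ret → ret (k , F , b∈ , λ where
          zero → pointwise λ x → trans
            (solve 2 (λ w p → p := w :- (w :+ :- p)) refl (w zero x) (proj F (w zero) x))
            (trans (+-congˡ (trans (-‿cong (at (N≈0 Nr≈0) x)) -0#≈0#)) (+-identityʳ _))
          (suc i) → fixed i))
        (λ Nr≉0 ret → reciprocal (0≤N (residual F (w zero))) Nr≉0 λ (s , _ , Ns≈1) →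
          let sN≈1 = trans (*-comm s _) Ns≈1 in
          ret (suc k , extend F (w zero) s sN≈1
              , (λ { zero → r∈ ; (suc j) → b∈ j })
              , λ { zero → proj-extend-new F (w zero) s sN≈1
                  ; (suc i) → proj-extend-fixed F (w zero) s sN≈1 (w (suc i)) (fixed i) }))
        ret

  record IsProjection (p : A) : Set where
    field
      self-adjoint : star p ≐ p
      idempotent   : p ⊛ p ≐ p

  record HasRank (p : A) (k : ℕ) : Set where
    field
      family   : OrthoFamily k
      basis-⊛  : ∀ i → basis family i ⊛ p ≐ basis family i
      proj-⊛   : ∀ a → proj family a ≐ a ⊛ p

  _∈Ideal_ : A → A → Set
  v ∈Ideal m = ∃[ a ] v ≐ a ⊛ m

  ideal-submodule : ∀ m → IsSubmodule (_∈Ideal m)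
  ideal-submodule m = record
    { ∈-resp = λ e (a , f) → a , ≐-trans (≐-sym e) f
    ; 𝟘∈     = 𝟘 , A.sym (A.zeroˡ m)
    ; ⊕∈     = λ (a , e) (b , f) → a ⊕ b , A.trans (A.+-cong e f) (A.sym (A.distribʳ m a b))
    ; •∈     = λ s (a , e) → s • a , A.trans (•-congˡ s e) (A.sym (•-⊛ s a m)) }

  shift-ideal : ∀ m {v} g → v ∈Ideal m → shift g v ∈Ideal m
  shift-ideal m g (a , e) = shift g a , ≐-trans (shift-cong g e) (shift-⊛ g a m)

  shift-inverseʳ : ∀ g a → shift g (shift (g ⁻¹) a) ≐ a
  shift-inverseʳ g a = ≐-trans (≐-sym (shift-∙ g (g ⁻¹) a))
    (≐-trans (pointwise λ x → reflexive (cong (λ h → shift h a x) (∙-inverseʳ g))) (shift-ε a))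

  module _ {k} (F : OrthoFamily k) (q : A) (proj-⊛ : ∀ a → proj F a ≐ a ⊛ q) where
    private
      bᵢ = basis F
      s = scale F

    -- The entry (x, y) of the orthogonal projection, found by applying it to the point mass
    -- `shift y 𝟙`. Self-adjointness and trace of `q` are both read off from it.
    kernel : ∀ x y → q ((y ⁻¹) ∙ x) ≈ sum λ i → s i * conj (bᵢ i y) * bᵢ i x
    kernel x y = begin
      shift y q x
        ≈⟨ at (shift-cong y (⊛-identityˡ q)) x ⟨
      shift y (𝟙 ⊛ q) x
        ≈⟨ at (shift-⊛ y 𝟙 q) x ⟩
      (shift y 𝟙 ⊛ q) x
        ≈⟨ at (proj-⊛ (shift y 𝟙)) x ⟨
      sum (λ i → s i * ⟪ shift y 𝟙 , bᵢ i ⟫ * bᵢ i x)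
        ≈⟨ sum-cong (λ i → *-congʳ (*-congˡ (trans
             (sum-cong λ z → *-congʳ (reflexive (𝟙-δ y z))) (sum-δ y λ z → conj (bᵢ i z))))) ⟩
      sum (λ i → s i * conj (bᵢ i y) * bᵢ i x) ∎
      where open ≈-Reasoning

    conj-scale : ∀ i → conj (s i) ≈ s i
    conj-scale i = begin
      conj (s i)                      ≈⟨ *-identityʳ _ ⟨
      conj (s i) * 1#                 ≈⟨ *-congˡ sN≈1 ⟨
      conj (s i) * (s i * N (bᵢ i))    ≈⟨ solve 3 (λ c s m → c :* (s :* m) := s :* (c :* m)) refl _ _ _ ⟩
      s i * (conj (s i) * N (bᵢ i))    ≈⟨ *-congˡ (trans (*-congˡ (sym (⟪⟫-conj (bᵢ i) (bᵢ i)))) (sym (conj-* _ _))) ⟩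
      s i * conj (s i * N (bᵢ i))      ≈⟨ *-congˡ (trans (conj-cong sN≈1) conj-1) ⟩
      s i * 1#                        ≈⟨ *-identityʳ _ ⟩
      s i                             ∎
      where
      open ≈-Reasoning
      sN≈1 : s i * N (bᵢ i) ≈ 1#
      sN≈1 = trans (ortho F i i) (reflexive (δ-refl i))

    kernel⇒self-adjoint : star q ≐ q
    kernel⇒self-adjoint = pointwise λ x → begin
      conj (q (x ⁻¹))
        ≈⟨ conj-cong (ap q (∙-identityʳ (x ⁻¹))) ⟨
      conj (q ((x ⁻¹) ∙ ε))
        ≈⟨ conj-cong (kernel ε x) ⟩
      conj (sum (λ i → s i * conj (bᵢ i x) * bᵢ i ε))
        ≈⟨ conj-sum (λ i → s i * conj (bᵢ i x) * bᵢ i ε) ⟩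
      sum (λ i → conj (s i * conj (bᵢ i x) * bᵢ i ε))
        ≈⟨ sum-cong (λ i → trans (conj-* _ _) (trans (*-congʳ (trans (conj-* _ _) (*-cong (conj-scale i) (conj-conj (bᵢ i x)))))
             (solve 3 (λ s x e → s :* x :* e := s :* e :* x) refl _ _ _))) ⟩
      sum (λ i → s i * conj (bᵢ i ε) * bᵢ i x)
        ≈⟨ kernel x ε ⟨
      q ((ε ⁻¹) ∙ x)
        ≈⟨ at (shift-ε q) x ⟩
      q x ∎
      where open ≈-Reasoning

    -- The left side adds up the diagonal entries q(x⁻¹x) of the projection; on the right each basis
    -- vector contributes its norm times its `scale`, which is 1.
    trace≈rank : ι (fromℕ n) * τ q ≈ ι (fromℕ k)
    trace≈rank = begin
      ι (fromℕ n) * τ q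
        ≈⟨ sum-const n (τ q) ⟨
      sum {n} (λ x → τ q)
        ≈⟨ sum-cong (λ x → trans (ap q (≡.sym (∙-inverseˡ x))) (kernel x x)) ⟩
      sum (λ x → sum λ i → s i * conj (bᵢ i x) * bᵢ i x)
        ≈⟨ ∑-comm (λ x i → s i * conj (bᵢ i x) * bᵢ i x) ⟩
      sum (λ i → sum λ x → s i * conj (bᵢ i x) * bᵢ i x)
        ≈⟨ sum-cong (λ i → trans (trans
             (sum-cong λ x → solve 3 (λ s c x → s :* c :* x := s :* (x :* c)) refl (s i) (conj (bᵢ i x)) (bᵢ i x))
             (sym (*-distribˡ-sum (s i) λ x → bᵢ i x * conj (bᵢ i x))))
             (trans (ortho F i i) (reflexive (δ-refl i)))) ⟩
      sum {k} (λ i → 1#)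
        ≈⟨ trans (sum-const k 1#) (*-identityʳ _) ⟩
      ι (fromℕ k) ∎
      where open ≈-Reasoning

  module _ (m : A) {k} (F : OrthoFamily k) (b∈ : ∀ j → basis F j ∈Ideal m)
           (fixed : ∀ g → proj F (shift g m) ≐ shift g m) where
    open IsSubmodule (ideal-submodule m)
    private
      π : A → A
      π = proj F

    proj∈ideal : ∀ a → π a ∈Ideal m
    proj∈ideal a = lincomb∈ (coeffs F a) (basis F) b∈

    proj-fixes-ideal : ∀ {v} → v ∈Ideal m → π v ≐ v
    proj-fixes-ideal {v} (a , e) = ≐-trans (proj-cong F e) (≐-trans (proj-lincomb F a (λ y → shift y m))
      (≐-trans (pointwise λ x → sum-cong λ y → *-congˡ (at (fixed y) x)) (≐-sym e)))

    -- Translations are unitary and preserve the ideal, so they preserve its orthogonal complement;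
    -- the residual of `a` therefore contributes nothing to the coefficients.
    proj-shift : ∀ g a → π (shift g a) ≐ shift g (π a)
    proj-shift g a = ≐-trans (lincomb-cong (basis F) same-coeffs)
      (proj-fixes-ideal (shift-ideal m g (proj∈ideal a)))
      where
      same-coeffs : ∀ i → coeffs F (shift g a) i ≈ coeffs F (shift g (π a)) i
      same-coeffs i = *-congˡ (begin
        ⟪ shift g a , basis F i ⟫
          ≈⟨ ⟪⟫-cong (pointwise λ x → solve 2 (λ a p → a := (a :+ :- p) :+ p) refl _ _) ≐-refl ⟩
        ⟪ shift g (residual F a) ⊕ shift g (π a) , basis F i ⟫
          ≈⟨ ⟪⟫-⊕ˡ _ _ _ ⟩
        ⟪ shift g (residual F a) , basis F i ⟫ + ⟪ shift g (π a) , basis F i ⟫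
          ≈⟨ +-congʳ (⟪⟫-cong ≐-refl (≐-sym (shift-inverseʳ g (basis F i)))) ⟩
        ⟪ shift g (residual F a) , shift g (shift (g ⁻¹) (basis F i)) ⟫ + ⟪ shift g (π a) , basis F i ⟫
          ≈⟨ +-congʳ (⟪⟫-shift g (residual F a) (shift (g ⁻¹) (basis F i))) ⟩
        ⟪ residual F a , shift (g ⁻¹) (basis F i) ⟫ + ⟪ shift g (π a) , basis F i ⟫
          ≈⟨ +-congʳ (residual⊥ F a _ (proj-fixes-ideal (shift-ideal m (g ⁻¹) (b∈ i)))) ⟩
        0# + ⟪ shift g (π a) , basis F i ⟫
          ≈⟨ +-identityˡ _ ⟩
        ⟪ shift g (π a) , basis F i ⟫ ∎)
        where open ≈-Reasoning

    idealUnit : A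
    idealUnit = π 𝟙

    -- Expand `a` in the translates of `𝟙`: a linear map that commutes with left translations is
    -- right multiplication by its value at `𝟙`.
    proj≐⊛ : ∀ a → π a ≐ a ⊛ idealUnit
    proj≐⊛ a = ≐-sym (≐-trans (pointwise λ x → sum-cong λ y → *-congˡ (sym (at (proj-shift y 𝟙) x)))
      (≐-trans (≐-sym (proj-lincomb F a (λ y → shift y 𝟙))) (proj-cong F (⊛-identityʳ a))))

    idealUnit-projection : IsProjection idealUnit
    idealUnit-projection = record
      { self-adjoint = kernel⇒self-adjoint F idealUnit proj≐⊛
      ; idempotent   = ≐-trans (≐-sym (proj≐⊛ idealUnit)) (proj-proj F 𝟙) }

    idealUnit-rank : HasRank idealUnit k
    idealUnit-rank = record
      { family  = F
      ; basis-⊛ = λ i → ≐-trans (≐-sym (proj≐⊛ _)) (proj-fixes-ideal (b∈ i))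
      ; proj-⊛  = proj≐⊛ }

    ⊛-idealUnit : m ⊛ idealUnit ≐ m
    ⊛-idealUnit = ≐-trans (≐-sym (proj≐⊛ m)) (proj-fixes-ideal (𝟙 , ≐-sym (⊛-identityˡ m)))

  -- Semisimplicity, obtained from the inner product: the orthogonal projection onto the span of the
  -- translates of `m` is right multiplication by `q`.
  ideal-projection : ∀ m → ¬ ¬ (∃[ q ] (IsProjection q × q ∈Ideal m × m ⊛ q ≐ m × ∃[ k ] HasRank q k))
  ideal-projection m ret = gram-schmidt (ideal-submodule m) (λ g → shift g m)
    (λ g → shift-ideal m g (𝟙 , ≐-sym (⊛-identityˡ m)))
    λ (k , F , b∈ , fixed) → ret (idealUnit m F b∈ fixed , idealUnit-projection m F b∈ fixed
      , proj∈ideal m F b∈ fixed 𝟙 , ⊛-idealUnit m F b∈ fixed , k , idealUnit-rank m F b∈ fixed)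

  rank-resp : ∀ {p q k} → p ≐ q → HasRank p k → HasRank q k
  rank-resp e R = record
    { family  = HasRank.family R
    ; basis-⊛ = λ i → ≐-trans (⊛-cong ≐-refl (≐-sym e)) (HasRank.basis-⊛ R i)
    ; proj-⊛  = λ a → ≐-trans (HasRank.proj-⊛ R a) (⊛-cong ≐-refl e) }

  -- Projections that generate the same left ideal coincide: `q ⊛ p ≐ q` and `p ⊛ q ≐ p`, and taking
  -- adjoints exchanges the factors.
  projection-rank : ∀ {p} → IsProjection p → ¬ ¬ (∃[ k ] HasRank p k)
  projection-rank {p} P ret = ideal-projection p λ (q , Q , (a , q≐ap) , pq≐p , k , R) →
    let open ≐-Reasoning
        q≐p : q ≐ p
        q≐p = begin
          q               ≈⟨ q≐ap ⟩
          a ⊛ p           ≈⟨ ⊛-cong ≐-refl (IsProjection.idempotent P) ⟨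
          a ⊛ (p ⊛ p)     ≈⟨ ⊛-assoc a p p ⟨
          a ⊛ p ⊛ p       ≈⟨ ⊛-cong (≐-sym q≐ap) (≐-refl {p}) ⟩
          q ⊛ p           ≈⟨ ⊛-cong (IsProjection.self-adjoint Q) (IsProjection.self-adjoint P) ⟨
          star q ⊛ star p ≈⟨ star-⊛ p q ⟨
          star (p ⊛ q)    ≈⟨ star-cong pq≐p ⟩
          star p          ≈⟨ IsProjection.self-adjoint P ⟩
          p               ∎
    in ret (k , rank-resp q≐p R)

  rank-trace : ∀ {p k} → HasRank p k → ι (fromℕ n) * τ p ≈ ι (fromℕ k)
  rank-trace {p} R = trace≈rank (HasRank.family R) p (HasRank.proj-⊛ R)

-- Powers of rationals and trisection of intervals

module RationalPowers where
  open Rationals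
  open ≡ using (refl)
  open +-*-Solver

  toℚᵘ-fromℕ : ∀ k → ℚ.toℚᵘ (fromℕ k) ℚᵘ.≃ ℚᵘ.mkℚᵘ (+ k) 0
  toℚᵘ-fromℕ zero    = ℚᵘₚ.≃-refl
  toℚᵘ-fromℕ (suc k) = ℚᵘₚ.≃-trans (ℚₚ.toℚᵘ-homo-+ 1ℚ (fromℕ k))
    (ℚᵘₚ.≃-trans (ℚᵘₚ.+-congʳ ℚᵘ.1ℚᵘ (toℚᵘ-fromℕ k)) (ℚᵘ.*≡* (cong (ℤ._* + 1)
      (cong (λ z → + 1 ℤ.+ z) (ℤₚ.*-identityʳ (+ k))))))

  archimedes : ∀ x → ∃[ k ] x ℚ.< fromℕ k
  archimedes x@(ℚ.mkℚ _ _ _) = suc ℤ.∣ ℚ.↥ x ∣ , ℚₚ.toℚᵘ-cancel-< (ℚᵘₚ.<-≤-trans (ℚᵘ.*<* lt)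
    (ℚᵘₚ.≤-reflexive (ℚᵘₚ.≃-sym (toℚᵘ-fromℕ (suc ℤ.∣ ℚ.↥ x ∣)))))
    where
    open ℤₚ.≤-Reasoning
    lt : ℚ.↥ x ℤ.* + 1 ℤ.< + suc ℤ.∣ ℚ.↥ x ∣ ℤ.* ℚ.↧ x
    lt = begin-strict
      ℚ.↥ x ℤ.* + 1                   ≡⟨ ℤₚ.*-identityʳ (ℚ.↥ x) ⟩
      ℚ.↥ x                           ≤⟨ i≤∣i∣ (ℚ.↥ x) ⟩
      + ℤ.∣ ℚ.↥ x ∣                   <⟨ ℤ.+<+ (ℕₚ.n<1+n _) ⟩
      + suc ℤ.∣ ℚ.↥ x ∣               ≡⟨ ℤₚ.*-identityʳ _ ⟨
      + suc ℤ.∣ ℚ.↥ x ∣ ℤ.* + 1       ≤⟨ ℤₚ.*-monoˡ-≤-nonNeg (+ suc ℤ.∣ ℚ.↥ x ∣) {+ 1} {ℚ.↧ x} (ℤ.+≤+ (ℕ.s≤s ℕ.z≤n)) ⟩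
      + suc ℤ.∣ ℚ.↥ x ∣ ℤ.* ℚ.↧ x     ∎
      where
      i≤∣i∣ : ∀ i → i ℤ.≤ + ℤ.∣ i ∣
      i≤∣i∣ (+ k) = ℤₚ.≤-refl
      i≤∣i∣ ℤ.-[1+ k ] = ℤ.-≤+

  -- The exponent is 2^j: bounds are passed from `H ⊛ H` back to `H`, so repeated squaring is the
  -- natural iteration.
  _^2^_ : ℚ → ℕ → ℚ
  p ^2^ zero  = p
  p ^2^ suc j = (p ^2^ j) ℚ.* (p ^2^ j)

  ^2^-pos : ∀ {p} j → 0ℚ ℚ.< p → 0ℚ ℚ.< p ^2^ j
  ^2^-pos zero    0<p = 0<p
  ^2^-pos (suc j) 0<p = 0<p*q (^2^-pos j 0<p) (^2^-pos j 0<p)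

  ^2^-* : ∀ p q j → (p ℚ.* q) ^2^ j ≡ (p ^2^ j) ℚ.* (q ^2^ j)
  ^2^-* p q zero    = refl
  ^2^-* p q (suc j) = ≡.trans (cong₂ ℚ._*_ (^2^-* p q j) (^2^-* p q j))
    (solve 2 (λ a b → (a :* b) :* (a :* b) := (a :* a) :* (b :* b)) refl (p ^2^ j) (q ^2^ j))

  -- Far below the true growth for exponent 2^j, but linear growth suffices. Squaring doubles the
  -- linear term, and 2(j + 1) ≥ j + 2.
  bernoulli : ∀ {η} j → 0ℚ ℚ.≤ η → 1ℚ ℚ.+ fromℕ (suc j) ℚ.* η ℚ.≤ (1ℚ ℚ.+ η) ^2^ j
  bernoulli {η} zero    0≤η = ℚₚ.≤-reflexive (cong (1ℚ ℚ.+_) (ℚₚ.*-identityˡ η))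
  bernoulli {η} (suc j) 0≤η = ≤-offset
    (0≤p+q (0≤p+q (0≤p*q 0≤d 0≤d) (0≤p*q (0≤p+q 0≤b 0≤b) 0≤d)) (0≤p+q (0≤p*q 0≤u 0≤u) (0≤p*q (0≤fromℕ j) 0≤η)))
    (solve 3 (λ v k e → let b = con 1ℚ :+ (con 1ℚ :+ k) :* e ; u = (con 1ℚ :+ k) :* e in
        v :* v := (con 1ℚ :+ (con 1ℚ :+ (con 1ℚ :+ k)) :* e)
          :+ ((((v :- b) :* (v :- b)) :+ (b :+ b) :* (v :- b)) :+ (u :* u :+ k :* e))) refl
       ((1ℚ ℚ.+ η) ^2^ j) (fromℕ j) η)
    where
    u = fromℕ (suc j) ℚ.* η
    b = 1ℚ ℚ.+ u
    0≤u : 0ℚ ℚ.≤ u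
    0≤u = 0≤p*q (0≤fromℕ (suc j)) 0≤η
    0≤b : 0ℚ ℚ.≤ b
    0≤b = 0≤p+q (ℚₚ.<⇒≤ 0<1) 0≤u
    0≤d : 0ℚ ℚ.≤ ((1ℚ ℚ.+ η) ^2^ j) ℚ.- b
    0≤d = p≤q⇒0≤q-p {b} (bernoulli j 0≤η)

  -- With q = (1 + η)p the claim reads γ < (1 + η)^(2^j), so any j with jη > γ will do. Thus powers
  -- absorb any constant, however crude the one in `N-⊛` is.
  separating-power : ∀ {p q} γ → 0ℚ ℚ.< p → p ℚ.< q → 0ℚ ℚ.< γ → ∃[ j ] γ ℚ.* (p ^2^ j) ℚ.< q ^2^ j
  separating-power {p} {q} γ 0<p p<q 0<γ =
    let η , 0<η , pη≡q-p = divide {p} {q ℚ.- p} 0<p (p<q⇒0<q-p p<q)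
        κ , 0<κ , ηκ≡γ   = divide {η} {γ} 0<η 0<γ
        j , κ<j          = archimedes κ
    in j , separated η κ 0<η pη≡q-p ηκ≡γ j κ<j
    where
    separated : ∀ η κ → 0ℚ ℚ.< η → p ℚ.* η ≡ q ℚ.- p → η ℚ.* κ ≡ γ → ∀ j → κ ℚ.< fromℕ j →
                γ ℚ.* (p ^2^ j) ℚ.< q ^2^ j
    separated η κ 0<η pη≡q-p ηκ≡γ j κ<j = begin-strict
      γ ℚ.* (p ^2^ j)                <⟨ ℚₚ.*-monoˡ-<-pos (p ^2^ j) {{ℚ.positive (^2^-pos j 0<p)}} γ<r ⟩
      ((1ℚ ℚ.+ η) ^2^ j) ℚ.* (p ^2^ j) ≡⟨ ^2^-* (1ℚ ℚ.+ η) p j ⟨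
      ((1ℚ ℚ.+ η) ℚ.* p) ^2^ j       ≡⟨ cong (_^2^ j) [1+η]p≡q ⟩
      q ^2^ j                        ∎
      where
      open ℚₚ.≤-Reasoning
      [1+η]p≡q : (1ℚ ℚ.+ η) ℚ.* p ≡ q
      [1+η]p≡q = ≡.trans (solve 2 (λ e p → (con 1ℚ :+ e) :* p := p :+ p :* e) refl η p)
        (≡.trans (cong (p ℚ.+_) pη≡q-p) (solve 2 (λ p q → p :+ (q :- p) := q) refl p q))
      γ<r : γ ℚ.< (1ℚ ℚ.+ η) ^2^ j
      γ<r = ℚₚ.<-≤-trans (<-offset
        (0<p+q (0<p*q {fromℕ j ℚ.- κ} {η} (p<q⇒0<q-p κ<j) 0<η) (0<p+q 0<1 0<η))
        (≡.trans (solve 3 (λ e k f → con 1ℚ :+ (con 1ℚ :+ f) :* e := e :* k :+ ((f :- k) :* e :+ (con 1ℚ :+ e))) refl η κ (fromℕ j))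
          (cong (ℚ._+ ((fromℕ j ℚ.- κ) ℚ.* η ℚ.+ (1ℚ ℚ.+ η))) ηκ≡γ)))
        (bernoulli j (ℚₚ.<⇒≤ 0<η))

-- Turns a cut that is located between any two rationals into nested intervals.
module Trisection (U L : ℚ → Set) (located : ∀ {p q} → p ℚ.< q → U q ⊎ L p)
                  (a₀ b₀ : ℚ) (a₀<b₀ : a₀ ℚ.< b₀) (L-a₀ : L a₀) (U-b₀ : U b₀) where
  open Rationals
  open RationalPowers
  open ≡ using (refl)
  open +-*-Solver

  record Interval : Set where
    field
      left width : ℚ
      0<width    : 0ℚ ℚ.< width
      L-left     : L left
      U-right    : U (left ℚ.+ width)
  open Interval

  ⅓ : ℚ
  ⅓ = + 1 ℚ./ 3

  third : ℚ → ℚ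
  third w = w ℚ.* ⅓

  0<third : ∀ {w} → 0ℚ ℚ.< w → 0ℚ ℚ.< third w
  0<third 0<w = 0<p*q 0<w (ℚₚ.positive⁻¹ ⅓)

  private
    trisect-right : ∀ a w → (a ℚ.+ third w) ℚ.+ (third w ℚ.+ third w) ≡ a ℚ.+ w
    trisect-right = solve 2 (λ a w → (a :+ w :* con ⅓) :+ (w :* con ⅓ :+ w :* con ⅓) := a :+ w) refl

  record Trisected (I : Interval) : Set where
    field
      next   : Interval
      width≡ : width next ≡ third (width I) ℚ.+ third (width I)
      left≤  : left I ℚ.≤ left next
      right≤ : left next ℚ.+ width next ℚ.≤ left I ℚ.+ width I
  open Trisected

  trisect : ∀ I → Trisected I
  trisect I = Sum.[ lower , upper ]′ (located {a ℚ.+ t} {a ℚ.+ (t ℚ.+ t)}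
      (<-offset 0<t (solve 2 (λ a t → a :+ (t :+ t) := (a :+ t) :+ t) refl a t)))
    where
    a = left I
    t = third (width I)
    0<t : 0ℚ ℚ.< t
    0<t = 0<third (0<width I)
    lower : U (a ℚ.+ (t ℚ.+ t)) → Trisected I
    lower u = record
      { next = record { left = a ; width = t ℚ.+ t ; 0<width = 0<p+q 0<t 0<t ; L-left = L-left I ; U-right = u }
      ; width≡ = refl
      ; left≤ = ℚₚ.≤-refl
      ; right≤ = ≤-offset (ℚₚ.<⇒≤ 0<t) (≡.trans (≡.sym (trisect-right a (width I)))
          (solve 2 (λ a t → (a :+ t) :+ (t :+ t) := (a :+ (t :+ t)) :+ t) refl a t)) }
    upper : L (a ℚ.+ t) → Trisected I
    upper l = record
      { next = record { left = a ℚ.+ t ; width = t ℚ.+ t ; 0<width = 0<p+q 0<t 0<t ; L-left = l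
                      ; U-right = subst U (≡.sym (trisect-right a (width I))) (U-right I) }
      ; width≡ = refl
      ; left≤ = ≤-offset (ℚₚ.<⇒≤ 0<t) refl
      ; right≤ = ℚₚ.≤-reflexive (trisect-right a (width I)) }

  interval : ℕ → Interval
  interval zero    = record
    { left = a₀ ; width = b₀ ℚ.- a₀ ; 0<width = p<q⇒0<q-p a₀<b₀ ; L-left = L-a₀
    ; U-right = subst U (solve 2 (λ a b → b := a :+ (b :- a)) refl a₀ b₀) U-b₀ }
  interval (suc j) = next (trisect (interval j))

  a w : ℕ → ℚ
  a j = left (interval j)
  w j = width (interval j)

  a↑ : ∀ j → a j ℚ.≤ a (suc j)
  a↑ j = left≤ (trisect (interval j))

  a+w↓ : ∀ j → a (suc j) ℚ.+ w (suc j) ℚ.≤ a j ℚ.+ w j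
  a+w↓ j = right≤ (trisect (interval j))

  private
    two : ℚ
    two = 1ℚ ℚ.+ 1ℚ

  -- Weaker than the decay (2/3)^j, but provable without powers, since (2/3)(3 + j) ≤ 2 + j, and
  -- enough for a null sequence.
  width-bound : ∀ j → w j ℚ.* (two ℚ.+ fromℕ j) ℚ.≤ w 0 ℚ.* two
  width-bound zero = ℚₚ.≤-reflexive (cong (w 0 ℚ.*_) (ℚₚ.+-identityʳ two))
  width-bound (suc j) = ℚₚ.≤-trans
    (≤-offset (0≤p*q (ℚₚ.<⇒≤ (0<third (0<width (interval j)))) (0≤fromℕ j))
      (≡.trans
        (solve 2 (λ w k → let t = w :* con ⅓ in
          w :* ((con 1ℚ :+ con 1ℚ) :+ k) := (t :+ t) :* ((con 1ℚ :+ con 1ℚ) :+ (con 1ℚ :+ k)) :+ t :* k)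
          refl (w j) (fromℕ j))
        (cong (λ v → v ℚ.* (two ℚ.+ fromℕ (suc j)) ℚ.+ third (w j) ℚ.* fromℕ j)
          (≡.sym (width≡ (trisect (interval j)))))))
    (width-bound j)

  w→0 : ∀ ε → 0ℚ ℚ.< ε → ∃[ j ] w j ℚ.< ε
  w→0 ε 0<ε =
    let κ , 0<κ , εκ≡2w = divide {ε} {w 0 ℚ.* two} 0<ε (0<p*q {w 0} {two} (0<width (interval 0)) (0<p+q 0<1 0<1))
        j , κ<j = archimedes κ
    in j , small κ εκ≡2w j κ<j
    where
    small : ∀ κ → ε ℚ.* κ ≡ w 0 ℚ.* two → ∀ j → κ ℚ.< fromℕ j → w j ℚ.< ε
    small κ eq j κ<j = ℚₚ.*-cancelʳ-<-nonNeg (two ℚ.+ fromℕ j)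
      {{ℚ.nonNegative (0≤p+q (ℚₚ.<⇒≤ (0<p+q 0<1 0<1)) (0≤fromℕ j))}} {w j} {ε}
      (ℚₚ.≤-<-trans (width-bound j) (subst (ℚ._< ε ℚ.* (two ℚ.+ fromℕ j)) eq
        (<-offset (0<p+q (0<p*q {fromℕ j ℚ.- κ} {ε} (p<q⇒0<q-p κ<j) 0<ε) (0<p*q {ε} {two} 0<ε (0<p+q 0<1 0<1)))
          (solve 3 (λ e k f → e :* ((con 1ℚ :+ con 1ℚ) :+ f) := e :* k :+ ((f :- k) :* e :+ e :* (con 1ℚ :+ con 1ℚ))) refl ε κ (fromℕ j)))))

-- The operator norm of right multiplication

module Spectral (S : StarField) {n : ℕ} (_∙_ : Fin n → Fin n → Fin n) (ε : Fin n)
                (_⁻¹ : Fin n → Fin n) (isGroup : IsGroup _≡_ _∙_ ε _⁻¹) where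
  open StarField S hiding (zero)
  open Scalars S
  open GroupAlgebra S _∙_ ε _⁻¹ isGroup
  open Projections S _∙_ ε _⁻¹ isGroup
  open RationalPowers

  -- `p` bounds the square of the operator norm, so that no roots occur and squaring a self-adjoint
  -- `h` squares the bound.
  Bounded : A → ℚ → Set
  Bounded h p = ∀ v → N (v ⊛ h) ≤ ι p * N v

  N-𝟙⊛ : ∀ h → N (𝟙 ⊛ h) ≈ N h
  N-𝟙⊛ h = N-cong (⊛-identityˡ h)

  bounded-𝟙 : ∀ {h p} → Bounded h p → N h ≤ ι p
  bounded-𝟙 {h} b = ≤-resp (N-𝟙⊛ h) (trans (*-congˡ N-𝟙) (*-identityʳ _)) (b 𝟙)

  bounded-mono : ∀ {h p q} → p ℚ.≤ q → Bounded h p → Bounded h q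
  bounded-mono p≤q b v = ≤-trans (b v) (*-monoʳ-≤ (0≤N v) (ι-mono p≤q))

  _^²^_ : A → ℕ → A
  h ^²^ zero  = h
  h ^²^ suc j = (h ^²^ j) ⊛ (h ^²^ j)

  ^²^-self-adjoint : ∀ {h} → star h ≐ h → ∀ j → star (h ^²^ j) ≐ h ^²^ j
  ^²^-self-adjoint h*≐h zero    = h*≐h
  ^²^-self-adjoint {h} h*≐h (suc j) = ≐-trans (star-⊛ (h ^²^ j) (h ^²^ j))
    (⊛-cong (^²^-self-adjoint h*≐h j) (^²^-self-adjoint h*≐h j))

  bounded-^²^ : ∀ {h p} → 0ℚ ℚ.< p → Bounded h p → ∀ j → Bounded (h ^²^ j) (p ^2^ j)
  bounded-^²^ 0<p b zero = b
  bounded-^²^ {h} {p} 0<p b (suc j) v = ≤-resp (N-cong (⊛-assoc v H H))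
    (trans (sym (*-assoc (ι P) (ι P) (N v))) (*-congʳ (sym (ι-* P P))))
    (≤-trans (bH (v ⊛ H)) (*-monoˡ-≤ (0≤-ι (ℚₚ.<⇒≤ (^2^-pos j 0<p))) (bH v)))
    where
    H = h ^²^ j
    P = p ^2^ j
    bH = bounded-^²^ 0<p b j

  N-quadratic : ∀ {H t} → star H ≐ H → ∀ v → conj t ≈ t →
    N (v ⊛ (H ⊛ H) ⊕ ⊖ (t • v)) ≈ (N (v ⊛ (H ⊛ H)) + t * t * N v) - (t * N (v ⊛ H) + t * N (v ⊛ H))
  N-quadratic {H} {t} H*≐H v t*≈t = trans (N-⊖ VHH (t • v)) (+-cong (+-congˡ (trans (N-• t v) (*-congʳ (*-congˡ t*≈t))))
      (-‿cong (+-cong (trans (⟪⟫-•ʳ t VHH v) (*-cong t*≈t ⟪vHH,v⟫))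
                      (trans (⟪⟫-•ˡ t v VHH) (*-congˡ (trans (sym (⟪⟫-conj VHH v))
                        (trans (conj-cong ⟪vHH,v⟫) (0≤⇒real (0≤N (v ⊛ H))))))))))
    where
    VHH = v ⊛ (H ⊛ H)
    ⟪vHH,v⟫ : ⟪ VHH , v ⟫ ≈ N (v ⊛ H)
    ⟪vHH,v⟫ = trans (⟪⟫-cong (≐-sym (⊛-assoc v H H)) ≐-refl) (trans (⟪⟫-adjointʳ (v ⊛ H) H v)
      (⟪⟫-cong (≐-refl {v ⊛ H}) (⊛-cong (≐-refl {v}) H*≐H)))

  -- 2q N(vH) = 2 Re ⟪ vH², qv ⟫ ≤ N(vH²) + q² N(v)
  bounded-√ : ∀ {H q} → 0ℚ ℚ.< q → star H ≐ H → Bounded (H ⊛ H) (q ℚ.* q) → Bounded H q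
  bounded-√ {H} {q} 0<q H*≐H b v =
    0≤-resp (trans (solve 4 (λ r o Q X → r :* ((o :+ o) :* Q :* X) := (Q :* (o :+ o)) :* r :* X) refl (ι r) 1# (ι q) X)
             (trans (*-congʳ 2qr≈1) (*-identityˡ X)))
      (0≤-* (0≤-ι (ℚₚ.<⇒≤ 0<r)) amgm)
    where
    X = ι q * N v - N (v ⊛ H)
    reciprocal-2q = Rationals.divide {q ℚ.* (1ℚ ℚ.+ 1ℚ)} {1ℚ} (Rationals.0<p*q 0<q (Rationals.0<p+q Rationals.0<1 Rationals.0<1)) Rationals.0<1
    r = proj₁ reciprocal-2q
    0<r = proj₁ (proj₂ reciprocal-2q)
    2qr≈1 : ι q * (1# + 1#) * ι r ≈ 1#
    2qr≈1 = trans (*-congʳ (*-congˡ (+-cong (sym ι-1) (sym ι-1)))) (trans (*-congʳ (*-congˡ (sym (ι-+ 1ℚ 1ℚ))))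
      (trans (*-congʳ (sym (ι-* q (1ℚ ℚ.+ 1ℚ)))) (trans (sym (ι-* (q ℚ.* (1ℚ ℚ.+ 1ℚ)) r))
      (trans (reflexive (cong ι (proj₂ (proj₂ reciprocal-2q)))) ι-1))))
    amgm : 0≤ ((1# + 1#) * ι q * X)
    amgm = 0≤-resp (trans (solve 4 (λ M Q V W → (Q :* Q :* V :- M) :+ ((M :+ Q :* Q :* V) :- (Q :* W :+ Q :* W))
              := (con 1ℚ :+ con 1ℚ) :* Q :* (Q :* V :- W)) refl (N (v ⊛ (H ⊛ H))) (ι q) (N v) (N (v ⊛ H)))
              (*-congʳ (*-congʳ (+-cong ι-1 ι-1))))
      (0≤-+ (≤-resp refl (*-congʳ (ι-* q q)) (b v)) (0≤-resp (N-quadratic H*≐H v (conj-ι q)) (0≤N (v ⊛ (H ⊛ H) ⊕ ⊖ (ι q • v)))))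

  bounded-^²^⁻¹ : ∀ {h q} → 0ℚ ℚ.< q → star h ≐ h → ∀ j → Bounded (h ^²^ j) (q ^2^ j) → Bounded h q
  bounded-^²^⁻¹ 0<q h*≐h zero    b = b
  bounded-^²^⁻¹ 0<q h*≐h (suc j) b =
    bounded-^²^⁻¹ 0<q h*≐h j (bounded-√ (^2^-pos j 0<q) (^²^-self-adjoint h*≐h j) b)

  -- The constant of `N-⊛`, raised by 1 to make it positive.
  γ : ℚ
  γ = growth n ℚ.+ 1ℚ

  0<γ : 0ℚ ℚ.< γ
  0<γ = ℚₚ.+-mono-≤-< (0≤growth n) Rationals.0<1

  bounded-by-N : ∀ h {Q} → ι γ * N h ≤ ι Q → Bounded h Q
  bounded-by-N h {Q} le v = ≤-trans (N-⊛ v h) (≤-trans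
    (0≤-resp (trans (solve 3 (λ g V H → V :* H := (g :+ con 1ℚ) :* H :* V :- g :* (V :* H)) refl (ι (growth n)) (N v) (N h))
        (+-congʳ (*-congʳ (*-congʳ (sym (ι-+ (growth n) 1ℚ))))))
      (0≤-* (0≤N v) (0≤N h)))
    (*-monoʳ-≤ (0≤N v) le))

  -- The square of the norm of right multiplication by h.
  record OperatorNorm (h : A) : Set where
    field
      norm²      : Carrier
      norm-bound : ∀ v → N (v ⊛ h) ≤ norm² * N v
      -- Minimality: no slack `c` can be taken off `norm²`. The conclusion is an equation because
      -- `≈` is stable under double negation.
      norm-least : ∀ c → 0≤ c → (∀ v → N (v ⊛ h) + c * N v ≤ norm² * N v) → c ≈ 0#

    0≤norm² : 0≤ norm²
    0≤norm² = 0≤-≤ (0≤N h) (≤-resp (N-𝟙⊛ h) (trans (*-congˡ N-𝟙) (*-identityʳ _)) (norm-bound 𝟙))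

  module _ {h} (a w : ℕ → ℚ) (l : Carrier) (a≤l : ∀ j → ι (a j) ≤ l) (l≤a+w : ∀ j → l ≤ ι (a j ℚ.+ w j))
           (lower : ∀ j → ¬ Bounded h (a j)) (upper : ∀ j → Bounded h (a j ℚ.+ w j))
           (w→0 : ∀ δ → 0ℚ ℚ.< δ → ∃[ j ] w j ℚ.< δ) where

    limit-bound : ∀ v → N (v ⊛ h) ≤ l * N v
    limit-bound v = 0≤-closed λ δ 0<δ →
      -- An interval of width below η = δ/B changes the bound by at most δ on a vector with N(v) ≤
      -- B.
      let B , 0<B , Nv≤B = bounded-above (0≤N v)
          η , 0<η , Bη≡δ = Rationals.divide {B} {δ} 0<B 0<δ
          j , w<η        = w→0 η 0<η
      in 0≤-resp
        (solve 6 (λ M a w l V d → (((a :+ w) :* V :- M) :+ (l :- a) :* V) :+ (d :- w :* V)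
            := (l :* V :- M) :+ d) refl (N (v ⊛ h)) (ι (a j)) (ι (w j)) l (N v) (ι δ))
        (0≤-+ (0≤-+ (≤-resp refl (*-congʳ (ι-+ (a j) (w j))) (upper j v))
                    (0≤-* (a≤l j) (0≤N v)))
              (≤-trans (*-monoʳ-≤ (0≤N v) (ι-mono (ℚₚ.<⇒≤ w<η)))
                (≤-resp refl (trans (sym (ι-* η B)) (reflexive (cong ι (≡.trans (ℚₚ.*-comm η B) Bη≡δ))))
                  (*-monoˡ-≤ (0≤-ι (ℚₚ.<⇒≤ 0<η)) Nv≤B))))

    -- A nonzero slack is at least some δ > 0. In an interval narrower than δ the left end would
    -- then already be a bound, against `lower`.
    limit-least : ∀ c → 0≤ c → (∀ v → N (v ⊛ h) + c * N v ≤ l * N v) → c ≈ 0#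
    limit-least c 0≤c gap = ≈-stable λ c≉0 → bounded-below 0≤c c≉0 λ (δ , 0<δ , δ≤c) →
      let j , w<δ = w→0 δ 0<δ
      in lower j λ v → 0≤-resp
        (solve 6 (λ M a w l V c → ((l :* V :- (M :+ c :* V)) :+ ((a :+ w) :- l) :* V) :+ (c :- w) :* V := a :* V :- M) refl
          (N (v ⊛ h)) (ι (a j)) (ι (w j)) l (N v) c)
        (0≤-+ (0≤-+ (gap v) (0≤-* (≤-resp refl (ι-+ (a j) (w j)) (l≤a+w j)) (0≤N v)))
              (0≤-* (≤-trans (ι-mono (ℚₚ.<⇒≤ w<δ)) δ≤c) (0≤N v)))

    limit-norm : OperatorNorm h
    limit-norm = record { norm² = l ; norm-bound = limit-bound ; norm-least = limit-least }

  module _ {h} (h*≐h : star h ≐ h) where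

    -- For the power H = h^(2^j), N(H) and the squared operator norm agree up to the factor `γ`.
    -- Once j is so large that γ p^(2^j) < q^(2^j), locating the single scalar γ N(H) between these
    -- two settles the matter: below q^(2^j) it bounds H, hence `h` by taking square roots j times;
    -- otherwise the bound `p` is refuted at the vector `𝟙`.
    bounded-located-pos : ∀ {p q} → 0ℚ ℚ.< p → p ℚ.< q → Bounded h q ⊎ ¬ Bounded h p
    bounded-located-pos {p} {q} 0<p p<q =
      let j , γp<q = separating-power γ 0<p p<q 0<γ in
      Sum.map
        (λ le → bounded-^²^⁻¹ (ℚₚ.<-trans 0<p p<q) h*≐h j (bounded-by-N (h ^²^ j) le))
        (λ nle b → nle (≤-resp refl (sym (ι-* γ (p ^2^ j)))
          (*-monoˡ-≤ (0≤-ι (ℚₚ.<⇒≤ 0<γ)) (bounded-𝟙 (bounded-^²^ 0<p b j)))))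
        (locate {ι γ * N (h ^²^ j)} (0≤-* (0≤-ι (ℚₚ.<⇒≤ 0<γ)) (0≤N (h ^²^ j))) γp<q)

    bounded-located : ∀ {p q} → p ℚ.< q → Bounded h q ⊎ ¬ Bounded h p
    bounded-located {p} {q} p<q with 0ℚ ℚₚ.≤? p
    ... | no 0≰p  = inj₂ λ b → 0≰p (0≤-ι⁻¹ (0≤-≤ (0≤N h) (bounded-𝟙 b)))
    ... | yes 0≤p =
      -- `p` may be 0, where powers separate nothing; a rational strictly in between is positive.
      let m , p<m , m<q = ℚₚ.<-dense p<q
      in Sum.map₂ (λ nb b → nb (bounded-mono {h} (ℚₚ.<⇒≤ p<m) b))
           (bounded-located-pos (ℚₚ.≤-<-trans 0≤p p<m) m<q)

    private
      bound₀ : ∃[ B ] (0ℚ ℚ.< B × 0≤ (ι B - ι γ * N h))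
      bound₀ = bounded-above (0≤-* (0≤-ι (ℚₚ.<⇒≤ 0<γ)) (0≤N h))

      -1<0 : ℚ.- 1ℚ ℚ.< 0ℚ
      -1<0 = ℚₚ.negative⁻¹ (ℚ.- 1ℚ)

    -- The left end must fail to be a bound, but for h = 0 every nonnegative rational is one; hence
    -- the start at -1.
    open Trisection (Bounded h) (λ p → ¬ Bounded h p) bounded-located (ℚ.- 1ℚ) (proj₁ bound₀)
      (ℚₚ.<-trans -1<0 (proj₁ (proj₂ bound₀)))
      (λ b → ℚₚ.<-irrefl ≡.refl (ℚₚ.<-≤-trans -1<0 (0≤-ι⁻¹ (0≤-≤ (0≤N h) (bounded-𝟙 b)))))
      (bounded-by-N h (proj₂ (proj₂ bound₀)))

    operatorNorm : OperatorNorm h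
    operatorNorm =
      let l , bounds = nested-intervals a w (λ j → ℚₚ.<⇒≤ (Interval.0<width (interval j))) a↑ a+w↓ w→0
      in limit-norm a w l (λ j → proj₁ (bounds j)) (λ j → proj₂ (bounds j))
           (λ j → Interval.L-left (interval j)) (λ j → Interval.U-right (interval j)) w→0

-- Splitting a projection by an eigenprojection

module Splitting (S : StarField) {n : ℕ} (_∙_ : Fin n → Fin n → Fin n) (ε : Fin n)
                (_⁻¹ : Fin n → Fin n) (isGroup : IsGroup _≡_ _∙_ ε _⁻¹) where
  open StarField S hiding (zero)
  open Scalars S
  open GroupAlgebra S _∙_ ε _⁻¹ isGroup
  open Projections S _∙_ ε _⁻¹ isGroup
  open Spectral S _∙_ ε _⁻¹ isGroup
  open IsProjection

  ⊖≐𝟘 : ∀ {a b} → a ⊕ ⊖ b ≐ 𝟘 → a ≐ b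
  ⊖≐𝟘 {a} {b} e = pointwise λ x → trans (solve 2 (λ a b → a := (a :- b) :+ b) refl (a x) (b x))
    (trans (+-congʳ (at e x)) (+-identityˡ (b x)))

  star-swap : ∀ {a b c} → star a ≐ a → star b ≐ b → star c ≐ c → a ⊛ b ≐ c → b ⊛ a ≐ c
  star-swap {a} {b} a* b* c* e = ≐-trans (⊛-cong (≐-sym b*) (≐-sym a*))
    (≐-trans (≐-sym (star-⊛ a b)) (≐-trans (star-cong e) c*))

  ⊛-⊖ˡ : ∀ a b c → (a ⊕ ⊖ b) ⊛ c ≐ a ⊛ c ⊕ ⊖ (b ⊛ c)
  ⊛-⊖ˡ a b c = AP.[y-z]x≈yx-zx c a b

  ⊛-⊖ʳ : ∀ a b c → a ⊛ (b ⊕ ⊖ c) ≐ a ⊛ b ⊕ ⊖ (a ⊛ c)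
  ⊛-⊖ʳ a b c = AP.x[y-z]≈xy-xz a b c

  ⊖-cong : ∀ {a b c d} → a ≐ c → b ≐ d → a ⊕ ⊖ b ≐ c ⊕ ⊖ d
  ⊖-cong e f = A.+-cong e (A.-‿cong f)

  projection-⊖ : ∀ {p q} → IsProjection p → IsProjection q → q ⊛ p ≐ q → IsProjection (p ⊕ ⊖ q)
  projection-⊖ {p} {q} P Q qp≐q = record
    { self-adjoint = ≐-trans (star-⊕ p (⊖ q)) (A.+-cong (self-adjoint P)
        (≐-trans (star-⊖ q) (A.-‿cong (self-adjoint Q))))
    ; idempotent   = begin
        (p ⊕ ⊖ q) ⊛ (p ⊕ ⊖ q)
          ≈⟨ ⊛-⊖ʳ (p ⊕ ⊖ q) p q ⟩
        (p ⊕ ⊖ q) ⊛ p ⊕ ⊖ ((p ⊕ ⊖ q) ⊛ q)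
          ≈⟨ ⊖-cong (≐-trans (⊛-⊖ˡ p q p) (⊖-cong (idempotent P) qp≐q))
                    (≐-trans (⊛-⊖ˡ p q q) (⊖-cong pq≐q (idempotent Q))) ⟩
        (p ⊕ ⊖ q) ⊕ ⊖ (q ⊕ ⊖ q)
          ≈⟨ pointwise (λ x → solve 2 (λ p q → (p :- q) :- (q :- q) := p :- q) refl (p x) (q x)) ⟩
        p ⊕ ⊖ q ∎ }
    where
    open ≐-Reasoning
    pq≐q : p ⊛ q ≐ q
    pq≐q = star-swap (self-adjoint Q) (self-adjoint P) (self-adjoint Q) qp≐q

  𝟙-projection : IsProjection 𝟙
  𝟙-projection = record { self-adjoint = star-𝟙 ; idempotent = ⊛-identityˡ 𝟙 }

  τ≈N : ∀ {p} → IsProjection p → τ p ≈ N p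
  τ≈N {p} P = trans (at (≐-sym (≐-trans (⊛-cong (≐-refl {p}) (self-adjoint P)) (idempotent P))) ε) (sym (⟪⟫-τ p p))

  0≤τ : ∀ {p} → IsProjection p → 0≤ τ p
  0≤τ {p} P = 0≤-resp (sym (τ≈N P)) (0≤N p)

  τ≈0 : ∀ {p} → IsProjection p → τ p ≈ 0# → p ≐ 𝟘
  τ≈0 P e = N≈0 (trans (sym (τ≈N P)) e)

  •-cancel : ∀ {s y a b} → s * y ≈ 1# → s • a ≐ s • b → a ≐ b
  •-cancel {s} {y} {a} {b} sy≈1 e = pointwise λ x → begin
    a x             ≈⟨ *-identityˡ (a x) ⟨
    1# * a x        ≈⟨ *-congʳ sy≈1 ⟨
    s * y * a x     ≈⟨ solve 3 (λ s y a → s :* y :* a := y :* (s :* a)) refl s y (a x) ⟩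
    y * (s * a x)   ≈⟨ *-congˡ (at e x) ⟩
    y * (s * b x)   ≈⟨ solve 3 (λ s y a → s :* y :* a := y :* (s :* a)) refl s y (b x) ⟨
    s * y * b x     ≈⟨ *-congʳ sy≈1 ⟩
    1# * b x        ≈⟨ *-identityˡ (b x) ⟩
    b x             ∎
    where open ≈-Reasoning

  IsProperSubprojection : A → A → Set
  IsProperSubprojection p r = IsProjection r × r ⊛ p ≐ r × ¬ (r ≐ 𝟘) × ¬ (p ≐ r)

  module _ {p g} (P : IsProjection p) (g*≐g : star g ≐ g) (pg≐g : p ⊛ g ≐ g)
           (¬scalar : ¬ (∃[ c ] g ⊛ g ≐ c • p)) where
    private
      g² = g ⊛ g

      g²*≐g² : star g² ≐ g²
      g²*≐g² = ≐-trans (star-⊛ g g) (⊛-cong g*≐g g*≐g)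

      gp≐g : g ⊛ p ≐ g
      gp≐g = star-swap (self-adjoint P) g*≐g g*≐g pg≐g

    -- r projects onto the eigenspace of g² for its largest eigenvalue l.
    module _ {l} (l*≈l : conj l ≈ l) {a q} (Q : IsProjection q)
             (q≐aM : q ≐ a ⊛ (l • 𝟙 ⊕ ⊖ g²)) (Mq≐M : (l • 𝟙 ⊕ ⊖ g²) ⊛ q ≐ l • 𝟙 ⊕ ⊖ g²) where
      private
        M r : A
        M = l • 𝟙 ⊕ ⊖ g²
        r = 𝟙 ⊕ ⊖ q
        M*≐M : star M ≐ M
        M*≐M = ≐-trans (star-⊕ (l • 𝟙) (⊖ g²)) (A.+-cong (≐-trans (star-• l 𝟙) (•-cong l*≈l star-𝟙))
          (≐-trans (star-⊖ g²) (A.-‿cong g²*≐g²)))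

      eigenprojection : IsProjection r
      eigenprojection = projection-⊖ 𝟙-projection Q (⊛-identityʳ q)

      -- `M ⊛ q ≐ M` makes `M ⊛ r` vanish; by adjoints `r ⊛ M` vanishes too, which is the eigenvalue
      -- equation.
      eigen : l • r ≐ r ⊛ g²
      eigen = ⊖≐𝟘 (begin
        l • r ⊕ ⊖ (r ⊛ g²)            ≈⟨ ⊖-cong (≐-trans (•-congˡ l (⊛-identityʳ r)) ≐-refl) (≐-refl {r ⊛ g²}) ⟨
        l • (r ⊛ 𝟙) ⊕ ⊖ (r ⊛ g²)      ≈⟨ ⊖-cong (⊛-• l r 𝟙) (≐-refl {r ⊛ g²}) ⟨
        r ⊛ (l • 𝟙) ⊕ ⊖ (r ⊛ g²)      ≈⟨ ⊛-⊖ʳ r (l • 𝟙) g² ⟨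
        r ⊛ M                         ≈⟨ star-swap M*≐M (self-adjoint eigenprojection) 𝟘* Mr≐𝟘 ⟩
        𝟘                             ∎)
        where
        open ≐-Reasoning
        𝟘* : star 𝟘 ≐ 𝟘
        𝟘* = pointwise λ x → conj-0
        Mr≐𝟘 : M ⊛ r ≐ 𝟘
        Mr≐𝟘 = ≐-trans (⊛-⊖ʳ M 𝟙 q) (≐-trans (⊖-cong (⊛-identityʳ M) Mq≐M) (A.-‿inverseʳ M))

      -- `r` is r g² divided by `l`, and `g²` absorbs `p` on the right; this is where the eigenvalue
      -- has to be invertible.
      eigen-⊛p : ∀ {y} → l * y ≈ 1# → r ⊛ p ≐ r
      eigen-⊛p ly≈1 = •-cancel ly≈1 (begin
        l • (r ⊛ p)      ≈⟨ •-⊛ l r p ⟨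
        (l • r) ⊛ p      ≈⟨ ⊛-cong eigen (≐-refl {p}) ⟩
        (r ⊛ g²) ⊛ p     ≈⟨ ⊛-assoc r g² p ⟩
        r ⊛ (g² ⊛ p)     ≈⟨ ⊛-cong (≐-refl {r}) (≐-trans (⊛-assoc g g p) (⊛-cong (≐-refl {g}) gp≐g)) ⟩
        r ⊛ g²           ≈⟨ eigen ⟨
        l • r            ∎)
        where open ≐-Reasoning

      p≢eigenprojection : ¬ (p ≐ r)
      p≢eigenprojection p≐r = ¬scalar (l , (begin
        g²               ≈⟨ ⊛-cong pg≐g (≐-refl {g}) ⟨
        (p ⊛ g) ⊛ g      ≈⟨ ⊛-assoc p g g ⟩
        p ⊛ g²           ≈⟨ ⊛-cong p≐r (≐-refl {g²}) ⟩
        r ⊛ g²           ≈⟨ eigen ⟨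
        l • r            ≈⟨ •-congˡ l p≐r ⟨
        l • p            ∎))
        where open ≐-Reasoning

      -- If r vanished, l - g² would be invertible, and l would not be the norm of g².
      eigenprojection≢𝟘 : (norm : OperatorNorm g) → l ≡ OperatorNorm.norm² norm → ¬ (r ≐ 𝟘)
      eigenprojection≢𝟘 norm ≡.refl r≐𝟘 = reciprocal 0≤C C≉0 λ (c , 0≤c , Cc≈1) →
        1≉0 (trans (sym Cc≈1) (trans (*-congˡ (norm-least c 0≤c (gap c 0≤c Cc≈1))) (zeroʳ C)))
        where
        open OperatorNorm norm
        C₀ C : Carrier
        C₀ = ι (growth n) * N (star a)
        C = C₀ * l
        0≤C₀ : 0≤ C₀
        0≤C₀ = 0≤-* (0≤-ι (0≤growth n)) (0≤N (star a))
        0≤C : 0≤ C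
        0≤C = 0≤-* 0≤C₀ 0≤norm²
        -- With r = 0 the projection `q` is `𝟙`, so 1 = aM = Ma* by adjoints. Right multiplication
        -- by `M` is thus undone by `star a`, and N(v) ≤ C₀ N(vM) by `N-⊛`.
        vMa* : ∀ v → v ≐ (v ⊛ M) ⊛ star a
        vMa* v = begin
          v                      ≈⟨ ⊛-identityʳ v ⟨
          v ⊛ 𝟙                  ≈⟨ ⊛-cong (≐-refl {v}) (≐-trans (⊖≐𝟘 r≐𝟘) q≐aM) ⟩
          v ⊛ (a ⊛ M)            ≈⟨ ⊛-cong (≐-refl {v}) (≐-trans (≐-sym 𝟙≐aM) (≐-trans (≐-sym star-𝟙)
                                      (≐-trans (star-cong 𝟙≐aM) (≐-trans (star-⊛ a M) (⊛-cong M*≐M (≐-refl {star a})))))) ⟩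
          v ⊛ (M ⊛ star a)       ≈⟨ ⊛-assoc v M (star a) ⟨
          (v ⊛ M) ⊛ star a       ∎
          where
          open ≐-Reasoning
          𝟙≐aM : 𝟙 ≐ a ⊛ M
          𝟙≐aM = ≐-trans (⊖≐𝟘 r≐𝟘) q≐aM
        -- In the expansion of N(vg² - lv) the one term to estimate is N(vg²) ≤ l N(vg).
        N[vM]≤ : ∀ v → N (v ⊛ M) ≤ l * (l * N v - N (v ⊛ g))
        N[vM]≤ v = 0≤-resp
          (trans (solve 4 (λ l V W X → l :* W :- X := l :* (l :* V :- W) :- ((X :+ l :* l :* V) :- (l :* W :+ l :* W)))
                    refl l (N v) (N (v ⊛ g)) (N (v ⊛ g²)))
             (+-congˡ (-‿cong (trans (sym (N-quadratic g*≐g v l*≈l)) (sym N[vM])))))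
          (≤-resp (N-cong (⊛-assoc v g g)) refl (norm-bound (v ⊛ g)))
          where
          N[vM] : N (v ⊛ M) ≈ N (v ⊛ g² ⊕ ⊖ (l • v))
          N[vM] = trans (N-cong (≐-trans (⊛-⊖ʳ v (l • 𝟙) g²)
              (⊖-cong (≐-trans (⊛-• l v 𝟙) (•-congˡ l (⊛-identityʳ v))) (≐-refl {v ⊛ g²}))))
            (sum-cong λ x → trans (solve 2 (λ u c → u :* c := (:- u) :* (:- c)) refl _ _)
              (*-cong (solve 2 (λ x y → :- (x :- y) := y :- x) refl _ _)
                (trans (sym (conj-neg _)) (conj-cong (solve 2 (λ x y → :- (x :- y) := y :- x) refl _ _)))))
        Nv≤ : ∀ v → N v ≤ C * (l * N v - N (v ⊛ g))
        Nv≤ v = ≤-trans (≤-resp (sym (N-cong (vMa* v))) refl (N-⊛ (v ⊛ M) (star a)))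
          (≤-resp (solve 3 (λ g s X → (g :* s) :* X := g :* (X :* s)) refl (ι (growth n)) (N (star a)) (N (v ⊛ M)))
                  (sym (*-assoc C₀ l _))
            (*-monoˡ-≤ 0≤C₀ (N[vM]≤ v)))
        C≉0 : ¬ C ≈ 0#
        C≉0 C≈0 = 1≉0 (trans (sym N-𝟙) (≤0⇒≈0 (0≤N 𝟙) (≤-resp refl (trans (*-congʳ C≈0) (zeroˡ _)) (Nv≤ 𝟙))))
        -- Dividing N(v) ≤ C (l N(v) - N(vg)) by C exhibits c = 1/C as a slack below `l`, which
        -- `norm-least` forbids.
        gap : ∀ c → 0≤ c → C * c ≈ 1# → ∀ v → N (v ⊛ g) + c * N v ≤ l * N v
        gap c 0≤c Cc≈1 v = 0≤-resp
          (trans (+-congʳ (trans (sym (*-assoc c C _)) (trans (*-congʳ (trans (*-comm c C) Cc≈1)) (*-identityˡ _))))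
            (solve 4 (λ l V W c → (l :* V :- W) :- c :* V := l :* V :- (W :+ c :* V)) refl l (N v) (N (v ⊛ g)) c))
          (*-monoˡ-≤ 0≤c (Nv≤ v))

    -- The norm is at hand as an actual scalar before any double negation is opened; only then is
    -- the ideal of l - g² projected onto and `l` inverted.
    split : ¬ ¬ (∃[ r ] IsProperSubprojection p r)
    split ret =
      let norm = operatorNorm g*≐g
          open OperatorNorm norm
          l*≈l = 0≤⇒real 0≤norm²
      in ideal-projection (norm² • 𝟙 ⊕ ⊖ g²) λ (q , Q , (a , q≐aM) , Mq≐M , _) →
        reciprocal 0≤norm² (norm²≉0 norm) λ (y , _ , ly≈1) →
        ret (𝟙 ⊕ ⊖ q , eigenprojection l*≈l Q q≐aM Mq≐M , eigen-⊛p l*≈l Q q≐aM Mq≐M ly≈1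
            , eigenprojection≢𝟘 l*≈l Q q≐aM Mq≐M norm ≡.refl , p≢eigenprojection l*≈l Q q≐aM Mq≐M)
      where
      -- A vanishing norm forces g = 0, and then g² = 0 · p is a multiple of `p` after all.
      norm²≉0 : (norm : OperatorNorm g) → ¬ OperatorNorm.norm² norm ≈ 0#
      norm²≉0 norm l≈0 = ¬scalar (0# , ≐-trans (⊛-cong g≐𝟘 g≐𝟘) (≐-trans (A.zeroˡ 𝟘) (pointwise λ x → sym (zeroˡ (p x)))))
        where
        open OperatorNorm norm
        g≐𝟘 : g ≐ 𝟘
        g≐𝟘 = N≈0 (≤0⇒≈0 (0≤N g) (≤-resp (N-𝟙⊛ g) (trans (*-congʳ l≈0) (zeroˡ _)) (norm-bound 𝟙)))

-- Primitive projections and their characters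

module Primitive (S : StarField) {n : ℕ} (_∙_ : Fin n → Fin n → Fin n) (ε : Fin n)
                (_⁻¹ : Fin n → Fin n) (isGroup : IsGroup _≡_ _∙_ ε _⁻¹) where
  open StarField S hiding (zero)
  open Scalars S
  open GroupAlgebra S _∙_ ε _⁻¹ isGroup
  open Projections S _∙_ ε _⁻¹ isGroup
  open Splitting S _∙_ ε _⁻¹ isGroup
  open IsProjection
  open IsGroup isGroup using () renaming (assoc to ∙-assoc; identityʳ to ∙-identityʳ; inverseˡ to ∙-inverseˡ)
  private
    group : Group 0ℓ 0ℓ
    group = record { isGroup = isGroup }
  open Algebra.Properties.Group group

  τ⁻¹ : A → Carrier → Set
  τ⁻¹ p t = τ p * t ≈ 1#

  -- The corner pAp consists of multiples of `p`. The coefficient is written as a quotient of traces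
  -- instead of being asserted to exist: the condition becomes a family of equations, which are
  -- stable, and eigenvalues become explicit terms.
  IsPrimitive : A → Carrier → Set
  IsPrimitive p t = ∀ a → p ⊛ a ⊛ p ≐ (τ (p ⊛ a ⊛ p) * t) • p

  module _ {p t} (P : IsProjection p) (τt≈1 : τ⁻¹ p t) where

    scalar⇒τ : ∀ {k c} → k ≐ c • p → k ≐ (τ k * t) • p
    scalar⇒τ {k} {c} e = ≐-trans e (•-cong (begin
      c               ≈⟨ *-identityʳ c ⟨
      c * 1#          ≈⟨ *-congˡ τt≈1 ⟨
      c * (τ p * t)   ≈⟨ *-assoc c (τ p) t ⟨
      c * τ p * t     ≈⟨ *-congʳ (at e ε) ⟨
      τ k * t         ∎) (≐-refl {p}))
      where open ≈-Reasoning

    Splitter : A → Set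
    Splitter g = star g ≐ g × p ⊛ g ≐ g × ¬ (∃[ c ] g ⊛ g ≐ c • p)

    -- Polarisation: g² and (g + p)² can both be multiples of p only if g is.
    hermitian-scalar : ¬ (∃[ g ] Splitter g) → ∀ {g} → star g ≐ g → p ⊛ g ≐ g → g ≐ (τ g * t) • p
    hermitian-scalar none {g} g*≐g pg≐g = pointwise λ x → ≈-stable λ g≉ →
      none (g , g*≐g , pg≐g , λ (c , gg≐cp) →
        none (g ⊕ p , ≐-trans (star-⊕ g p) (A.+-cong g*≐g (self-adjoint P))
                    , ≐-trans (⊛-distribˡ p g p) (A.+-cong pg≐g (idempotent P))
                    , λ (d , e) → g≉ (at (scalar⇒τ {g} {ι ½ * (d - c - 1#)} (g≐ c d gg≐cp e)) x)))
      where
      gp≐g : g ⊛ p ≐ g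
      gp≐g = star-swap (self-adjoint P) g*≐g g*≐g pg≐g
      g≐ : ∀ c d → g ⊛ g ≐ c • p → (g ⊕ p) ⊛ (g ⊕ p) ≐ d • p → g ≐ (ι ½ * (d - c - 1#)) • p
      g≐ c d gg≐cp e = pointwise λ x → trans
        (trans (solve 3 (λ g q p → g := con ½ :* (((q :+ g) :+ (g :+ p)) :- q :- p)) refl (g x) (c * p x) (p x))
          (*-congˡ (+-congʳ (+-congʳ (trans (sym (at expand x)) (at e x))))))
        (trans (solve 5 (λ h d c p o → h :* (d :* p :- c :* p :- p) := h :* ((d :- c :- con 1ℚ) :* p)) refl (ι ½) d c (p x) 1#)
          (trans (*-congˡ (*-congʳ (+-congˡ (-‿cong ι-1)))) (sym (*-assoc _ _ _))))
        where
        expand : (g ⊕ p) ⊛ (g ⊕ p) ≐ (c • p ⊕ g) ⊕ (g ⊕ p)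
        expand = ≐-trans (⊛-distribʳ (g ⊕ p) g p) (A.+-cong
          (≐-trans (⊛-distribˡ g g p) (A.+-cong gg≐cp gp≐g))
          (≐-trans (⊛-distribˡ p g p) (A.+-cong pg≐g (idempotent P))))

    -- Splitters are Hermitian, so k = pap is decomposed into k + k* and i(k - k*). Both are fixed
    -- by `p`, hence multiples of it by `hermitian-scalar`, and `parts` recombines them.
    no-splitter⇒primitive : ¬ (∃[ g ] Splitter g) → IsPrimitive p t
    no-splitter⇒primitive none a = pointwise λ x → begin
      k x
        ≈⟨ parts x ⟩
      ι ½ * u x + - (ι ½ * 𝑖) * v x
        ≈⟨ +-cong (*-congˡ (at (hermitian-scalar none u*≐u pu≐u) x)) (*-congˡ (at (hermitian-scalar none v*≐v pv≐v) x)) ⟩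
      ι ½ * (τ u * t * p x) + - (ι ½ * 𝑖) * (τ v * t * p x)
        ≈⟨ solve 6 (λ h m u v t p → h :* (u :* t :* p) :+ m :* (v :* t :* p) := (h :* u :+ m :* v) :* t :* p) refl (ι ½) (- (ι ½ * 𝑖)) (τ u) (τ v) t (p x) ⟩
      (ι ½ * τ u + - (ι ½ * 𝑖) * τ v) * t * p x
        ≈⟨ *-congʳ (*-congʳ (parts ε)) ⟨
      τ k * t * p x ∎
      where
      open ≈-Reasoning
      k u v : A
      k = p ⊛ a ⊛ p
      u = k ⊕ star k
      v = 𝑖 • (k ⊕ ⊖ star k)
      parts : ∀ x → k x ≈ ι ½ * u x + - (ι ½ * 𝑖) * v x
      parts x = begin
        k x
          ≈⟨ solve 2 (λ k s → k := con ½ :* (k :+ s) :- con ½ :* ((:- con 1ℚ) :* (k :- s))) refl (k x) (star k x) ⟩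
        ι ½ * u x - ι ½ * ((- ι 1ℚ) * (k x - star k x))
          ≈⟨ +-congˡ (-‿cong (*-congˡ (*-congʳ (trans 𝑖*𝑖 (-‿cong (sym ι-1)))))) ⟨
        ι ½ * u x - ι ½ * ((𝑖 * 𝑖) * (k x - star k x))
          ≈⟨ solve 4 (λ h u i d → h :* u :- h :* ((i :* i) :* d) := h :* u :+ (:- (h :* i)) :* (i :* d)) refl (ι ½) (u x) 𝑖 _ ⟩
        ι ½ * u x + - (ι ½ * 𝑖) * v x ∎
      pk≐k : p ⊛ k ≐ k
      pk≐k = ≐-trans (≐-sym (⊛-assoc p (p ⊛ a) p)) (⊛-cong
        (≐-trans (≐-sym (⊛-assoc p p a)) (⊛-cong (idempotent P) (≐-refl {a}))) (≐-refl {p}))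
      pk*≐k* : p ⊛ star k ≐ star k
      pk*≐k* = ≐-trans (⊛-cong (≐-sym (self-adjoint P)) (≐-refl {star k})) (≐-trans (≐-sym (star-⊛ k p))
        (star-cong (≐-trans (⊛-assoc (p ⊛ a) p p) (⊛-cong (≐-refl {p ⊛ a}) (idempotent P)))))
      u*≐u : star u ≐ u
      u*≐u = ≐-trans (star-⊕ k (star k)) (≐-trans (A.+-congˡ {star k} (star-star k)) (A.+-comm (star k) k))
      pu≐u : p ⊛ u ≐ u
      pu≐u = ≐-trans (⊛-distribˡ p k (star k)) (A.+-cong pk≐k pk*≐k*)
      v*≐v : star v ≐ v
      v*≐v = ≐-trans (star-• 𝑖 (k ⊕ ⊖ star k)) (≐-trans (•-cong conj-𝑖 (≐-trans (star-⊕ k (⊖ star k))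
        (A.+-congˡ {star k} (≐-trans (star-⊖ (star k)) (A.-‿cong (star-star k))))))
        (pointwise λ x → solve 3 (λ i k s → (:- i) :* (s :- k) := i :* (k :- s)) refl 𝑖 (k x) (star k x)))
      pv≐v : p ⊛ v ≐ v
      pv≐v = ≐-trans (⊛-• 𝑖 p (k ⊕ ⊖ star k)) (•-congˡ 𝑖 (≐-trans (⊛-⊖ʳ p k (star k)) (⊖-cong pk≐k pk*≐k*)))

    primitive-or-split : ¬ ¬ (IsPrimitive p t ⊎ (∃[ r ] IsProperSubprojection p r))
    primitive-or-split ret = ¬¬-lem (∃[ g ] Splitter g)
      (λ (g , g*≐g , pg≐g , ¬scalar) ret → split P g*≐g pg≐g ¬scalar λ r → ret (inj₂ r))
      (λ none ret → ret (inj₁ (no-splitter⇒primitive none)))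
      ret

  IsClass : A → Set
  IsClass f = ∀ x y → f (x ∙ (y ∙ (x ⁻¹))) ≈ f y

  x⁻¹[xyx⁻¹]x≡y : ∀ x y → ((x ⁻¹) ∙ (x ∙ (y ∙ (x ⁻¹)))) ∙ x ≡ y
  x⁻¹[xyx⁻¹]x≡y x y = ≡.trans (cong (_∙ x) (\\-leftDividesʳ x (y ∙ (x ⁻¹)))) (//-rightDividesˡ x y)

  reindex-conj : ∀ g (t : A) → sum t ≈ sum (λ x → t (g ∙ (x ∙ (g ⁻¹))))
  reindex-conj g t = trans (reindexˡ g t) (reindexʳ (g ⁻¹) (λ x → t (g ∙ x)))

  -- Replacing y by xy⁻¹ turns f(y) a(y⁻¹x) into f(xy⁻¹) a(y), and xy⁻¹ is conjugate to y⁻¹x.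
  class-central : ∀ {f} → IsClass f → ∀ a → f ⊛ a ≐ a ⊛ f
  class-central {f} cl a = pointwise λ x → begin
    sum (λ y → f y * a ((y ⁻¹) ∙ x))
      ≈⟨ reindexˡ x (λ y → f y * a ((y ⁻¹) ∙ x)) ⟩
    sum (λ y → f (x ∙ y) * a (((x ∙ y) ⁻¹) ∙ x))
      ≈⟨ reindex⁻¹ (λ y → f (x ∙ y) * a (((x ∙ y) ⁻¹) ∙ x)) ⟩
    sum (λ y → f (x ∙ (y ⁻¹)) * a (((x ∙ (y ⁻¹)) ⁻¹) ∙ x))
      ≈⟨ sum-cong (λ y → trans (*-comm _ _) (*-cong (ap a (lemma x y)) (trans (sym (cl (y ⁻¹) _)) (ap f (lemma′ x y))))) ⟩
    sum (λ y → a y * f ((y ⁻¹) ∙ x)) ∎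
    where
    open ≈-Reasoning
    lemma : ∀ x y → ((x ∙ (y ⁻¹)) ⁻¹) ∙ x ≡ y
    lemma x y = ≡.trans ([gh]⁻¹x x (y ⁻¹) x) (≡.trans (cong (((y ⁻¹) ⁻¹) ∙_) (∙-inverseˡ x))
      (≡.trans (∙-identityʳ _) (⁻¹-involutive y)))
    lemma′ : ∀ x y → (y ⁻¹) ∙ ((x ∙ (y ⁻¹)) ∙ ((y ⁻¹) ⁻¹)) ≡ (y ⁻¹) ∙ x
    lemma′ x y = cong ((y ⁻¹) ∙_) (//-rightDividesʳ (y ⁻¹) x)

  star-central : ∀ {f} → (∀ a → f ⊛ a ≐ a ⊛ f) → ∀ a → star f ⊛ a ≐ a ⊛ star f
  star-central {f} central a = begin
    star f ⊛ a               ≈⟨ ⊛-cong (≐-refl {star f}) (star-star a) ⟨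
    star f ⊛ star (star a)   ≈⟨ star-⊛ (star a) f ⟨
    star (star a ⊛ f)        ≈⟨ star-cong (central (star a)) ⟨
    star (f ⊛ star a)        ≈⟨ star-⊛ f (star a) ⟩
    star (star a) ⊛ star f   ≈⟨ ⊛-cong (star-star a) (≐-refl {star f}) ⟩
    a ⊛ star f               ∎
    where open ≐-Reasoning

  module _ {p t k} (P : IsProjection p) (τt≈1 : τ⁻¹ p t) (prim : IsPrimitive p t) (R : HasRank p k) where

    -- At `g` this is the trace, on the left ideal of `p`, of translation by the inverse of `g`: the
    -- complex conjugate of the character of that ideal.
    character : A
    character g = sum λ x → p (((x ⁻¹) ∙ g) ∙ x)

    -- A class function does not see the conjugation by x, so every x contributes `⟪ f , p ⟫`.
    ⟪⟫-character : ∀ {f} → IsClass f → ⟪ f , character ⟫ ≈ ι (fromℕ n) * ⟪ f , p ⟫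
    ⟪⟫-character {f} cl = begin
      sum (λ g → f g * conj (character g))
        ≈⟨ sum-cong (λ g → trans (*-congˡ (conj-sum λ x → p (((x ⁻¹) ∙ g) ∙ x)))
             (*-distribˡ-sum (f g) λ x → conj (p (((x ⁻¹) ∙ g) ∙ x)))) ⟩
      sum (λ g → sum λ x → f g * conj (p (((x ⁻¹) ∙ g) ∙ x)))
        ≈⟨ ∑-comm (λ g x → f g * conj (p (((x ⁻¹) ∙ g) ∙ x))) ⟩
      sum (λ x → sum λ g → f g * conj (p (((x ⁻¹) ∙ g) ∙ x)))
        ≈⟨ sum-cong (λ x → trans (reindex-conj x (λ g → f g * conj (p (((x ⁻¹) ∙ g) ∙ x))))
             (sum-cong λ u → *-cong (cl x u) (conj-cong (ap p (x⁻¹[xyx⁻¹]x≡y x u))))) ⟩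
      sum {n} (λ x → ⟪ f , p ⟫)
        ≈⟨ sum-const n ⟪ f , p ⟫ ⟩
      ι (fromℕ n) * ⟪ f , p ⟫ ∎
      where open ≈-Reasoning

    character-class : IsClass character
    character-class g y = trans (reindexˡ g (λ x → p (((x ⁻¹) ∙ (g ∙ (y ∙ (g ⁻¹)))) ∙ x)))
      (sum-cong λ x → ap p (lemma x))
      where
      lemma : ∀ x → (((g ∙ x) ⁻¹) ∙ (g ∙ (y ∙ (g ⁻¹)))) ∙ (g ∙ x) ≡ ((x ⁻¹) ∙ y) ∙ x
      lemma x = ≡.trans (cong (_∙ (g ∙ x)) (≡.trans ([gh]⁻¹x g x _) (cong ((x ⁻¹) ∙_) (\\-leftDividesʳ g (y ∙ (g ⁻¹))))))
        (≡.trans (cong (_∙ (g ∙ x)) (≡.sym (∙-assoc (x ⁻¹) y (g ⁻¹))))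
        (≡.trans (≡.sym (∙-assoc (((x ⁻¹) ∙ y) ∙ (g ⁻¹)) g x)) (cong (_∙ x) (//-rightDividesˡ g ((x ⁻¹) ∙ y)))))

    Np≈τp : N p ≈ τ p
    Np≈τp = sym (τ≈N P)

    -- The sum becomes ∑ (p δₓ p)(x) over all x. Primitivity makes p δₓ p the multiple of `p` with
    -- coefficient conj (p x) * t, which leaves N(p) t = τ(p) t = 1.
    ⟪character,p⟫ : ⟪ character , p ⟫ ≈ 1#
    ⟪character,p⟫ = begin
      sum (λ u → sum (λ x → p (((x ⁻¹) ∙ u) ∙ x)) * conj (p u))
        ≈⟨ sum-cong (λ u → *-distribʳ-sum (conj (p u)) λ x → p (((x ⁻¹) ∙ u) ∙ x)) ⟩
      sum (λ u → sum λ x → p (((x ⁻¹) ∙ u) ∙ x) * conj (p u))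
        ≈⟨ ∑-comm (λ u x → p (((x ⁻¹) ∙ u) ∙ x) * conj (p u)) ⟩
      sum (λ x → sum λ u → p (((x ⁻¹) ∙ u) ∙ x) * conj (p u))
        ≈⟨ sum-cong (λ x → trans (reindex⁻¹ λ u → p (((x ⁻¹) ∙ u) ∙ x) * conj (p u))
             (sum-cong λ u → trans (*-comm _ _) (*-cong (at (self-adjoint P) u) (ap p (∙-assoc (x ⁻¹) (u ⁻¹) x))))) ⟩
      sum (λ x → (p ⊛ shift x p) x)
        ≈⟨ sum-cong (λ x → at (trans-δ x) x) ⟩
      sum (λ x → (p ⊛ shift x 𝟙 ⊛ p) x)
        ≈⟨ sum-cong (λ x → trans (at (prim (shift x 𝟙)) x) (*-congʳ (*-congʳ (τ[pδp] x)))) ⟩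
      sum (λ x → conj (p x) * t * p x)
        ≈⟨ sum-cong (λ x → solve 3 (λ c t p → c :* t :* p := (p :* c) :* t) refl (conj (p x)) t (p x)) ⟩
      sum (λ x → p x * conj (p x) * t)
        ≈⟨ *-distribʳ-sum t (λ x → p x * conj (p x)) ⟨
      N p * t
        ≈⟨ *-congʳ Np≈τp ⟩
      τ p * t
        ≈⟨ τt≈1 ⟩
      1# ∎
      where
      open ≈-Reasoning
      δp : ∀ x → shift x 𝟙 ⊛ p ≐ shift x p
      δp x = ≐-trans (≐-sym (shift-⊛ x 𝟙 p)) (shift-cong x (⊛-identityˡ p))
      trans-δ : ∀ x → p ⊛ shift x p ≐ p ⊛ shift x 𝟙 ⊛ p
      trans-δ x = ≐-trans (⊛-cong (≐-refl {p}) (≐-sym (δp x))) (≐-sym (⊛-assoc p (shift x 𝟙) p))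
      τ[pδp] : ∀ x → τ (p ⊛ shift x 𝟙 ⊛ p) ≈ conj (p x)
      τ[pδp] x = trans (τ-comm (p ⊛ shift x 𝟙) p) (trans (at (≐-trans (≐-sym (⊛-assoc p p (shift x 𝟙)))
          (⊛-cong (idempotent P) (≐-refl {shift x 𝟙}))) ε)
        (trans (τ-comm p (shift x 𝟙)) (trans (at (δp x) ε) (trans (ap p (∙-identityʳ (x ⁻¹)))
          (trans (sym (conj-conj _)) (conj-cong (at (self-adjoint P) x)))))))

    -- The orthogonality relation for one irreducible character with itself, summed over G without
    -- normalisation.
    N-character : N character ≈ ι (fromℕ n)
    N-character = trans (⟪⟫-character character-class) (trans (*-congˡ ⟪character,p⟫) (*-identityʳ _))

    module _ {f} (cl : IsClass f) (Nf≈n : N f ≈ ι (fromℕ n)) where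

      eigenvalue : Carrier
      eigenvalue = τ (p ⊛ f ⊛ p) * t

      -- Schur's lemma for the ideal: centrality gives fp = pfp, and primitivity makes that a
      -- multiple of `p`.
      f-eigen : f ⊛ p ≐ eigenvalue • p
      f-eigen = ≐-trans (≐-sym (≐-trans (⊛-cong (≐-sym (class-central cl p)) (≐-refl {p}))
        (≐-trans (⊛-assoc f p p) (⊛-cong (≐-refl {f}) (idempotent P))))) (prim f)

      f*-eigen : star f ⊛ p ≐ conj eigenvalue • p
      f*-eigen = ≐-trans (star-central (class-central cl) p) (≐-trans (⊛-cong (≐-sym (self-adjoint P)) (≐-refl {star f}))
        (≐-trans (≐-sym (star-⊛ f p)) (≐-trans (star-cong f-eigen) (≐-trans (star-• eigenvalue p) (•-congˡ _ (self-adjoint P))))))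

      ⟪f,character⟫ : ⟪ f , character ⟫ ≈ eigenvalue * ι (fromℕ k)
      ⟪f,character⟫ = begin
        ⟪ f , character ⟫                        ≈⟨ ⟪⟫-character cl ⟩
        ι (fromℕ n) * ⟪ f , p ⟫                  ≈⟨ *-congˡ (⟪⟫-τ f p) ⟩
        ι (fromℕ n) * τ (f ⊛ star p)             ≈⟨ *-congˡ (at (≐-trans (⊛-cong (≐-refl {f}) (self-adjoint P)) f-eigen) ε) ⟩
        ι (fromℕ n) * (eigenvalue * τ p)         ≈⟨ solve 3 (λ n l t → n :* (l :* t) := l :* (n :* t)) refl _ _ _ ⟩
        eigenvalue * (ι (fromℕ n) * τ p)         ≈⟨ *-congˡ (rank-trace R) ⟩
        eigenvalue * ι (fromℕ k)                 ∎
        where open ≈-Reasoning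

      -- Expanding 0 ≤ N(f - χ) plays the role of the Cauchy-Schwarz inequality, as f and the
      -- character χ both have norm |G|.
      eigenvalue-bound : (eigenvalue + conj eigenvalue) * ι (fromℕ k) ≤ ι (fromℕ n) + ι (fromℕ n)
      eigenvalue-bound = 0≤-resp (trans (N-⊖ f character) (+-cong (+-cong Nf≈n N-character) (-‿cong
          (trans (+-cong ⟪f,character⟫ (trans (sym (⟪⟫-conj f character)) (trans (conj-cong ⟪f,character⟫)
            (trans (conj-* _ _) (*-congˡ (conj-ι (fromℕ k)))))))
            (sym (distribʳ _ _ _))))))
        (0≤N (f ⊕ ⊖ character))

-- The bound on the convolution

module Positivity (S : StarField) {n : ℕ} (_∙_ : Fin n → Fin n → Fin n) (ε : Fin n)
                (_⁻¹ : Fin n → Fin n) (isGroup : IsGroup _≡_ _∙_ ε _⁻¹) where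
  open StarField S hiding (zero)
  open Scalars S
  open GroupAlgebra S _∙_ ε _⁻¹ isGroup
  open Projections S _∙_ ε _⁻¹ isGroup
  open Splitting S _∙_ ε _⁻¹ isGroup
  open Primitive S _∙_ ε _⁻¹ isGroup
  open IsProjection

  ι-cancel : ∀ {p q} → ι p ≈ ι q → p ℚ.≤ q
  ι-cancel {p} {q} e = Rationals.≤-offset
    (0≤-ι⁻¹ (0≤-resp (trans (+-congˡ (sym (ι-neg p))) (sym (ι-+ q (ℚ.- p)))) (≤-reflexive e)))
    (≡.trans (≡.sym (ℚₚ.+-identityˡ q)) (≡.trans (cong (ℚ._+ q) (≡.sym (ℚₚ.+-inverseʳ p)))
      (≡.trans (ℚₚ.+-assoc p (ℚ.- p) q) (cong (p ℚ.+_) (ℚₚ.+-comm (ℚ.- p) q)))))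

  -- Ranks add up through traces, that is, as scalars; this brings the comparison back to ℕ for the
  -- induction in `positive`.
  ι-fromℕ-+ : ∀ {k l m} → ι (fromℕ k) + ι (fromℕ l) ≈ ι (fromℕ m) → ¬ l ≡ 0 → k ℕ.< m
  ι-fromℕ-+ {k} {zero}  {m} e l≢0 = ⊥-elim (l≢0 ≡.refl)
  ι-fromℕ-+ {k} {suc l} {m} e _ = ℕₚ.≰⇒> λ m≤k → ℚₚ.<-irrefl ≡.refl (ℚₚ.<-≤-trans
    (Rationals.<-offset {fromℕ (suc l)} {fromℕ k ℚ.+ fromℕ (suc l)} {fromℕ k} (0<fromℕ l) ≡.refl)
    (ℚₚ.≤-trans (ι-cancel (trans (ι-+ (fromℕ k) (fromℕ (suc l))) e)) (fromℕ-mono m≤k)))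

  ι-fromℕ≉0 : ∀ {k} → 0 ℕ.< k → ¬ ι (fromℕ k) ≈ 0#
  ι-fromℕ≉0 {suc k} _ e = ℚₚ.<-irrefl ≡.refl (ℚₚ.<-≤-trans (0<fromℕ k) (ι-cancel (trans e (sym ι-0))))

  n≉0 : ¬ ι (fromℕ n) ≈ 0#
  n≉0 = ι-fromℕ≉0 (ℕ.>-nonZero⁻¹ n {{nonZeroIndex ε}})

  rank≢0 : ∀ {p k} → IsProjection p → HasRank p k → ¬ p ≐ 𝟘 → ¬ k ≡ 0
  rank≢0 {p} P R p≢𝟘 ≡.refl = reciprocal (0≤-ι (0≤fromℕ n)) n≉0 λ (y , _ , ny≈1) →
    p≢𝟘 (τ≈0 P (cancel y (trans (*-comm _ _) ny≈1) (trans (*-comm _ _) (trans (rank-trace R) ι-0))))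

  -- |G| times the projection onto the trivial representation. The condition `p ⊛ 𝕛 ≐ 𝟘` says that
  -- the coefficients of `p` sum to 0.
  𝕛 : A
  𝕛 x = 1#

  ⊛-𝕛 : ∀ a → a ⊛ 𝕛 ≐ sum a • 𝕛
  ⊛-𝕛 a = pointwise λ x → trans (sum-cong λ y → *-identityʳ (a y)) (sym (*-identityʳ _))

  Eigen : A → Carrier → A → Set
  Eigen a s p = a ⊛ p ≐ s • p

  eigen-⊛ : ∀ {a b s t p} → Eigen a s p → Eigen b t p → Eigen (a ⊛ b) (s * t) p
  eigen-⊛ {a} {b} {s} {t} {p} e f = begin
    a ⊛ b ⊛ p       ≈⟨ ⊛-assoc a b p ⟩
    a ⊛ (b ⊛ p)     ≈⟨ ⊛-cong (≐-refl {a}) f ⟩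
    a ⊛ (t • p)     ≈⟨ ⊛-• t a p ⟩
    t • (a ⊛ p)     ≈⟨ •-congˡ t e ⟩
    t • (s • p)     ≈⟨ pointwise (λ x → solve 3 (λ s t p → t :* (s :* p) := (s :* t) :* p) refl s t (p x)) ⟩
    (s * t) • p     ∎
    where open ≐-Reasoning

  eigen-⊖ : ∀ {a b s t p} → Eigen a s p → Eigen b t p → Eigen (a ⊕ ⊖ b) (s - t) p
  eigen-⊖ {a} {b} {s} {t} {p} e f = ≐-trans (⊛-⊖ˡ a b p) (≐-trans (⊖-cong e f)
    (pointwise λ x → solve 3 (λ s t p → s :* p :- t :* p := (s :- t) :* p) refl s t (p x)))

  eigen-• : ∀ {a s p} c → Eigen a s p → Eigen (c • a) (c * s) p
  eigen-• {a} {s} {p} c e = ≐-trans (•-⊛ c a p) (≐-trans (•-congˡ c e) (•-• c s p))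

  module _ {f} (cl : IsClass f) (Nf≈n : N f ≈ ι (fromℕ n)) (Σf≈0 : sum f ≈ 0#)
           {d} (0<d : 0 ℕ.< d) {κ : Carrier} (0≤κ : 0≤ κ) (κd≈2n : κ * ι (fromℕ d) ≈ ι (fromℕ n) + ι (fromℕ n))
           (d-min : ∀ {p t k} → IsProjection p → τ⁻¹ p t → IsPrimitive p t → HasRank p k → p ⊛ 𝕛 ≐ 𝟘 → d ℕ.≤ k)
    where

    -- τ (φ p) = (κ - λ - conj λ) λ conj λ τ(p) whenever f acts on p as the scalar λ.
    φ : A
    φ = (κ • (f ⊛ star f) ⊕ ⊖ (f ⊛ (f ⊛ star f))) ⊕ ⊖ (f ⊛ (star f ⊛ star f))

    φ-eigen : ∀ {p s t} → Eigen f s p → Eigen (star f) t p → Eigen φ ((κ * (s * t) - s * (s * t)) - s * (t * t)) p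
    φ-eigen e e* = eigen-⊖ (eigen-⊖ (eigen-• κ (eigen-⊛ e e*)) (eigen-⊛ e (eigen-⊛ e e*))) (eigen-⊛ e (eigen-⊛ e* e*))

    primitive-positive : ∀ {p t k} → IsProjection p → τ⁻¹ p t → IsPrimitive p t → HasRank p k → p ⊛ 𝕛 ≐ 𝟘 →
      0≤ τ (φ ⊛ p)
    primitive-positive {p} {t} {k} P τt≈1 prim R pj≐𝟘 = 0≤-stable λ ret →
      reciprocal (0≤-ι (0≤fromℕ k)) (ι-fromℕ≉0 (ℕₚ.<-≤-trans 0<d d≤k)) λ (y , 0≤y , ky≈1) → ret
        (0≤-resp (trans
           (solve 4 (λ c s t p → (c :- (s :+ t)) :* (s :* t) :* p := ((c :* (s :* t) :- s :* (s :* t)) :- s :* (t :* t)) :* p)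
             refl κ l (conj l) (τ p))
           (sym (at (φ-eigen (f-eigen P τt≈1 prim R cl Nf≈n) (f*-eigen P τt≈1 prim R cl Nf≈n)) ε)))
         (0≤-* (0≤-* (0≤κ-l y 0≤y ky≈1) (0≤-norm l)) (0≤τ P)))
      where
      l = eigenvalue P τt≈1 prim R cl Nf≈n
      d≤k = d-min P τt≈1 prim R pj≐𝟘
      -- (λ + conj λ) k ≤ 2n = κ d ≤ κ k, divided by the rank k. Here the minimality of `d` enters,
      -- as d ≤ k.
      0≤κ-l : ∀ y → 0≤ y → ι (fromℕ k) * y ≈ 1# → 0≤ (κ - (l + conj l))
      0≤κ-l y 0≤y ky≈1 = 0≤-resp
        (trans (solve 4 (λ c l k y → ((c :* k) :- l :* k) :* y := (c :- l) :* (k :* y)) refl κ (l + conj l) (ι (fromℕ k)) y)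
          (trans (*-congˡ ky≈1) (*-identityʳ _)))
        (0≤-* (≤-trans (eigenvalue-bound P τt≈1 prim R cl Nf≈n) (≤-resp κd≈2n refl (*-monoˡ-≤ 0≤κ (ι-mono (fromℕ-mono d≤k))))) 0≤y)

    τφ-⊖ : ∀ a b → τ (φ ⊛ (a ⊕ ⊖ b)) ≈ τ (φ ⊛ a) - τ (φ ⊛ b)
    τφ-⊖ a b = at (⊛-⊖ʳ φ a b) ε

    -- Induction on a bound for the rank. If `p` is not primitive, it has a proper subprojection r;
    -- r and p - r are nonzero, so both have smaller rank, both still annihilate `𝕛`, and τ(φ ·) is
    -- additive. All cases are taken under the double negation that `0≤-stable` removes.
    positive : ∀ m {p k} → k ℕ.< m → IsProjection p → HasRank p k → p ⊛ 𝕛 ≐ 𝟘 → 0≤ τ (φ ⊛ p)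
    positive (suc m) {p} {k} (ℕ.s≤s k≤m) P R pj≐𝟘 = 0≤-stable (¬¬-lem (τ p ≈ 0#)
      (λ τp≈0 ret → ret (0≤-resp (sym (at (≐-trans (⊛-cong (≐-refl {φ}) (τ≈0 P τp≈0)) (A.zeroʳ φ)) ε)) 0≤0))
      (λ τp≉0 ret → reciprocal (0≤τ P) τp≉0 λ (t , _ , τt≈1) → primitive-or-split P τt≈1 λ where
        (inj₁ prim) → ret (primitive-positive P τt≈1 prim R pj≐𝟘)
        (inj₂ (r , Q , rp≐r , r≢𝟘 , p≢r)) →
          let P-Q = projection-⊖ P Q rp≐r
              rj≐𝟘 : r ⊛ 𝕛 ≐ 𝟘
              rj≐𝟘 = ≐-trans (⊛-cong (≐-sym rp≐r) (≐-refl {𝕛})) (≐-trans (⊛-assoc r p 𝕛)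
                (≐-trans (⊛-cong (≐-refl {r}) pj≐𝟘) (A.zeroʳ r)))
              p-rj≐𝟘 : (p ⊕ ⊖ r) ⊛ 𝕛 ≐ 𝟘
              p-rj≐𝟘 = ≐-trans (⊛-⊖ˡ p r 𝕛) (≐-trans (⊖-cong pj≐𝟘 rj≐𝟘) (A.-‿inverseʳ 𝟘))
          in projection-rank Q λ (k₁ , R₁) → projection-rank P-Q λ (k₂ , R₂) →
          let k₁+k₂≈k : ι (fromℕ k₁) + ι (fromℕ k₂) ≈ ι (fromℕ k)
              k₁+k₂≈k = trans (+-cong (sym (rank-trace R₁)) (sym (rank-trace R₂))) (trans
                (solve 3 (λ n p r → n :* r :+ n :* (p :- r) := n :* p) refl (ι (fromℕ n)) (τ p) (τ r)) (rank-trace R))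
              k₁<k = ι-fromℕ-+ k₁+k₂≈k (rank≢0 P-Q R₂ (λ e → p≢r (⊖≐𝟘 e)))
              k₂<k = ι-fromℕ-+ (trans (+-comm _ _) k₁+k₂≈k) (rank≢0 Q R₁ r≢𝟘)
          in ret (0≤-resp (trans (+-congˡ (τφ-⊖ p r)) (solve 2 (λ p r → r :+ (p :- r) := p) refl (τ (φ ⊛ p)) (τ (φ ⊛ r))))
               (0≤-+ (positive m (ℕₚ.<-≤-trans k₁<k k≤m) Q R₁ rj≐𝟘)
                     (positive m (ℕₚ.<-≤-trans k₂<k k≤m) P-Q R₂ p-rj≐𝟘)))))

    τφ : τ (φ ⊛ 𝟙) ≈ κ * ι (fromℕ n) - (⟪ f ⊛ f , f ⟫ + conj ⟪ f ⊛ f , f ⟫)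
    τφ = trans (at (⊛-identityʳ φ) ε) (trans
      (+-cong (+-cong (*-congˡ (trans (sym (⟪⟫-τ f f)) Nf≈n))
                      (-‿cong (trans (at (≐-sym (⊛-assoc f f (star f))) ε) (sym (⟪⟫-τ (f ⊛ f) f)))))
              (-‿cong (trans (at (⊛-cong (≐-refl {f}) (≐-sym (star-⊛ f f))) ε)
                (trans (sym (⟪⟫-τ f (f ⊛ f))) (sym (⟪⟫-conj (f ⊛ f) f))))))
      (solve 3 (λ a b c → (a :- b) :- c := a :- (b :+ c)) refl (κ * ι (fromℕ n)) ⟪ f ⊛ f , f ⟫ (conj ⟪ f ⊛ f , f ⟫)))

    -- The coefficients of f and of its star sum to 0, so both annihilate `𝕛`, and `φ-eigen` applies
    -- with eigenvalues 0.
    τφ𝕛 : τ (φ ⊛ 𝕛) ≈ 0#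
    τφ𝕛 = trans (at (φ-eigen ej (≐-trans (⊛-𝕛 (star f)) (•-cong Σf*≈0 (≐-refl {𝕛})))) ε)
      (trans (solve 3 (λ c z o → ((c :* (z :* z) :- z :* (z :* z)) :- z :* (z :* z)) :* o := z :* ((c :- z :- z) :* z :* o)) refl κ 0# 1#)
        (zeroˡ _))
      where
      ej : Eigen f 0# 𝕛
      ej = ≐-trans (⊛-𝕛 f) (•-cong Σf≈0 (≐-refl {𝕛}))
      Σf*≈0 : sum (star f) ≈ 0#
      Σf*≈0 = trans (sym (conj-sum λ x → f (x ⁻¹))) (trans (conj-cong (trans (sym (reindex⁻¹ f)) Σf≈0)) conj-0)

    convolution-bound : ⟪ f ⊛ f , f ⟫ + conj ⟪ f ⊛ f , f ⟫ ≤ κ * ι (fromℕ n)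
    convolution-bound = 0≤-stable λ ret → reciprocal (0≤-ι (0≤fromℕ n)) n≉0 λ (y , 0≤y , ny≈1) →
      -- `J` projects onto the trivial representation. Its complement is the projection to which
      -- `positive` applies, and τ(φJ) = 0 makes the complement carry all of τ(φ).
      let J = y • 𝕛
          J*≐J : star J ≐ J
          J*≐J = ≐-trans (star-• y 𝕛) (•-cong (0≤⇒real 0≤y) (pointwise λ _ → conj-1))
          ⊛-J : ∀ a → a ⊛ J ≐ (y * sum a) • 𝕛
          ⊛-J a = ≐-trans (⊛-• y a 𝕛) (≐-trans (•-congˡ y (⊛-𝕛 a)) (•-• y (sum a) 𝕛))
          ΣJ≈1 : sum J ≈ 1#
          ΣJ≈1 = trans (sum-const n (y * 1#)) (trans (*-congˡ (*-identityʳ y)) ny≈1)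
          J-projection : IsProjection J
          J-projection = record { self-adjoint = J*≐J
            ; idempotent = ≐-trans (⊛-J J) (•-cong (trans (*-congˡ ΣJ≈1) (*-identityʳ y)) (≐-refl {𝕛})) }
          P = projection-⊖ 𝟙-projection J-projection (⊛-identityʳ J)
          pj≐𝟘 : (𝟙 ⊕ ⊖ J) ⊛ 𝕛 ≐ 𝟘
          pj≐𝟘 = ≐-trans (⊛-⊖ˡ 𝟙 J 𝕛) (≐-trans (⊖-cong (⊛-identityˡ 𝕛) (≐-trans (⊛-𝕛 J)
            (≐-trans (•-cong ΣJ≈1 (≐-refl {𝕛})) (•-identity 𝕛)))) (A.-‿inverseʳ 𝕛))
      in projection-rank P λ (k , R) → ret (0≤-resp
           (trans (τφ-⊖ 𝟙 J) (trans (+-cong τφ (-‿cong (trans (at (⊛-• y φ 𝕛) ε) (trans (*-congˡ τφ𝕛) (zeroʳ y)))))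
             (trans (+-congˡ -0#≈0#) (+-identityʳ _))))
           (positive (suc k) ℕₚ.≤-refl P R pj≐𝟘))

-- The left ideal of a primitive projection as an irreducible representation

module LeftIdeal (S : StarField) {n : ℕ} (_∙_ : Fin n → Fin n → Fin n) (ε : Fin n)
                (_⁻¹ : Fin n → Fin n) (isGroup : IsGroup _≡_ _∙_ ε _⁻¹) where
  open StarField S hiding (zero)
  open Scalars S
  open GroupAlgebra S _∙_ ε _⁻¹ isGroup
  open Projections S _∙_ ε _⁻¹ isGroup
  open Splitting S _∙_ ε _⁻¹ isGroup
  open Primitive S _∙_ ε _⁻¹ isGroup
  open Positivity S _∙_ ε _⁻¹ isGroup
  open IsProjection
  open IsGroup isGroup using () renaming (inverseˡ to ∙-inverseˡ)

  module _ {p k} (R : HasRank p k) where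
    open HasRank R
    open OrthoFamily family

    ρ : Fin n → Fin k → Fin k → Carrier
    ρ g i j = coeffs (shift g (basis j)) i

    proj-fixes : ∀ {a} → a ⊛ p ≐ a → proj a ≐ a
    proj-fixes ap≐a = ≐-trans (proj-⊛ _) ap≐a

    shift-⊛p : ∀ g {a} → a ⊛ p ≐ a → shift g a ⊛ p ≐ shift g a
    shift-⊛p g {a} ap≐a = ≐-trans (≐-sym (shift-⊛ g a p)) (shift-cong g ap≐a)

    -- ρ g is the matrix of left translation by g.
    coeffs-shift : ∀ g {a} → a ⊛ p ≐ a → ∀ i → coeffs (shift g a) i ≈ sum λ j → ρ g i j * coeffs a j
    coeffs-shift g {a} ap≐a i = begin
      coeffs (shift g a) i
        ≈⟨ coeffs-cong (shift-cong g (proj-fixes ap≐a)) i ⟨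
      coeffs (lincomb (coeffs a) (λ j → shift g (basis j))) i
        ≈⟨ coeffs-lincomb (coeffs a) (λ j → shift g (basis j)) i ⟩
      sum (λ j → coeffs a j * ρ g i j)
        ≈⟨ sum-cong (λ j → *-comm _ _) ⟩
      sum (λ j → ρ g i j * coeffs a j) ∎
      where open ≈-Reasoning

    ρ-identity : ∀ i j → ρ ε i j ≈ δ i j
    ρ-identity i j = trans (coeffs-cong (shift-ε (basis j)) i) (ortho i j)

    ρ-homo : ∀ g h i l → ρ (g ∙ h) i l ≈ sum λ j → ρ g i j * ρ h j l
    ρ-homo g h i l = trans (coeffs-cong (shift-∙ g h (basis l)) i) (coeffs-shift g (shift-⊛p h (basis-⊛ l)) i)

    span : (Fin k → Carrier) → A
    span c = lincomb c basis

    span-⊛p : ∀ c → span c ⊛ p ≐ span c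
    span-⊛p c = ≐-trans (≐-sym (proj-⊛ (span c))) (lincomb-cong basis (coeffs-span c))

    act : Fin n → (Fin k → Carrier) → (Fin k → Carrier)
    act g v i = sum λ j → ρ g i j * v j

    act-coeffs : ∀ g v i → act g v i ≈ coeffs (shift g (span v)) i
    act-coeffs g v i = trans (sum-cong λ j → *-congˡ (sym (coeffs-span v j))) (sym (coeffs-shift g (span-⊛p v) i))

    -- Invariant subspaces in terms of the abstract `sum` and of the group on `Fin n`; `invariant`
    -- translates from the definition for G.
    record IsInvariant (Q : (Fin k → Carrier) → Set) : Set where
      field
        inv-resp : ∀ {v w} → (∀ i → v i ≈ w i) → Q v → Q w
        inv-0    : Q (λ _ → 0#)
        inv-+    : ∀ {v w} → Q v → Q w → Q (λ i → v i + w i)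
        inv-*    : ∀ c {v} → Q v → Q (λ i → c * v i)
        inv-act  : ∀ g {v} → Q v → Q (act g v)

      inv-sum : ∀ {m} (t : Fin m → Fin k → Carrier) → (∀ g → Q (t g)) → Q (λ i → sum λ g → t g i)
      inv-sum {zero}  t h = inv-resp (λ i → sym (sum-[] λ g → t g i)) inv-0
      inv-sum {suc m} t h = inv-resp (λ i → sym (sum-∷ λ g → t g i)) (inv-+ (h zero) (inv-sum (t ∘ suc) (h ∘ suc)))

    module _ {t} (P : IsProjection p) (τt≈1 : τ⁻¹ p t) (prim : IsPrimitive p t) where

      -- For v ≠ 0 with a = span v, a*a is a nonzero multiple of p, so every w = wp is in ℂG a.
      invariant-full : ∀ {Q} → IsInvariant Q → ∀ v → Q v → ∀ {y} → N (span v) * y ≈ 1# → ∀ u → Q u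
      invariant-full {Q} inv v v∈Q {y} Ny≈1 u = inv-resp u≈ (inv-sum (λ g i → d g * act g v i) λ g → inv-* (d g) (inv-act g v∈Q))
        where
        open IsInvariant inv
        a w d : A
        a = span v
        w = span u
        d = (y * τ p) • (w ⊛ star a)
        a*a : star a ⊛ a ≐ (N a * t) • p
        a*a = begin
          star a ⊛ a                    ≈⟨ ⊛-cong (star-cong (span-⊛p v)) (span-⊛p v) ⟨
          star (a ⊛ p) ⊛ (a ⊛ p)        ≈⟨ ⊛-cong (≐-trans (star-⊛ a p) (⊛-cong (self-adjoint P) (≐-refl {star a}))) (≐-refl {a ⊛ p}) ⟩
          (p ⊛ star a) ⊛ (a ⊛ p)        ≈⟨ ≐-trans (≐-sym (⊛-assoc (p ⊛ star a) a p)) (⊛-cong (⊛-assoc p (star a) a) (≐-refl {p})) ⟩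
          p ⊛ (star a ⊛ a) ⊛ p          ≈⟨ prim (star a ⊛ a) ⟩
          (τ (p ⊛ (star a ⊛ a) ⊛ p) * t) • p ≈⟨ •-cong (*-congʳ τ≈Na) (≐-refl {p}) ⟩
          (N a * t) • p                 ∎
          where
          open ≐-Reasoning
          τ≈Na : τ (p ⊛ (star a ⊛ a) ⊛ p) ≈ N a
          τ≈Na = trans (at (≐-trans (⊛-cong (≐-sym (⊛-assoc p (star a) a)) (≐-refl {p})) (≐-trans (⊛-assoc (p ⊛ star a) a p)
              (⊛-cong (≐-trans (⊛-cong (≐-sym (self-adjoint P)) (≐-refl {star a})) (≐-trans (≐-sym (star-⊛ a p)) (star-cong (span-⊛p v))))
                      (span-⊛p v)))) ε)
            (trans (τ-comm (star a) a) (sym (⟪⟫-τ a a)))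
        w≐da : w ≐ d ⊛ a
        w≐da = begin
          w                                    ≈⟨ span-⊛p u ⟨
          w ⊛ p                                ≈⟨ •-identity (w ⊛ p) ⟨
          1# • (w ⊛ p)                         ≈⟨ •-cong scale≈1 (≐-refl {w ⊛ p}) ⟨
          (y * τ p * (N a * t)) • (w ⊛ p)      ≈⟨ •-• (y * τ p) (N a * t) (w ⊛ p) ⟨
          (y * τ p) • ((N a * t) • (w ⊛ p))    ≈⟨ •-congˡ _ (⊛-• (N a * t) w p) ⟨
          (y * τ p) • (w ⊛ ((N a * t) • p))    ≈⟨ •-congˡ _ (⊛-cong (≐-refl {w}) a*a) ⟨
          (y * τ p) • (w ⊛ (star a ⊛ a))       ≈⟨ •-congˡ _ (⊛-assoc w (star a) a) ⟨
          (y * τ p) • (w ⊛ star a ⊛ a)         ≈⟨ •-⊛ (y * τ p) (w ⊛ star a) a ⟨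
          d ⊛ a                                ∎
          where
          open ≐-Reasoning
          scale≈1 : y * τ p * (N a * t) ≈ 1#
          scale≈1 = trans (solve 4 (λ y q m t → y :* q :* (m :* t) := (m :* y) :* (q :* t)) refl y (τ p) (N a) t)
            (trans (*-cong Ny≈1 τt≈1) (*-identityˡ 1#))
        u≈ : ∀ i → sum (λ g → d g * act g v i) ≈ u i
        u≈ i = begin
          sum (λ g → d g * act g v i)
            ≈⟨ sum-cong (λ g → *-congˡ (act-coeffs g v i)) ⟩
          sum (λ g → d g * coeffs (shift g a) i)
            ≈⟨ coeffs-lincomb d (λ g → shift g a) i ⟨
          coeffs (d ⊛ a) i
            ≈⟨ coeffs-cong w≐da i ⟨
          coeffs w i
            ≈⟨ coeffs-span u i ⟩
          u i ∎
          where open ≈-Reasoning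

      -- To refute `¬zero` it suffices that each coordinate of each v in `Q` vanishes, which is a
      -- stable equation. A coordinate that did not vanish would make the norm of `span v`
      -- invertible, and `invariant-full` would contradict `¬full`.
      irreducible : ∀ {Q} → IsInvariant Q → ¬ (¬ (∀ v → Q v → ∀ i → v i ≈ 0#) × ¬ (∀ v → Q v))
      irreducible inv (¬zero , ¬full) = ¬zero λ v v∈Q i → ≈-stable λ vi≉0 →
        reciprocal (0≤N (span v)) (λ N≈0′ → vi≉0 (trans (sym (coeffs-span v i))
            (trans (*-congˡ (trans (⟪⟫-cong (N≈0 N≈0′) (≐-refl {basis i})) (sum≈0 {n} λ x → zeroˡ _))) (zeroʳ _))))
          λ (y , _ , Ny≈1) → ¬full (invariant-full inv v v∈Q Ny≈1)

      p≢𝟘 : ¬ p ≐ 𝟘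
      p≢𝟘 e = 1≉0 (trans (sym τt≈1) (trans (*-congʳ (at e ε)) (zeroˡ t)))

      -- Under a trivial action `p` equals all its translates and is constant; then n τ(p) is the
      -- sum of its coefficients, which is 0.
      nontrivial : p ⊛ 𝕛 ≐ 𝟘 → ¬ (∀ g i j → ρ g i j ≈ δ i j)
      nontrivial pj≐𝟘 triv = p≢𝟘 (τ≈0 P (≈-stable λ τp≉0 → n≉0′ τp≉0))
        where
        shift-p : ∀ g → shift g p ≐ p
        shift-p g = ≐-trans (≐-sym (proj-fixes (shift-⊛p g (idempotent P))))
          (≐-trans (lincomb-cong basis λ i → trans (coeffs-shift g (idempotent P) i)
            (trans (sum-cong λ j → *-congʳ (triv g i j)) (sum-δ i (coeffs p)))) (proj-fixes (idempotent P)))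
        n*τp≈0 : ι (fromℕ n) * τ p ≈ 0#
        n*τp≈0 = trans (sym (sum-const n (τ p))) (trans (sum-cong λ x →
            trans (ap p (≡.sym (∙-inverseˡ x))) (trans (at (shift-p x) x) (sym (*-identityʳ (p x)))))
          (at pj≐𝟘 ε))
        n≉0′ : ¬ ¬ τ p ≈ 0#
        n≉0′ τp≉0 = reciprocal (0≤-ι (0≤fromℕ n)) n≉0 λ (y , _ , ny≈1) →
          τp≉0 (cancel y (trans (*-comm _ _) ny≈1) (trans (*-comm _ _) n*τp≈0))

      rank≢0′ : ¬ k ≡ 0
      rank≢0′ = rank≢0 P R p≢𝟘

-- Fractions, list sums and counting

module Averages where
  open ≡ using (refl)
  open RationalPowers using (toℚᵘ-fromℕ)
  open +-*-Solver

  -- Characterises a fraction by its product with the denominator, computed among the unnormalised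
  -- rationals, where no gcd intervenes.
  /-*-fromℕ : ∀ k m .{{_ : ℕ.NonZero m}} → (+ k ℚ./ m) ℚ.* fromℕ m ≡ fromℕ k
  /-*-fromℕ k (suc m) = ℚₚ.toℚᵘ-injective (ℚᵘₚ.≃-trans (ℚₚ.toℚᵘ-homo-* (+ k ℚ./ suc m) (fromℕ (suc m)))
    (ℚᵘₚ.≃-trans (ℚᵘₚ.*-cong (ℚₚ.toℚᵘ-fromℚᵘ (ℚᵘ.mkℚᵘ (+ k) m)) (toℚᵘ-fromℕ (suc m)))
      (ℚᵘₚ.≃-trans (ℚᵘ.*≡* (cancel-suc k m)) (ℚᵘₚ.≃-sym (toℚᵘ-fromℕ k)))))
    where
    cancel-suc : ∀ k m → (+ k ℤ.* + suc m) ℤ.* + 1 ≡ + k ℤ.* + (suc m ℕ.* 1)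
    cancel-suc k m = ≡.trans (ℤₚ.*-identityʳ _) (cong (λ l → + k ℤ.* + l) (≡.sym (ℕₚ.*-identityʳ (suc m))))

  listSum : ∀ {a} {X : Set a} → (X → ℚ) → List X → ℚ
  listSum g L = List.foldr ℚ._+_ 0ℚ (List.map g L)

  listSum-++ : ∀ {a} {X : Set a} (g : X → ℚ) K L → listSum g (K ++ L) ≡ listSum g K ℚ.+ listSum g L
  listSum-++ g []      L = ≡.sym (ℚₚ.+-identityˡ _)
  listSum-++ g (x ∷ K) L = ≡.trans (cong (g x ℚ.+_) (listSum-++ g K L)) (≡.sym (ℚₚ.+-assoc (g x) _ _))

  length-cartesianProduct : ∀ {a b} {X : Set a} {Y : Set b} (xs : List X) (ys : List Y) →
    List.length (List.cartesianProduct xs ys) ≡ List.length xs ℕ.* List.length ys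
  length-cartesianProduct []       ys = refl
  length-cartesianProduct (x ∷ xs) ys = ≡.trans (Listₚ.length-++ (List.map (x ,_) ys))
    (cong₂ ℕ._+_ (Listₚ.length-map (x ,_) ys) (length-cartesianProduct xs ys))

  module _ {a p} {X : Set a} {P : Pred X p} (P? : Decidable P) (g : X → ℚ)
           (g-yes : ∀ {x} → P x → g x ≡ 1ℚ) (g-no : ∀ {x} → ¬ P x → g x ≡ ℚ.- 1ℚ) where

    -- An agreement adds 2 = 1 + 1 on both sides, a disagreement 0 = -1 + 1.
    listSum-filter : ∀ L → fromℕ (List.length (List.filter P? L)) ℚ.+ fromℕ (List.length (List.filter P? L))
      ≡ listSum g L ℚ.+ fromℕ (List.length L)
    listSum-filter [] = refl
    listSum-filter (x ∷ L) with P? x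
    ... | yes px = ≡.trans
      (solve 1 (λ c → (con 1ℚ :+ c) :+ (con 1ℚ :+ c) := (con 1ℚ :+ con 1ℚ) :+ (c :+ c)) refl
         (fromℕ (List.length (List.filter P? L))))
      (≡.trans (cong ((1ℚ ℚ.+ 1ℚ) ℚ.+_) (listSum-filter L))
        (≡.trans (solve 2 (λ s l → (con 1ℚ :+ con 1ℚ) :+ (s :+ l) := (con 1ℚ :+ s) :+ (con 1ℚ :+ l)) refl (listSum g L) (fromℕ (List.length L)))
          (cong (λ y → (y ℚ.+ listSum g L) ℚ.+ (1ℚ ℚ.+ fromℕ (List.length L))) (≡.sym (g-yes px)))))
    ... | no ¬px = ≡.trans (listSum-filter L)
        (≡.trans (solve 2 (λ s l → s :+ l := ((:- con 1ℚ) :+ s) :+ (con 1ℚ :+ l)) refl (listSum g L) (fromℕ (List.length L)))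
          (cong (λ y → (y ℚ.+ listSum g L) ℚ.+ (1ℚ ℚ.+ fromℕ (List.length L))) (≡.sym (g-no ¬px))))

  -- With T = ∑ f(x) f(y) f(xy), c the number of agreements and ν = 1/N².
  agreement-bound : ∀ c T N D ν δ → c ℚ.+ c ≡ T ℚ.+ N ℚ.* N → ν ℚ.* (N ℚ.* N) ≡ 1ℚ → δ ℚ.* D ≡ 1ℚ →
    0ℚ ℚ.≤ ν → 0ℚ ℚ.≤ δ → 0ℚ ℚ.≤ δ ℚ.* (N ℚ.* N) ℚ.- T → c ℚ.* ν ℚ.≤ ½ ℚ.* (1ℚ ℚ.+ δ)
  agreement-bound c T N D ν δ c+c≡ νNN≡1 δD≡1 0≤ν 0≤δ 0≤δNN-T =
    Rationals.≤-offset {½ ℚ.* ν ℚ.* (δ ℚ.* (N ℚ.* N) ℚ.- T)}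
      (Rationals.0≤p*q (Rationals.0≤p*q (ℚₚ.<⇒≤ Rationals.0<½) 0≤ν) 0≤δNN-T) (begin
        ½ ℚ.* (1ℚ ℚ.+ δ)
          ≡⟨ solve 1 (λ d → con ½ :* (con 1ℚ :+ d) := con ½ :* (con 1ℚ :+ d :* con 1ℚ)) refl δ ⟩
        ½ ℚ.* (1ℚ ℚ.+ δ ℚ.* 1ℚ)
          ≡⟨ cong (λ o → ½ ℚ.* (o ℚ.+ δ ℚ.* o)) νNN≡1 ⟨
        ½ ℚ.* (ν ℚ.* (N ℚ.* N) ℚ.+ δ ℚ.* (ν ℚ.* (N ℚ.* N)))
          ≡⟨ solve 4 (λ v m d t → con ½ :* (v :* m :+ d :* (v :* m)) := con ½ :* v :* (t :+ m) :+ con ½ :* v :* (d :* m :- t)) refl ν (N ℚ.* N) δ T ⟩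
        ½ ℚ.* ν ℚ.* (T ℚ.+ N ℚ.* N) ℚ.+ ½ ℚ.* ν ℚ.* (δ ℚ.* (N ℚ.* N) ℚ.- T)
          ≡⟨ cong (λ u → ½ ℚ.* ν ℚ.* u ℚ.+ ½ ℚ.* ν ℚ.* (δ ℚ.* (N ℚ.* N) ℚ.- T)) c+c≡ ⟨
        ½ ℚ.* ν ℚ.* (c ℚ.+ c) ℚ.+ ½ ℚ.* ν ℚ.* (δ ℚ.* (N ℚ.* N) ℚ.- T)
          ≡⟨ cong (ℚ._+ ½ ℚ.* ν ℚ.* (δ ℚ.* (N ℚ.* N) ℚ.- T)) (solve 2 (λ v c → con ½ :* v :* (c :+ c) := c :* v) refl ν c) ⟩
        c ℚ.* ν ℚ.+ ½ ℚ.* ν ℚ.* (δ ℚ.* (N ℚ.* N) ℚ.- T) ∎)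
    where open ≡.≡-Reasoning

module ListSums (S : StarField) where
  open StarField S hiding (zero)
  open Scalars S
  open Averages

  sum-tabulate : ∀ {a} {X : Set a} (g : X → ℚ) {m} (u : Fin m → X) →
    sum (λ i → ι (g (u i))) ≈ ι (listSum g (List.tabulate u))
  sum-tabulate g {zero}  u = trans (sum-[] λ i → ι (g (u i))) (sym ι-0)
  sum-tabulate g {suc m} u = trans (sum-∷ λ i → ι (g (u i)))
    (trans (+-congˡ (sum-tabulate g (u ∘ suc))) (sym (ι-+ (g (u zero)) _)))

  sum-cartesianProduct : ∀ {a b} {X : Set a} {Y : Set b} (g : X × Y → ℚ) {l m} (u : Fin l → X) (v : Fin m → Y) →
    sum (λ i → sum λ j → ι (g (u i , v j))) ≈ ι (listSum g (List.cartesianProduct (List.tabulate u) (List.tabulate v)))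
  sum-cartesianProduct g {zero}  u v = trans (sum-[] λ i → sum λ j → ι (g (u i , v j))) (sym ι-0)
  sum-cartesianProduct g {suc l} u v = trans (sum-∷ λ i → sum λ j → ι (g (u i , v j)))
    (trans (+-cong (sum-tabulate (λ y → g (u zero , y)) v) (sum-cartesianProduct g (u ∘ suc) v))
      (trans (sym (ι-+ _ _)) (reflexive (cong ι (≡.sym (≡.trans
        (listSum-++ g (List.map (u zero ,_) (List.tabulate v)) _)
        (cong (ℚ._+ listSum g (List.cartesianProduct (List.tabulate (u ∘ suc)) (List.tabulate v)))
          (cong (List.foldr ℚ._+_ 0ℚ) (≡.sym (Listₚ.map-∘ (List.tabulate v)))))))))))

-- Transfer to the given group

module Agreement {c ℓ} (G : FiniteGroup c ℓ) where
  open FiniteGroup G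
  open Inverse enumeration using (from-cong; strictlyInverseˡ; strictlyInverseʳ)
  open Averages
  open Rationals using (0≤p*q; 0≤p+q)

  n : ℕ
  n = order

  -- The group is moved to `Fin n`, where equality is propositional, so that arbitrary functions on
  -- it respect equality.
  _∙′_ : Fin n → Fin n → Fin n
  i ∙′ j = index (element i ∙ element j)

  ε′ : Fin n
  ε′ = index ε

  _⁻¹′ : Fin n → Fin n
  i ⁻¹′ = index (element i ⁻¹)

  element-∙ : ∀ i j → element (i ∙′ j) ≈ element i ∙ element j
  element-∙ i j = strictlyInverseˡ _

  element-⁻¹ : ∀ i → element (i ⁻¹′) ≈ element i ⁻¹
  element-⁻¹ i = strictlyInverseˡ _

  index-∙ : ∀ x y → index (x ∙ y) ≡ index x ∙′ index y
  index-∙ x y = from-cong (sym (∙-cong (strictlyInverseˡ x) (strictlyInverseˡ y)))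

  isGroup′ : IsGroup _≡_ _∙′_ ε′ _⁻¹′
  isGroup′ = record
    { isMonoid = record
      { isSemigroup = record
        { isMagma = record { isEquivalence = ≡.isEquivalence ; ∙-cong = cong₂ _∙′_ }
        ; assoc = λ i j k → from-cong (trans (∙-congʳ (element-∙ i j))
            (trans (assoc _ _ _) (∙-congˡ (sym (element-∙ j k))))) }
      ; identity = (λ i → ≡.trans (from-cong (trans (∙-congʳ (strictlyInverseˡ ε)) (identityˡ _))) (strictlyInverseʳ i))
                 , (λ i → ≡.trans (from-cong (trans (∙-congˡ (strictlyInverseˡ ε)) (identityʳ _))) (strictlyInverseʳ i)) }
    ; inverse = (λ i → from-cong (trans (∙-congʳ (element-⁻¹ i)) (inverseˡ _)))
              , (λ i → from-cong (trans (∙-congˡ (element-⁻¹ i)) (inverseʳ _)))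
    ; ⁻¹-cong = cong _⁻¹′ }

  S : StarField
  S = ComplexStarField.ℂ-starField

  private
    module K = StarField S
  open Scalars S
  open GroupAlgebra S _∙′_ ε′ _⁻¹′ isGroup′
  open Projections S _∙′_ ε′ _⁻¹′ isGroup′
  open Primitive S _∙′_ ε′ _⁻¹′ isGroup′
  open Positivity S _∙′_ ε′ _⁻¹′ isGroup′
  module L = LeftIdeal S _∙′_ ε′ _⁻¹′ isGroup′

  module _ {p k} (R : HasRank p k) where

    representation : Representation G k
    representation = record
      { ρ      = λ x → L.ρ R (index x)
      ; ρ-cong = λ x≈y i j → K.reflexive (cong (λ g → L.ρ R g i j) (from-cong x≈y))
      ; ρ-ε    = L.ρ-identity R
      ; ρ-∙    = λ x y i j → K.trans (K.reflexive (cong (λ g → L.ρ R g i j) (index-∙ x y)))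
          (K.trans (L.ρ-homo R (index x) (index y) i j)
            (K.reflexive (sum≡ λ l → L.ρ R (index x) i l K.* L.ρ R (index y) l j)))
      }

    invariant : ∀ {Q} → IsInvariantSubspace representation Q → L.IsInvariant R Q
    invariant {Q} inv = record
      { inv-resp = resp
      ; inv-0    = zero∈
      ; inv-+    = +-closed
      ; inv-*    = λ c → *-closed c
      ; inv-act  = λ g {v} v∈Q → resp (λ i → K.trans
          (K.reflexive (≡.sym (sum≡ λ j → L.ρ R (index (element g)) i j K.* v j)))
          (K.reflexive (cong (λ h → L.act R h v i) (strictlyInverseʳ g)))) (ρ-closed (element g) v∈Q) }
      where open IsInvariantSubspace inv

    nontrivialIrrep : ∀ {t} → IsProjection p → τ⁻¹ p t → IsPrimitive p t → p ⊛ 𝕛 ≐ 𝟘 → NontrivialIrrep G k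
    nontrivialIrrep P τt≈1 prim pj≐𝟘 = record
      { rep         = representation
      ; irreducible = record
        { n-nonZero = ℕ.≢-nonZero (L.rank≢0′ R P τt≈1 prim)
        ; no-proper = λ Q inv → L.irreducible R P τt≈1 prim (invariant inv) }
      ; nontrivial  = λ triv → L.nontrivial R P τt≈1 prim pj≐𝟘 λ g i j →
          K.trans (K.reflexive (cong (λ h → L.ρ R h i j) (≡.sym (strictlyInverseʳ g)))) (triv (element g) i j) }

  module _ (f : Carrier → Sign) (f-class : IsClassFunction G f) (f-mean : 𝔼 (λ x → toℚ (f x)) ≡ 0ℚ)
           (d : ℕ) (d-min : IsMinNontrivialDim G d) where
    open IsClassFunction f-class
    open ListSums S

    f′ : A
    f′ i = K.ι (toℚ (f (element i)))

    f′-class : IsClass f′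
    f′-class i j = K.reflexive (cong (λ s → K.ι (toℚ s)) (≡.trans
      (f-cong (trans (element-∙ i _) (trans (∙-congˡ (trans (element-∙ j _) (∙-congˡ (element-⁻¹ i))))
        (trans (sym (assoc _ _ _)) (∙-congʳ (∙-congʳ (sym (⁻¹-involutive (element i)))))))))
      -- Conjugation by the inverse turns the form x⁻¹yx of the hypothesis into the form xyx⁻¹ of
      -- `IsClass`.
      (f-conjugacy (element i ⁻¹) (element j))))
      where open Algebra.Properties.Group group using (⁻¹-involutive)

    toℚ² : ∀ s → toℚ s ℚ.* toℚ s ≡ 1ℚ
    toℚ² Sign.+ = ≡.refl
    toℚ² Sign.- = ≡.refl

    N-f′ : N f′ K.≈ K.ι (fromℕ n)
    N-f′ = K.trans (sum-cong λ i → K.trans (K.*-congˡ (conj-ι (toℚ (f (element i)))))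
        (K.trans (K.sym (K.ι-* (toℚ (f (element i))) (toℚ (f (element i)))))
          (K.trans (K.reflexive (cong K.ι (toℚ² (f (element i))))) K.ι-1)))
      (K.trans (sum-const n K.1#) (K.*-identityʳ _))

    Σf≡0 : listSum (toℚ ∘ f) elements ≡ 0ℚ
    Σf≡0 = begin
      s                                          ≡⟨ ℚₚ.*-identityʳ s ⟨
      s ℚ.* 1ℚ                                   ≡⟨ cong (s ℚ.*_) (/-*-fromℕ 1 n) ⟨
      s ℚ.* ((+ 1 ℚ./ n) ℚ.* fromℕ n)            ≡⟨ ℚₚ.*-assoc s (+ 1 ℚ./ n) (fromℕ n) ⟨
      s ℚ.* (+ 1 ℚ./ n) ℚ.* fromℕ n              ≡⟨ cong (ℚ._* fromℕ n) f-mean ⟩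
      0ℚ ℚ.* fromℕ n                             ≡⟨ ℚₚ.*-zeroˡ (fromℕ n) ⟩
      0ℚ                                         ∎
      where
      open ≡.≡-Reasoning
      s = listSum (toℚ ∘ f) elements

    Σf′≈0 : sum f′ K.≈ K.0#
    Σf′≈0 = K.trans (sum-tabulate (toℚ ∘ f) element) (K.trans (K.reflexive (cong K.ι Σf≡0)) K.ι-0)

    -- Among signs st = u holds exactly if stu = 1, and stu = -1 otherwise.
    agreement : Carrier × Carrier → ℚ
    agreement (x , y) = toℚ (f x) ℚ.* (toℚ (f y) ℚ.* toℚ (f (x ∙ y)))

    pairs : List (Carrier × Carrier)
    pairs = List.cartesianProduct elements elements

    T : ℚ
    T = listSum agreement pairs

    ⟪f′f′,f′⟫ : ⟪ f′ ⊛ f′ , f′ ⟫ K.≈ K.ι T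
    ⟪f′f′,f′⟫ = begin
      sum (λ x → (sum λ y → f′ y K.* f′ ((y ⁻¹′) ∙′ x)) K.* K.conj (f′ x))
        ≈⟨ sum-cong (λ x → *-distribʳ-sum (K.conj (f′ x)) λ y → f′ y K.* f′ ((y ⁻¹′) ∙′ x)) ⟩
      sum (λ x → sum λ y → f′ y K.* f′ ((y ⁻¹′) ∙′ x) K.* K.conj (f′ x))
        ≈⟨ ∑-comm (λ x y → f′ y K.* f′ ((y ⁻¹′) ∙′ x) K.* K.conj (f′ x)) ⟩
      sum (λ y → sum λ x → f′ y K.* f′ ((y ⁻¹′) ∙′ x) K.* K.conj (f′ x))
        -- Replacing x by yx turns f(y) f(y⁻¹x) f(x) into f(y) f(x) f(yx).
        ≈⟨ sum-cong (λ y → K.trans (reindexˡ y λ x → f′ y K.* f′ ((y ⁻¹′) ∙′ x) K.* K.conj (f′ x)) (sum-cong (term y))) ⟩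
      sum (λ y → sum λ x → K.ι (agreement (element y , element x)))
        ≈⟨ sum-cartesianProduct agreement element element ⟩
      K.ι T ∎
      where
      open ≈-Reasoning
      group′ : Group _ _
      group′ = record { isGroup = isGroup′ }
      open Algebra.Properties.Group group′ using (\\-leftDividesʳ)
      term : ∀ y x → f′ y K.* f′ ((y ⁻¹′) ∙′ (y ∙′ x)) K.* K.conj (f′ (y ∙′ x)) K.≈ K.ι (agreement (element y , element x))
      term y x = K.trans (K.*-cong (K.*-congˡ (ap f′ (\\-leftDividesʳ y x))) (K.trans (conj-ι _)
          (K.reflexive (cong (λ s → K.ι (toℚ s)) (f-cong (element-∙ y x))))))
        (K.trans (K.*-assoc _ _ _) (K.sym (K.trans (K.ι-* _ _) (K.*-congˡ (K.ι-* _ _)))))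

    toℚ-agree : ∀ s t u → s Sign.* t ≡ u → toℚ s ℚ.* (toℚ t ℚ.* toℚ u) ≡ 1ℚ
    toℚ-agree Sign.+ Sign.+ _ ≡.refl = ≡.refl
    toℚ-agree Sign.+ Sign.- _ ≡.refl = ≡.refl
    toℚ-agree Sign.- Sign.+ _ ≡.refl = ≡.refl
    toℚ-agree Sign.- Sign.- _ ≡.refl = ≡.refl

    toℚ-disagree : ∀ s t u → ¬ s Sign.* t ≡ u → toℚ s ℚ.* (toℚ t ℚ.* toℚ u) ≡ ℚ.- 1ℚ
    toℚ-disagree Sign.+ Sign.+ Sign.+ ne = ⊥-elim (ne ≡.refl)
    toℚ-disagree Sign.+ Sign.+ Sign.- ne = ≡.refl
    toℚ-disagree Sign.+ Sign.- Sign.+ ne = ≡.refl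
    toℚ-disagree Sign.+ Sign.- Sign.- ne = ⊥-elim (ne ≡.refl)
    toℚ-disagree Sign.- Sign.+ Sign.+ ne = ≡.refl
    toℚ-disagree Sign.- Sign.+ Sign.- ne = ⊥-elim (ne ≡.refl)
    toℚ-disagree Sign.- Sign.- Sign.+ ne = ⊥-elim (ne ≡.refl)
    toℚ-disagree Sign.- Sign.- Sign.- ne = ≡.refl

    private
      instance
        d-nonZero : ℕ.NonZero d
        d-nonZero = minDim-nonZero d-min

    δ′ : ℚ
    δ′ = + 1 ℚ./ d

    0≤+/ : ∀ k m .{{_ : ℕ.NonZero m}} → 0ℚ ℚ.≤ + k ℚ./ m
    0≤+/ k m = ℚₚ.nonNegative⁻¹ (+ k ℚ./ m) {{ℚₚ.normalize-nonNeg k m}}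

    κ : ℚ
    κ = (fromℕ n ℚ.+ fromℕ n) ℚ.* δ′

    κd≡2n : κ ℚ.* fromℕ d ≡ fromℕ n ℚ.+ fromℕ n
    κd≡2n = ≡.trans (ℚₚ.*-assoc (fromℕ n ℚ.+ fromℕ n) δ′ (fromℕ d))
      (≡.trans (cong ((fromℕ n ℚ.+ fromℕ n) ℚ.*_) (/-*-fromℕ 1 d)) (ℚₚ.*-identityʳ _))

    -- As `T` is real, `convolution-bound` reads 2T ≤ κ n = 2n²/d. Its hypothesis on ranks is met
    -- because the left ideal of a primitive p with ∑ p = 0 is a nontrivial irreducible
    -- representation of G.
    T-bound : 0ℚ ℚ.≤ δ′ ℚ.* (fromℕ n ℚ.* fromℕ n) ℚ.- T
    T-bound = subst (0ℚ ℚ.≤_) halve (0≤p*q {½} (ℚₚ.<⇒≤ Rationals.0<½) (K.0≤-ι⁻¹ (K.0≤-resp collect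
      (convolution-bound f′-class N-f′ Σf′≈0 (ℕ.>-nonZero⁻¹ d)
        (K.0≤-ι (0≤p*q (0≤p+q (0≤fromℕ n) (0≤fromℕ n)) (0≤+/ 1 d)))
        (K.trans (K.sym (K.ι-* κ (fromℕ d))) (K.trans (K.reflexive (cong K.ι κd≡2n)) (K.ι-+ (fromℕ n) (fromℕ n))))
        (λ P τt≈1 prim R pj≐𝟘 → proj₂ d-min (nontrivialIrrep R P τt≈1 prim pj≐𝟘))))))
      where
      S₂ = ⟪ f′ ⊛ f′ , f′ ⟫
      collect : (K.ι κ K.* K.ι (fromℕ n)) K.- (S₂ K.+ K.conj S₂) K.≈ K.ι (κ ℚ.* fromℕ n ℚ.- (T ℚ.+ T))
      collect = K.trans (K.+-cong (K.sym (K.ι-* κ (fromℕ n))) (K.-‿cong (K.trans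
          (K.+-cong ⟪f′f′,f′⟫ (K.trans (K.conj-cong ⟪f′f′,f′⟫) (conj-ι T))) (K.sym (K.ι-+ T T)))))
        (K.trans (K.+-congˡ (K.sym (K.ι-neg (T ℚ.+ T)))) (K.sym (K.ι-+ (κ ℚ.* fromℕ n) (ℚ.- (T ℚ.+ T)))))
      halve : ½ ℚ.* (κ ℚ.* fromℕ n ℚ.- (T ℚ.+ T)) ≡ δ′ ℚ.* (fromℕ n ℚ.* fromℕ n) ℚ.- T
      halve = solve 3 (λ n d t → con ½ :* ((n :+ n) :* d :* n :- (t :+ t)) := d :* (n :* n) :- t) ≡.refl (fromℕ n) δ′ T
        where open +-*-Solver

    agree? : Decidable {A = Carrier × Carrier} (uncurry λ x y → f x Sign.* f y ≡ f (x ∙ y))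
    agree? = uncurry λ x y → f x Sign.* f y Signₚ.≟ f (x ∙ y)

    count : ℕ
    count = List.length (List.filter agree? pairs)

    ν : ℚ
    ν = + 1 ℚ./ (n ℕ.* n)

    ν-inverse : ν ℚ.* (fromℕ n ℚ.* fromℕ n) ≡ 1ℚ
    ν-inverse = ≡.trans (cong (ν ℚ.*_) (≡.sym (fromℕ-* n n))) (/-*-fromℕ 1 (n ℕ.* n))

    count-ν : fromℕ count ℚ.* ν ≡ + count ℚ./ (n ℕ.* n)
    count-ν = begin
      fromℕ count ℚ.* ν            ≡⟨ cong (ℚ._* ν) (/-*-fromℕ count (n ℕ.* n)) ⟨
      q ℚ.* fromℕ (n ℕ.* n) ℚ.* ν  ≡⟨ solve 3 (λ q m v → q :* m :* v := q :* (v :* m)) ≡.refl q (fromℕ (n ℕ.* n)) ν ⟩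
      q ℚ.* (ν ℚ.* fromℕ (n ℕ.* n)) ≡⟨ cong (q ℚ.*_) (/-*-fromℕ 1 (n ℕ.* n)) ⟩
      q ℚ.* 1ℚ                     ≡⟨ ℚₚ.*-identityʳ q ⟩
      q                            ∎
      where
      open ≡.≡-Reasoning
      open +-*-Solver
      q = + count ℚ./ (n ℕ.* n)

    2count : fromℕ count ℚ.+ fromℕ count ≡ T ℚ.+ fromℕ n ℚ.* fromℕ n
    2count = ≡.trans (listSum-filter agree? agreement
        (λ { {x , y} → toℚ-agree (f x) (f y) (f (x ∙ y)) }) (λ { {x , y} → toℚ-disagree (f x) (f y) (f (x ∙ y)) }) pairs)
      (cong (T ℚ.+_) (≡.trans (cong fromℕ length-pairs) (fromℕ-* n n)))
      where
      length-pairs : List.length pairs ≡ n ℕ.* n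
      length-pairs = ≡.trans (length-cartesianProduct elements elements)
        (cong₂ ℕ._*_ (Listₚ.length-tabulate element) (Listₚ.length-tabulate element))

    agreement-probability : + count ℚ./ (n ℕ.* n) ℚ.≤ ½ ℚ.* (1ℚ ℚ.+ δ′)
    agreement-probability = subst (ℚ._≤ ½ ℚ.* (1ℚ ℚ.+ δ′)) count-ν
      (agreement-bound (fromℕ count) T (fromℕ n) (fromℕ d) ν δ′ 2count ν-inverse (/-*-fromℕ 1 d)
        (0≤+/ 1 (n ℕ.* n)) (0≤+/ 1 d) T-bound)

open import Data.Rational.Base using (_+_; _≤_; _/_) renaming (_*_ to _*ℚ_)
open import Data.Sign.Base using (_*_)
open import Data.Sign.Properties using (_≟_)

theorem2 : ∀ {c ℓ} (G : FiniteGroup c ℓ) (let open FiniteGroup G)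
    (f : Carrier → Sign) → IsClassFunction G f →
    𝔼 (λ x → toℚ (f x)) ≡ 0ℚ →
    (d : ℕ) (d-min : IsMinNontrivialDim G d) →
    Pr (λ x y → f x * f y ≟ f (x ∙ y))
    ≤ ½ *ℚ (1ℚ + _/_ (+ 1) d {{minDim-nonZero d-min}})
theorem2 G = Agreement.agreement-probability G
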